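{- There is a universal constant $C>0$ such that for every $\delta\in(0,1]$ and every $\delta$-LCC configuration $V=(v_1,\ldots,v_m)\in(\mathbb{C}^d)^m$, we have $\dim(V)\le C/\delta^9$.
   Context: A list of non-zero points $(v_1,\ldots,v_m)$ in $\mathbb{C}^d$ (not necessarily distinct) is a $\delta$-LCC configuration if for every subset $\Delta\subseteq[m]$ of size at most $\delta m$ and every $i\in[m]$ there exist $j,k\in[m]\setminus\Delta$ such that either $v_i\in\{v_j,v_k\}$, or $v_i,v_j,v_k$ are three distinct collinear points. $\dim(V)$ is the dimension of the smallest affine subspace containing all points of the list.
   Formalization: The parameter δ ranges over rational numbers in (0,1] instead of real ones; the points may lie in K^d for any algebraically closed field K of characteristic 0, of which ℂ is an instance. -}

module Defs where

open import Level using (0ℓ)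
open import Data.Nat as ℕ using (ℕ; zero; suc)
open import Data.Fin using (Fin; zero; suc)
open import Data.Fin.Subset using (Subset; _∉_; ∣_∣)
open import Data.Product using (Σ; ∃; ∃-syntax; _×_; _,_)
open import Data.Sum using (_⊎_)
open import Relation.Nullary using (¬_)
open import Algebra.Bundles using (CommutativeRing)
open import Data.Rational as ℚ using (ℚ; _/_; _≤_)
open import Data.Rational.Properties using (pos⇒nonZero)

-- Algebraically closed fields of characteristic zero (ℂ is the model
-- the paper uses).

module RingOps (R : CommutativeRing 0ℓ 0ℓ) where
  open CommutativeRing R using (Carrier; 0#; 1#; _+_; _*_)
  natCast : ℕ → Carrier
  natCast zero    = 0#
  natCast (suc n) = 1# + natCast n
  pow : Carrier → ℕ → Carrier
  pow x zero    = 1#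
  pow x (suc n) = x * pow x n
  sumK : ∀ {n} → (Fin n → Carrier) → Carrier
  sumK {zero}  f = 0#
  sumK {suc n} f = f zero + sumK (λ i → f (suc i))

record ACF₀ : Set₁ where
  field
    cring : CommutativeRing 0ℓ 0ℓ
  open CommutativeRing cring public hiding (zero)
  open RingOps cring public
  field
    1≉0     : ¬ (1# ≈ 0#)
    inverse : ∀ x → ¬ (x ≈ 0#) → ∃[ y ] (x * y ≈ 1#)
    char0      : ∀ n → ¬ (natCast (suc n) ≈ 0#)
    algClosed  : ∀ n (a : Fin (suc n) → Carrier) →
                 ∃[ x ] (pow x (suc n) + sumK (λ i → a i * pow x (Data.Fin.toℕ i)) ≈ 0#)

_^ℚ_ : ℚ → ℕ → ℚ
q ^ℚ zero  = ℚ.1ℚ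
q ^ℚ suc n = q ℚ.* (q ^ℚ n)

bound : (C δ : ℚ) → ℚ.0ℚ ℚ.< δ → ℚ
bound C δ δ>0 = C ℚ.* ((ℚ.1/_ δ {{pos⇒nonZero δ {{ℚ.positive δ>0}}}}) ^ℚ 9)

module _ (K : ACF₀) where
  open ACF₀ K

  Point : ℕ → Set
  Point d = Fin d → Carrier

  _≈ᵥ_ : ∀ {d} → Point d → Point d → Set
  u ≈ᵥ v = ∀ l → u l ≈ v l

  NonZeroPoint : ∀ {d} → Point d → Set
  NonZeroPoint v = ¬ (∀ l → v l ≈ 0#)

  DistinctCollinear : ∀ {d} → Point d → Point d → Point d → Set
  DistinctCollinear u v w =
    ¬ (u ≈ᵥ v) × ¬ (u ≈ᵥ w) × ¬ (v ≈ᵥ w) ×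
    ∃[ t ] (∀ l → w l ≈ u l + t * (v l - u l))

  IsLCC : ∀ {d m} → ℚ → (Fin m → Point d) → Set
  IsLCC {d} {m} δ V =
    (∀ i → NonZeroPoint (V i)) ×
    (∀ (Δ : Subset m) → (ℤ.+ ∣ Δ ∣) / 1 ≤ δ ℚ.* ((ℤ.+ m) / 1) →
      ∀ i → ∃[ j ] ∃[ k ] (j ∉ Δ × k ∉ Δ ×
        ((V i ≈ᵥ V j ⊎ V i ≈ᵥ V k) ⊎ DistinctCollinear (V i) (V j) (V k))))
    where import Data.Integer as ℤ

  AffinelyIndependent : ∀ {d k} → (Fin (suc k) → Point d) → Set
  AffinelyIndependent {d} {k} p =
    ∀ (c : Fin k → Carrier) →
      (∀ l → sumK (λ i → c i * (p (suc i) l - p zero l)) ≈ 0#) →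
      ∀ i → c i ≈ 0#

  DimAtMost : ∀ {d m} → (Fin m → Point d) → ℚ → Set
  DimAtMost {d} {m} V D =
    ∀ k (w : Fin (suc k) → Fin m) →
      AffinelyIndependent (λ i → V (w i)) → (ℤ.+ k) / 1 ≤ D
    where import Data.Integer as ℤ

{-# OPTIONS --safe #-}
module Submission where

-- In place of the absolute value of ℂ we use relations "∣x∣ ≤ q" between K and ℚ that are compatible with sums and products, extend
-- the absolute value of ℚ, and are proper: ∣1∣ ≤ q only if q ≥ 1. As for valuation rings, a proper norm can be enlarged so that
-- ∣x∣ ≤ 1 or ∣1/x∣ ≤ 1, for any x ≠ 0. Hence maxima of finite families of units exist, and, as in the Gelfand–Mazur theorem, every
-- bounded element can be approximated by Gaussian rationals.
--
-- Consider collinear triples of n points, at most M through each pair and at least κ owned by each point. Distribute the triples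
-- among their points, each point receiving as many as it owns except for one surplus triple at a point l, so that the product of the
-- coefficients is maximal; call the maximum A_l. After dividing column l by A_l, the entry at j is maximal in at least κ of the
-- triples, for every j. Averaging these relations gives (I + F)C = 0 where F has small Frobenius norm and the p columns of C restrict
-- to the identity on p of the points. Replacing F and C by Gaussian rationals and comparing traces, κ p ≤ 3072 M n.
--
-- For a configuration with m points and τ = ⌊δm⌋, weight each collinear triple by the inverse of the number of points on its line.
-- Unless some class of equal (or parallel) points is large, the points of least multiplicity have total weight of order τ², so some
-- set A of points spans a space of dimension O(m∣A∣/τ²). Restrict to the functions vanishing on A and repeat: the dimension is
-- O(m²/τ²). Since the conclusion is decidable, all case distinctions on K may be made under a double negation.

open import Defs

-- Rank bounds for design matrices usually rest on an absolute value and on matrix scaling, a limit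
-- over the reals. An abstract `K` offers neither, nor decidable equality, and a full valuation
-- would need Zorn's lemma. So the argument starts from a norm under which only rationals are
-- bounded and enlarges it finitely often, once per comparison; properness is the invariant. Scaling
-- becomes an assignment problem whose optimal values serve as potentials, so that only finite
-- maxima occur.
--
-- F is small for this reason: row j averages at least κ relations, the entry at l collects O(M) of
-- them, and the entries of the row add up to O(1) in size, so their squares add up to O(M/κ). On a
-- space of dimension p that I + F annihilates, F acts as -1; hence p is at most the squared
-- Frobenius norm of F.
--
-- Weights have to be integers to become numbers of rows, which is why they are m! divided by line
-- sizes. Points are treated as evaluation functionals on a space of functions: restricting to the
-- functions that vanish on A keeps all dependencies, though points may become zero or parallel.

-- The rationals inside a field of characteristic zero.

module RationalEmbedding (K : ACF₀) where
  open ACF₀ K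
  open import Data.Nat.Base as ℕ using (ℕ; zero; suc)
  open import Data.Integer.Base as ℤ using (ℤ; +_; -[1+_])
  import Data.Integer.Properties as ℤP
  open import Data.Rational.Base as ℚ using (ℚ; mkℚ; toℚᵘ)
  open import Data.Rational.Unnormalised.Base as ℚᵘ using (ℚᵘ; mkℚᵘ; *≡*)
  import Data.Rational.Properties as ℚP
  import Data.Rational.Unnormalised.Properties as ℚᵘP
  open import Data.Product using (proj₁; proj₂)
  open import Data.Empty using (⊥-elim)
  open import Data.Maybe.Base using (Maybe; just; nothing)
  open import Relation.Nullary using (¬_; yes; no)
  open import Relation.Binary.PropositionalEquality as ≡ using (_≡_)
  open import Algebra.Properties.Ring ring using (-‿distribˡ-*; -‿distribʳ-*; -‿involutive; -‿+-comm; -0#≈0#)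
  open import Relation.Binary.Reasoning.Setoid setoid
  open import Algebra.Solver.Ring.AlmostCommutativeRing using (fromCommutativeRing; _-Raw-AlmostCommutative⟶_)

  natCast-+ : ∀ m n → natCast (m ℕ.+ n) ≈ natCast m + natCast n
  natCast-+ zero n = sym (+-identityˡ _)
  natCast-+ (suc m) n = trans (+-congˡ (natCast-+ m n)) (sym (+-assoc _ _ _))

  natCast-* : ∀ m n → natCast (m ℕ.* n) ≈ natCast m * natCast n
  natCast-* zero n = sym (zeroˡ _)
  natCast-* (suc m) n = begin
    natCast (n ℕ.+ m ℕ.* n)            ≈⟨ natCast-+ n (m ℕ.* n) ⟩
    natCast n + natCast (m ℕ.* n)      ≈⟨ +-cong (sym (*-identityˡ _)) (natCast-* m n) ⟩
    1# * natCast n + natCast m * natCast n ≈⟨ distribʳ _ _ _ ⟨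
    (1# + natCast m) * natCast n ∎

  intCast : ℤ → Carrier
  intCast (+ n) = natCast n
  intCast -[1+ n ] = - natCast (suc n)

  intCast-neg : ∀ i → intCast (ℤ.- i) ≈ - intCast i
  intCast-neg (+ zero) = sym -0#≈0#
  intCast-neg (+ suc n) = refl
  intCast-neg -[1+ n ] = sym (-‿involutive _)

  cancel-sub : ∀ u a b → (u + a) + - (u + b) ≈ a + - b
  cancel-sub u a b = begin
    (u + a) + - (u + b)      ≈⟨ +-cong (+-comm u a) (sym (-‿+-comm u b)) ⟩
    (a + u) + (- u + - b)    ≈⟨ +-assoc _ _ _ ⟩
    a + (u + (- u + - b))    ≈⟨ +-congˡ (sym (+-assoc _ _ _)) ⟩
    a + ((u + - u) + - b)    ≈⟨ +-congˡ (trans (+-congʳ (-‿inverseʳ u)) (+-identityˡ _)) ⟩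
    a + - b ∎

  intCast-⊖ : ∀ m n → intCast (m ℤ.⊖ n) ≈ natCast m + - natCast n
  intCast-⊖ zero zero = trans (sym (+-identityʳ _)) (+-congˡ (sym -0#≈0#))
  intCast-⊖ zero (suc n) = sym (+-identityˡ _)
  intCast-⊖ (suc m) zero = trans (sym (+-identityʳ _)) (+-congˡ (sym -0#≈0#))
  intCast-⊖ (suc m) (suc n) rewrite ℤP.[1+m]⊖[1+n]≡m⊖n m n =
    trans (intCast-⊖ m n) (sym (cancel-sub 1# _ _))

  intCast-+ : ∀ i j → intCast (i ℤ.+ j) ≈ intCast i + intCast j
  intCast-+ (+ m) (+ n) = natCast-+ m n
  intCast-+ (+ m) -[1+ n ] = intCast-⊖ m (suc n)
  intCast-+ -[1+ m ] (+ n) = trans (intCast-⊖ n (suc m)) (+-comm _ _)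
  intCast-+ -[1+ m ] -[1+ n ] = begin
    - (natCast (suc (suc (m ℕ.+ n))))          ≈⟨ -‿cong (+-congˡ (+-congˡ (natCast-+ m n))) ⟩
    - (1# + (1# + (natCast m + natCast n)))    ≈⟨ -‿cong (+-congˡ (trans (sym (+-assoc _ _ _)) (trans (+-congʳ (+-comm _ _)) (+-assoc _ _ _)))) ⟩
    - (1# + (natCast m + (1# + natCast n)))    ≈⟨ -‿cong (sym (+-assoc _ _ _)) ⟩
    - ((1# + natCast m) + (1# + natCast n))    ≈⟨ -‿+-comm _ _ ⟨
    - (1# + natCast m) + - (1# + natCast n) ∎

  intCast-*⁺ : ∀ m j → intCast (+ m ℤ.* j) ≈ natCast m * intCast j
  intCast-*⁺ m (+ n) rewrite ≡.sym (ℤP.pos-* m n) = natCast-* m n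
  intCast-*⁺ m -[1+ n ] = begin
    intCast (+ m ℤ.* -[1+ n ])      ≡⟨ ≡.cong intCast (≡.sym (ℤP.neg-distribʳ-* (+ m) (+ suc n))) ⟩
    intCast (ℤ.- (+ m ℤ.* + suc n)) ≈⟨ intCast-neg (+ m ℤ.* + suc n) ⟩
    - intCast (+ m ℤ.* + suc n)     ≈⟨ -‿cong (intCast-*⁺ m (+ suc n)) ⟩
    - (natCast m * natCast (suc n)) ≈⟨ -‿distribʳ-* _ _ ⟩
    natCast m * - natCast (suc n) ∎

  intCast-* : ∀ i j → intCast (i ℤ.* j) ≈ intCast i * intCast j
  intCast-* (+ m) j = intCast-*⁺ m j
  intCast-* -[1+ m ] j = begin
    intCast (-[1+ m ] ℤ.* j)        ≡⟨ ≡.cong intCast (≡.sym (ℤP.neg-distribˡ-* (+ suc m) j)) ⟩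
    intCast (ℤ.- (+ suc m ℤ.* j))   ≈⟨ intCast-neg (+ suc m ℤ.* j) ⟩
    - intCast (+ suc m ℤ.* j)       ≈⟨ -‿cong (intCast-*⁺ (suc m) j) ⟩
    - (natCast (suc m) * intCast j) ≈⟨ -‿distribˡ-* _ _ ⟩
    - natCast (suc m) * intCast j ∎

  invN : ℕ → Carrier
  invN d = proj₁ (inverse (natCast (suc d)) (char0 d))

  invN-inverse : ∀ d → natCast (suc d) * invN d ≈ 1#
  invN-inverse d = proj₂ (inverse (natCast (suc d)) (char0 d))

  ι : ℚ → Carrier
  ι (mkℚ n d _) = intCast n * invN d

  ι-mult : ∀ q → ι q * natCast (ℚ.↧ₙ q) ≈ intCast (ℚ.↥ q)
  ι-mult (mkℚ n d _) = trans (*-assoc _ _ _) (trans (*-congˡ (trans (*-comm _ _) (invN-inverse d))) (*-identityʳ _))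

  natCast-cancelʳ : ∀ d {x y} → x * natCast (suc d) ≈ y * natCast (suc d) → x ≈ y
  natCast-cancelʳ d {x} {y} e = begin
    x                                 ≈⟨ *-identityʳ x ⟨
    x * 1#                            ≈⟨ *-congˡ (invN-inverse d) ⟨
    x * (natCast (suc d) * invN d)    ≈⟨ *-assoc _ _ _ ⟨
    (x * natCast (suc d)) * invN d    ≈⟨ *-congʳ e ⟩
    (y * natCast (suc d)) * invN d    ≈⟨ *-assoc _ _ _ ⟩
    y * (natCast (suc d) * invN d)    ≈⟨ *-congˡ (invN-inverse d) ⟩
    y * 1#                            ≈⟨ *-identityʳ y ⟩
    y ∎

  -- The operations of `ℚ` normalise by a gcd. Cross-multiplication with an arbitrary unnormalised
  -- fraction lets the homomorphism laws be checked on raw numerators and denominators.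
  ι-unique : ∀ q n d {x} → toℚᵘ q ℚᵘ.≃ mkℚᵘ n d → x * natCast (suc d) ≈ intCast n → ι q ≈ x
  ι-unique q@(mkℚ n' d' _) n d {x} (*≡* e) h = natCast-cancelʳ d' (natCast-cancelʳ d (begin
    (ι q * natCast (suc d')) * natCast (suc d)   ≈⟨ *-congʳ (ι-mult q) ⟩
    intCast n' * natCast (suc d)                 ≈⟨ intCast-* n' (+ suc d) ⟨
    intCast (n' ℤ.* + suc d)                     ≡⟨ ≡.cong intCast e ⟩
    intCast (n ℤ.* + suc d')                     ≈⟨ intCast-* n (+ suc d') ⟩
    intCast n * natCast (suc d')                 ≈⟨ *-congʳ h ⟨
    (x * natCast (suc d)) * natCast (suc d')     ≈⟨ *-assoc _ _ _ ⟩
    x * (natCast (suc d) * natCast (suc d'))     ≈⟨ *-congˡ (*-comm _ _) ⟩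
    x * (natCast (suc d') * natCast (suc d))     ≈⟨ *-assoc _ _ _ ⟨
    (x * natCast (suc d')) * natCast (suc d) ∎))

  private
    swap4 : ∀ a b c d → (a * b) * (c * d) ≈ (a * c) * (b * d)
    swap4 a b c d = begin
      (a * b) * (c * d) ≈⟨ *-assoc _ _ _ ⟩
      a * (b * (c * d)) ≈⟨ *-congˡ (trans (sym (*-assoc _ _ _)) (trans (*-congʳ (*-comm _ _)) (*-assoc _ _ _))) ⟩
      a * (c * (b * d)) ≈⟨ *-assoc _ _ _ ⟨
      (a * c) * (b * d) ∎

  ι-* : ∀ p q → ι (p ℚ.* q) ≈ ι p * ι q
  ι-* p@(mkℚ a b _) q@(mkℚ c d _) = ι-unique (p ℚ.* q) _ _ (ℚP.toℚᵘ-homo-* p q) (begin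
    ι p * ι q * natCast (suc b ℕ.* suc d)              ≈⟨ *-congˡ (natCast-* (suc b) (suc d)) ⟩
    (ι p * ι q) * (natCast (suc b) * natCast (suc d))  ≈⟨ swap4 _ _ _ _ ⟩
    (ι p * natCast (suc b)) * (ι q * natCast (suc d))  ≈⟨ *-cong (ι-mult p) (ι-mult q) ⟩
    intCast a * intCast c                              ≈⟨ intCast-* a c ⟨
    intCast (a ℤ.* c) ∎)

  ι-+ : ∀ p q → ι (p ℚ.+ q) ≈ ι p + ι q
  ι-+ p@(mkℚ a b _) q@(mkℚ c d _) = ι-unique (p ℚ.+ q) _ _ (ℚP.toℚᵘ-homo-+ p q) (begin
    (ι p + ι q) * natCast (suc b ℕ.* suc d)            ≈⟨ *-congˡ (natCast-* (suc b) (suc d)) ⟩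
    (ι p + ι q) * (natCast (suc b) * natCast (suc d))  ≈⟨ distribʳ _ _ _ ⟩
    ι p * (natCast (suc b) * natCast (suc d)) + ι q * (natCast (suc b) * natCast (suc d))
      ≈⟨ +-cong (trans (sym (*-assoc _ _ _)) (*-congʳ (ι-mult p)))
                (trans (*-congˡ (*-comm _ _)) (trans (sym (*-assoc _ _ _)) (*-congʳ (ι-mult q)))) ⟩
    intCast a * natCast (suc d) + intCast c * natCast (suc b)
      ≈⟨ +-cong (intCast-* a (+ suc d)) (intCast-* c (+ suc b)) ⟨
    intCast (a ℤ.* + suc d) + intCast (c ℤ.* + suc b)  ≈⟨ intCast-+ (a ℤ.* + suc d) _ ⟨
    intCast (a ℤ.* + suc d ℤ.+ c ℤ.* + suc b) ∎)

  ι-neg : ∀ p → ι (ℚ.- p) ≈ - ι p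
  ι-neg p@(mkℚ a b _) = ι-unique (ℚ.- p) _ _ (ℚP.toℚᵘ-homo‿- p) (begin
    - ι p * natCast (suc b)    ≈⟨ -‿distribˡ-* _ _ ⟨
    - (ι p * natCast (suc b))  ≈⟨ -‿cong (ι-mult p) ⟩
    - intCast a                ≈⟨ intCast-neg a ⟨
    intCast (ℤ.- a) ∎)

  ι-0 : ι ℚ.0ℚ ≈ 0#
  ι-0 = ι-unique ℚ.0ℚ (+ 0) 0 ℚᵘP.≃-refl (zeroˡ _)

  ι-1 : ι ℚ.1ℚ ≈ 1#
  ι-1 = ι-unique ℚ.1ℚ (+ 1) 0 ℚᵘP.≃-refl (*-identityˡ _)

  ι-cong : ∀ {p q} → p ≡ q → ι p ≈ ι q
  ι-cong ≡.refl = refl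

  ι-nonzero : ∀ q → ¬ (q ≡ ℚ.0ℚ) → ¬ (ι q ≈ 0#)
  ι-nonzero q q≢0 e = 1≉0 (begin
      1#                 ≈⟨ ι-1 ⟨
      ι ℚ.1ℚ             ≡⟨ ≡.cong ι (≡.sym (ℚP.*-inverseʳ q {{nz}})) ⟩
      ι (q ℚ.* (ℚ.1/ q) {{nz}})   ≈⟨ ι-* q _ ⟩
      ι q * ι ((ℚ.1/ q) {{nz}})   ≈⟨ *-congʳ e ⟩
      0# * ι ((ℚ.1/ q) {{nz}})    ≈⟨ zeroˡ _ ⟩
      0# ∎)
    where nz = ℚ.≢-nonZero q≢0

  ι-injective : ∀ {p q} → ι p ≈ ι q → p ≡ q
  ι-injective {p} {q} e with p ℚP.≟ q
  ... | yes p≡q = p≡q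
  ... | no p≢q = ⊥-elim (ι-nonzero (p ℚ.- q) (λ z → p≢q (diff0 z)) (begin
      ι (p ℚ.- q)       ≈⟨ ι-+ p (ℚ.- q) ⟩
      ι p + ι (ℚ.- q)   ≈⟨ +-cong e (ι-neg q) ⟩
      ι q + - ι q       ≈⟨ -‿inverseʳ _ ⟩
      0# ∎))
    where
    diff0 : p ℚ.- q ≡ ℚ.0ℚ → p ≡ q
    diff0 z = ≡.trans (≡.sym (≡.trans (ℚP.+-assoc p (ℚ.- q) q) (≡.trans (≡.cong (p ℚ.+_) (ℚP.+-inverseˡ q)) (ℚP.+-identityʳ p))))
                (≡.trans (≡.cong (ℚ._+ q) z) (ℚP.+-identityˡ q))

  -- Gives the ring solver over `K` rational coefficients, whose equality is decidable although
  -- equality in `K` is not.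
  ι-morphism : ℚP.+-*-rawRing -Raw-AlmostCommutative⟶ fromCommutativeRing cring
  ι-morphism = record
    { ⟦_⟧ = ι ; +-homo = ι-+ ; *-homo = ι-* ; -‿homo = ι-neg ; 0-homo = ι-0 ; 1-homo = ι-1 }

  coeff≟ : ∀ p q → Maybe (ι p ≈ ι q)
  coeff≟ p q with p ℚP.≟ q
  ... | yes e = just (ι-cong e)
  ... | no _ = nothing

  module KSolver where
    open import Algebra.Solver.Ring ℚP.+-*-rawRing (fromCommutativeRing cring) ι-morphism coeff≟ public

-- Ordered-field facts about the rationals.

module RationalLemmas where
  open import Data.Nat.Base as ℕ using (ℕ; zero; suc)
  import Data.Nat.Properties as ℕP
  open import Data.Integer.Base as ℤ using (ℤ; +_; -[1+_])
  import Data.Integer.Properties as ℤP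
  open import Data.Rational.Base hiding (_/_; floor)
  open import Data.Rational.Base using (_/_)
  open import Data.Rational.Properties
  import Data.Rational.Unnormalised.Base as ℚᵘ
  import Data.Rational.Unnormalised.Properties as ℚᵘP
  import Data.Nat.Coprimality as Cop
  open import Data.Rational.Solver using (module +-*-Solver)
  open import Data.Product using (∃-syntax; _×_; _,_; proj₁; proj₂)
  open import Data.Sum using (inj₁; inj₂)
  open import Data.Empty using (⊥-elim)
  open import Relation.Nullary using (¬_; yes; no)
  open import Relation.Unary using (Decidable)
  open import Relation.Binary.PropositionalEquality using (_≡_; refl; sym; trans; cong; cong₂; subst; subst₂)

  -- Supplies all the discrete thresholds, such as integer parts, a level of multiplicity or the
  -- value of κ, by searching downwards from a bound at which the predicate fails.
  last-true : ∀ {P : ℕ → Set} → Decidable P → P 0 → ∀ N → ¬ P N → ∃[ n ] (n ℕ.< N × P n × ¬ P (suc n))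
  last-true P? p0 zero np = ⊥-elim (np p0)
  last-true P? p0 (suc N) np with P? N
  ... | yes p = N , ℕP.n<1+n N , p , np
  ... | no np' with n , n<N , q ← last-true P? p0 N np' = n , ℕP.m<n⇒m<1+n n<N , q

  *-nonNeg : ∀ {p q} → 0ℚ ≤ p → 0ℚ ≤ q → 0ℚ ≤ p * q
  *-nonNeg {p} {q} 0≤p 0≤q = nonNegative⁻¹ (p * q) {{nonNeg*nonNeg⇒nonNeg p {{nonNegative 0≤p}} q {{nonNegative 0≤q}}}}

  +-nonNeg : ∀ {p q} → 0ℚ ≤ p → 0ℚ ≤ q → 0ℚ ≤ p + q
  +-nonNeg 0≤p 0≤q = +-mono-≤ 0≤p 0≤q

  *-pos : ∀ {p q} → 0ℚ < p → 0ℚ < q → 0ℚ < p * q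
  *-pos {p} {q} 0<p 0<q = positive⁻¹ (p * q) {{pos*pos⇒pos p {{positive 0<p}} q {{positive 0<q}}}}

  *-monoˡ : ∀ {p q r} → 0ℚ ≤ r → p ≤ q → r * p ≤ r * q
  *-monoˡ {r = r} 0≤r = *-monoˡ-≤-nonNeg r {{nonNegative 0≤r}}

  *-monoʳ : ∀ {p q r} → 0ℚ ≤ r → p ≤ q → p * r ≤ q * r
  *-monoʳ {r = r} 0≤r = *-monoʳ-≤-nonNeg r {{nonNegative 0≤r}}

  *-mono : ∀ {p q r s} → 0ℚ ≤ p → p ≤ q → 0ℚ ≤ r → r ≤ s → p * r ≤ q * s
  *-mono 0≤p p≤q 0≤r r≤s = ≤-trans (*-monoˡ 0≤p r≤s) (*-monoʳ (≤-trans 0≤r r≤s) p≤q)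

  *-cancelʳ : ∀ {p q r} → 0ℚ < r → p * r ≤ q * r → p ≤ q
  *-cancelʳ {r = r} 0<r = *-cancelʳ-≤-pos r {{positive 0<r}}

  ≤-by-gap : ∀ {p q} g → 0ℚ ≤ g → p + g ≡ q → p ≤ q
  ≤-by-gap {p} g 0≤g refl = subst (_≤ p + g) (+-identityʳ p) (+-monoʳ-≤ p 0≤g)

  p≤q⇒0≤q-p : ∀ {p q} → p ≤ q → 0ℚ ≤ q - p
  p≤q⇒0≤q-p {p} {q} p≤q = subst (_≤ q - p) (+-inverseʳ p) (+-monoˡ-≤ (- p) p≤q)

  ≤-by-difference : ∀ {p q r s} → r ≤ s → q - p ≡ s - r → p ≤ q
  ≤-by-difference {p} {q} {r} {s} r≤s e =
    ≤-by-gap (q - p) (subst (0ℚ ≤_) (sym e) (p≤q⇒0≤q-p r≤s)) (lem p q)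
    where
    open +-*-Solver
    lem : ∀ p q → p + (q - p) ≡ q
    lem = solve 2 (λ p q → p :+ (q :- p) := q) refl

  square-nonNeg : ∀ p → 0ℚ ≤ p * p
  square-nonNeg p with ≤-total 0ℚ p
  ... | inj₁ 0≤p = *-nonNeg 0≤p 0≤p
  ... | inj₂ p≤0 = subst (0ℚ ≤_) (lem p) (*-nonNeg n n)
    where
    n : 0ℚ ≤ - p
    n = neg-antimono-≤ p≤0
    open +-*-Solver
    lem : ∀ p → (- p) * (- p) ≡ p * p
    lem = solve 1 (λ p → (:- p) :* (:- p) := p :* p) refl

  fromℕ : ℕ → ℚ
  fromℕ n = mkℚ (+ n) 0 (Cop.sym (Cop.1-coprimeTo n))

  /1≡fromℕ : ∀ n → (+ n) / 1 ≡ fromℕ n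
  /1≡fromℕ n = ↥p/↧p≡p (fromℕ n)

  toℚᵘ-fromℕ : ∀ n → toℚᵘ (fromℕ n) ℚᵘ.≃ ℚᵘ.mkℚᵘ (+ n) 0
  toℚᵘ-fromℕ n = ℚᵘP.≃-refl

  fromℕ-+ : ∀ m n → fromℕ (m ℕ.+ n) ≡ fromℕ m + fromℕ n
  fromℕ-+ m n = toℚᵘ-injective (ℚᵘP.≃-trans (toℚᵘ-fromℕ (m ℕ.+ n)) (ℚᵘP.≃-sym
    (ℚᵘP.≃-trans (toℚᵘ-homo-+ (fromℕ m) (fromℕ n))
      (ℚᵘP.≃-trans (ℚᵘP.+-cong (toℚᵘ-fromℕ m) (toℚᵘ-fromℕ n))
        (ℚᵘP.≃-reflexive (cong (λ i → ℚᵘ.mkℚᵘ i 0) (cong₂ ℤ._+_ (ℤP.*-identityʳ (+ m)) (ℤP.*-identityʳ (+ n)))))))))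

  fromℕ-* : ∀ m n → fromℕ (m ℕ.* n) ≡ fromℕ m * fromℕ n
  fromℕ-* m n = toℚᵘ-injective (ℚᵘP.≃-trans (toℚᵘ-fromℕ (m ℕ.* n)) (ℚᵘP.≃-sym
    (ℚᵘP.≃-trans (toℚᵘ-homo-* (fromℕ m) (fromℕ n))
      (ℚᵘP.≃-trans (ℚᵘP.*-cong (toℚᵘ-fromℕ m) (toℚᵘ-fromℕ n))
        (ℚᵘP.≃-reflexive (cong (λ i → ℚᵘ.mkℚᵘ i 0) (sym (ℤP.pos-* m n))))))))

  fromℕ-mono-≤ : ∀ {m n} → m ℕ.≤ n → fromℕ m ≤ fromℕ n
  fromℕ-mono-≤ m≤n = *≤* (ℤP.*-monoʳ-≤-nonNeg (+ 1) (ℤ.+≤+ m≤n))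

  fromℕ-mono-< : ∀ {m n} → m ℕ.< n → fromℕ m < fromℕ n
  fromℕ-mono-< m<n = *<* (ℤP.*-monoʳ-<-pos (+ 1) (ℤ.+<+ m<n))

  fromℕ-cancel-≤ : ∀ {m n} → fromℕ m ≤ fromℕ n → m ℕ.≤ n
  fromℕ-cancel-≤ {m} {n} h = ℕP.≮⇒≥ (λ n<m → <-irrefl refl (≤-<-trans h (fromℕ-mono-< n<m)))

  fromℕ-nonNeg : ∀ n → 0ℚ ≤ fromℕ n
  fromℕ-nonNeg n = fromℕ-mono-≤ {0} {n} ℕ.z≤n

  archimedean : ∀ h → 0ℚ < h → ∃[ n ] 1ℚ ≤ fromℕ n * h
  archimedean h@(mkℚ (+ zero) d _) 0<h = ⊥-elim (<-irrefl (sym (↥p≡0⇒p≡0 h refl)) 0<h)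
  archimedean h@(mkℚ (+ suc a) d _) 0<h = suc d , toℚᵘ-cancel-≤
    (ℚᵘP.≤-respʳ-≃ (ℚᵘP.≃-sym (toℚᵘ-homo-* (fromℕ (suc d)) h))
      (ℚᵘ.*≤* (ℤ.+≤+ (lem d a))))
    where
    lem : ∀ d a → 1 ℕ.* (1 ℕ.* suc d) ℕ.≤ suc d ℕ.* suc a ℕ.* 1
    lem d a rewrite ℕP.*-identityʳ (suc d ℕ.* suc a) | ℕP.*-identityˡ (1 ℕ.* suc d) | ℕP.*-identityˡ (suc d) = ℕP.m≤m*n (suc d) (suc a)
  archimedean h@(mkℚ -[1+ n ] d _) 0<h = ⊥-elim (<-asym 0<h (negative⁻¹ h))

  unbounded : ∀ q → ∃[ n ] q ≤ fromℕ n
  unbounded q with q ≤? 0ℚ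
  ... | yes q≤0 = 0 , q≤0
  ... | no q≰0 = n , subst₂ _≤_ (*-identityˡ q) eq (*-monoʳ (<⇒≤ 0<q) h)
    where
    0<q = ≰⇒> q≰0
    instance
      q+ : Positive q
      q+ = positive 0<q
      qnz : NonZero q
      qnz = pos⇒nonZero q
    inv = archimedean (1/ q) (positive⁻¹ (1/ q) {{1/pos⇒pos q}})
    n = proj₁ inv
    h = proj₂ inv
    eq : fromℕ n * (1/ q) * q ≡ fromℕ n
    eq = trans (*-assoc (fromℕ n) (1/ q) q) (trans (cong (fromℕ n *_) (*-inverseˡ q)) (*-identityʳ (fromℕ n)))

  floor : ∀ q → 0ℚ ≤ q → ∃[ n ] (fromℕ n ≤ q × q < fromℕ (suc n))
  floor q 0≤q with N , q≤N ← unbounded q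
    with n , _ , a , b ← last-true (λ n → fromℕ n ≤? q) 0≤q (suc N)
           (λ h → <-irrefl refl (≤-<-trans q≤N (<-≤-trans (fromℕ-mono-< (ℕP.n<1+n N)) h)))
    = n , a , ≰⇒> b

  ^-nonNeg : ∀ {p} n → 0ℚ ≤ p → 0ℚ ≤ p ^ℚ n
  ^-nonNeg zero 0≤p = from-yes (0ℚ ≤? 1ℚ) where open import Relation.Nullary.Decidable using (from-yes)
  ^-nonNeg (suc n) 0≤p = *-nonNeg 0≤p (^-nonNeg n 0≤p)

  -- Passing from n to n + 1 loses exactly θⁿ(n + 1)(1 - θ)², which is not negative. This form of
  -- Bernoulli's inequality avoids dividing by θ, which may be 0.
  bernoulli : ∀ {θ} → 0ℚ ≤ θ → θ ≤ 1ℚ → ∀ n → (θ ^ℚ n) * (1ℚ + fromℕ n * (1ℚ - θ)) ≤ 1ℚ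
  bernoulli {θ} 0≤θ θ≤1 zero = ≤-reflexive (lem θ)
    where
    open +-*-Solver
    lem : ∀ θ → 1ℚ * (1ℚ + 0ℚ * (1ℚ - θ)) ≡ 1ℚ
    lem = solve 1 (λ θ → con 1ℚ :* (con 1ℚ :+ con 0ℚ :* (con 1ℚ :- θ)) := con 1ℚ) refl
  bernoulli {θ} 0≤θ θ≤1 (suc n) = ≤-trans (≤-by-gap (t * ((1ℚ + fromℕ n) * (h * h))) g eq) (bernoulli 0≤θ θ≤1 n)
    where
    h = 1ℚ - θ
    t = θ ^ℚ n
    g : 0ℚ ≤ t * ((1ℚ + fromℕ n) * (h * h))
    g = *-nonNeg (^-nonNeg n 0≤θ) (*-nonNeg (subst (0ℚ ≤_) (fromℕ-+ 1 n) (fromℕ-nonNeg (suc n))) (square-nonNeg h))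
    open +-*-Solver
    lem : ∀ θ t k → θ * t * (1ℚ + (1ℚ + k) * (1ℚ - θ)) + t * ((1ℚ + k) * ((1ℚ - θ) * (1ℚ - θ))) ≡ t * (1ℚ + k * (1ℚ - θ))
    lem = solve 3 (λ θ t k → θ :* t :* (con 1ℚ :+ (con 1ℚ :+ k) :* (con 1ℚ :- θ)) :+ t :* ((con 1ℚ :+ k) :* ((con 1ℚ :- θ) :* (con 1ℚ :- θ))) := t :* (con 1ℚ :+ k :* (con 1ℚ :- θ))) refl
    eq : θ * t * (1ℚ + fromℕ (suc n) * (1ℚ - θ)) + t * ((1ℚ + fromℕ n) * (h * h)) ≡ t * (1ℚ + fromℕ n * (1ℚ - θ))
    eq rewrite fromℕ-+ 1 n = lem θ t (fromℕ n)

  ^-vanishes : ∀ {θ} → 0ℚ ≤ θ → θ < 1ℚ → ∀ η → 0ℚ < η → ∃[ n ] (θ ^ℚ n) ≤ η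
  ^-vanishes {θ} 0≤θ θ<1 η 0<η = n , ≤-trans
      (subst (_≤ t * (η * (1ℚ + fromℕ n * h))) (*-identityʳ t)
        (*-monoˡ (^-nonNeg n 0≤θ) 1≤))
      (subst₂ _≤_ (lem η t (1ℚ + fromℕ n * h)) (*-identityʳ η) (*-monoˡ (<⇒≤ 0<η) (bernoulli 0≤θ (<⇒≤ θ<1) n)))
    where
    h = 1ℚ - θ
    0<h : 0ℚ < h
    0<h = subst (_< h) (+-inverseʳ θ) (+-monoˡ-< (- θ) θ<1)
    arch = archimedean (η * h) (*-pos 0<η 0<h)
    n = proj₁ arch
    t = θ ^ℚ n
    open +-*-Solver
    lem : ∀ η t k → η * (t * k) ≡ t * (η * k)
    lem = solve 3 (λ η t k → η :* (t :* k) := t :* (η :* k)) refl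
    lem′ : ∀ η k h → k * (η * h) + η ≡ η * (1ℚ + k * h)
    lem′ = solve 3 (λ η k h → k :* (η :* h) :+ η := η :* (con 1ℚ :+ k :* h)) refl
    1≤ : 1ℚ ≤ η * (1ℚ + fromℕ n * h)
    1≤ = ≤-trans (proj₂ arch) (≤-by-gap η (<⇒≤ 0<η) (lem′ η (fromℕ n) h))

-- Norms with rational bounds, and their extension by an element or its inverse.

module Norms (K : ACF₀) where
  open ACF₀ K
  open RationalEmbedding K
  open RationalLemmas
  open import Data.Nat.Base as ℕ using (ℕ; zero; suc)
  import Data.Nat.Properties as ℕP
  open import Data.Fin.Base using (Fin; zero; suc; toℕ; fromℕ<)
  import Data.Fin.Properties as FP
  open import Data.Rational.Base as ℚ using (ℚ; 0ℚ; 1ℚ; ½)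
  import Data.Rational.Properties as ℚP
  open import Data.Rational.Solver using () renaming (module +-*-Solver to ℚSolver)
  open import Data.Product using (Σ; ∃-syntax; _×_; _,_; proj₁; proj₂)
  open import Data.Sum using (_⊎_; inj₁; inj₂)
  open import Data.Empty using (⊥)
  open import Relation.Nullary using (¬_; Dec; yes; no)
  open import Relation.Nullary.Decidable using (from-yes)
  open import Relation.Binary.PropositionalEquality as ≡ using (_≡_)
  open import Relation.Binary.Reasoning.Setoid setoid

  0≤1 : 0ℚ ℚ.≤ 1ℚ
  0≤1 = from-yes (0ℚ ℚP.≤? 1ℚ)

  excluded-middle : ∀ {a} {A : Set a} → ¬ ¬ Dec A
  excluded-middle k = k (no (λ a → k (yes a)))

  -- `N x q` asserts a bound instead of giving a value: an infimum of rationals need not be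
  -- rational, and an element may have no bound at all, so that a norm on a subring is also a
  -- `PreNorm`.
  record PreNorm : Set₁ where
    field
      N      : Carrier → ℚ → Set
      nonNeg : ∀ {x q} → N x q → 0ℚ ℚ.≤ q
      resp   : ∀ {x y q} → x ≈ y → N x q → N y q
      weaken : ∀ {x p q} → p ℚ.≤ q → N x p → N x q
      add    : ∀ {x y p q} → N x p → N y q → N (x + y) (p ℚ.+ q)
      mul    : ∀ {x y p q} → N x p → N y q → N (x * y) (p ℚ.* q)
      rat    : ∀ r → N (ι r) ℚ.∣ r ∣

    zeroN : N 0# 0ℚ
    zeroN = resp ι-0 (rat 0ℚ)

    oneN : N 1# 1ℚ
    oneN = resp ι-1 (rat 1ℚ)

    negN : ∀ {x q} → N x q → N (- x) q
    negN {x} {q} n = resp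
      (trans (*-congʳ (trans (ι-neg 1ℚ) (-‿cong ι-1))) (-1*x≈-x x))
      (≡.subst (N _) (ℚP.*-identityˡ q) (mul (rat (ℚ.- 1ℚ)) n))
      where open import Algebra.Properties.Ring ring using (-1*x≈-x)

    subN : ∀ {x y p q} → N x p → N y q → N (x - y) (p ℚ.+ q)
    subN m n = add m (negN n)

  open PreNorm

  Proper : PreNorm → Set
  Proper P = ∀ q → N P 1# q → 1ℚ ℚ.≤ q

  -- Only rationals have a bound, so this norm exists over any `K`; its properness is the
  -- injectivity of `ι`.
  trivialNorm : PreNorm
  trivialNorm = record
    { N = λ x q → ∃[ r ] (x ≈ ι r × ℚ.∣ r ∣ ℚ.≤ q)
    ; nonNeg = λ { (r , _ , h) → ℚP.≤-trans (ℚP.0≤∣p∣ r) h }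
    ; resp = λ { e (r , e′ , h) → r , trans (sym e) e′ , h }
    ; weaken = λ { p≤q (r , e , h) → r , e , ℚP.≤-trans h p≤q }
    ; add = λ { (r , e , h) (s , e′ , h′) → r ℚ.+ s , trans (+-cong e e′) (sym (ι-+ r s)) ,
                ℚP.≤-trans (ℚP.∣p+q∣≤∣p∣+∣q∣ r s) (ℚP.+-mono-≤ h h′) }
    ; mul = λ { (r , e , h) (s , e′ , h′) → r ℚ.* s , trans (*-cong e e′) (sym (ι-* r s)) ,
                ℚP.≤-trans (ℚP.≤-reflexive (ℚP.∣p*q∣≡∣p∣*∣q∣ r s)) (*-mono (ℚP.0≤∣p∣ r) h (ℚP.0≤∣p∣ s) h′) }
    ; rat = λ r → r , refl , ℚP.≤-refl
    }

  trivialNorm-proper : Proper trivialNorm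
  trivialNorm-proper q (r , e , h) with ι-injective {1ℚ} {r} (trans ι-1 e)
  ... | ≡.refl = h

  module _ (P : PreNorm) where

    -- The ball of radius q in the module generated by z, for the ℓ¹ norm on coefficients: the
    -- bounds of the coefficients must add up to at most q.
    data Span : ∀ {n} → (Fin n → Carrier) → ℚ → Carrier → Set where
      nil  : ∀ {z : Fin 0 → Carrier} {q a} → a ≈ 0# → 0ℚ ℚ.≤ q → Span z q a
      cons : ∀ {n} {z : Fin (suc n) → Carrier} {q a} c b a′ q′ → N P c b → Span (λ i → z (suc i)) q′ a′ →
             a ≈ c * z zero + a′ → b ℚ.+ q′ ℚ.≤ q → Span z q a

    Span-nonNeg : ∀ {n} (z : Fin n → Carrier) {q a} → Span z q a → 0ℚ ℚ.≤ q
    Span-nonNeg {zero} z (nil _ h) = h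
    Span-nonNeg {suc n} z (cons c b a′ q′ nc s e h) =
      ℚP.≤-trans (+-nonNeg (nonNeg P nc) (Span-nonNeg _ s)) h

    Span-resp : ∀ {n} (z : Fin n → Carrier) {q a a′} → a ≈ a′ → Span z q a → Span z q a′
    Span-resp {zero} z e (nil e′ h) = nil (trans (sym e) e′) h
    Span-resp {suc n} z e (cons c b a′ q′ nc s e′ h) = cons c b a′ q′ nc s (trans (sym e) e′) h

    Span-weaken : ∀ {n} (z : Fin n → Carrier) {p q a} → p ℚ.≤ q → Span z p a → Span z q a
    Span-weaken {zero} z l (nil e′ h) = nil e′ (ℚP.≤-trans h l)
    Span-weaken {suc n} z l (cons c b a′ q′ nc s e′ h) = cons c b a′ q′ nc s e′ (ℚP.≤-trans h l)

    Span-0 : ∀ {n} (z : Fin n → Carrier) → Span z 0ℚ 0#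
    Span-0 {zero} z = nil refl ℚP.≤-refl
    Span-0 {suc n} z = cons 0# 0ℚ 0# 0ℚ (zeroN P) (Span-0 _) (sym (trans (+-identityʳ _) (zeroˡ _))) ℚP.≤-refl

    Span-+ : ∀ {n} (z : Fin n → Carrier) {p q a b} → Span z p a → Span z q b → Span z (p ℚ.+ q) (a + b)
    Span-+ {zero} z (nil e h) (nil e′ h′) = nil (trans (+-cong e e′) (+-identityˡ _)) (+-nonNeg h h′)
    Span-+ {suc n} z {p} {q} (cons c b a r nc s e h) (cons c′ b′ a′ r′ nc′ s′ e′ h′) =
      cons (c + c′) (b ℚ.+ b′) (a + a′) (r ℚ.+ r′) (add P nc nc′) (Span-+ _ s s′)
      (trans (+-cong e e′) (solve 5 (λ c c′ a a′ z → (c :* z :+ a) :+ (c′ :* z :+ a′) := (c :+ c′) :* z :+ (a :+ a′)) refl c c′ a a′ (z zero)))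
      (≡.subst (ℚ._≤ p ℚ.+ q) (q4 b r b′ r′) (ℚP.+-mono-≤ h h′))
      where
      open KSolver
      q4 : ∀ b r b′ r′ → (b ℚ.+ r) ℚ.+ (b′ ℚ.+ r′) ≡ (b ℚ.+ b′) ℚ.+ (r ℚ.+ r′)
      q4 = ℚSolver.solve 4 (λ b r b′ r′ → (b ℚSolver.:+ r) ℚSolver.:+ (b′ ℚSolver.:+ r′) ℚSolver.:= (b ℚSolver.:+ b′) ℚSolver.:+ (r ℚSolver.:+ r′)) ≡.refl

    Span-scale : ∀ {n} (z : Fin n → Carrier) {p q c a} → N P c p → Span z q a → Span z (p ℚ.* q) (c * a)
    Span-scale {zero} z n (nil e h) = nil (trans (*-congˡ e) (zeroʳ _)) (*-nonNeg (nonNeg P n) h)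
    Span-scale {suc n} z {p} {q} {k} nk (cons c b a r nc s e h) =
      cons (k * c) (p ℚ.* b) (k * a) (p ℚ.* r) (mul P nk nc) (Span-scale _ nk s)
      (trans (*-congˡ e) (solve 4 (λ k c z a → k :* (c :* z :+ a) := (k :* c) :* z :+ k :* a) refl k c (z zero) a))
      (≡.subst (ℚ._≤ p ℚ.* q) (ℚP.*-distribˡ-+ p b r) (*-monoˡ (nonNeg P nk) h))
      where open KSolver

    Span-generator : ∀ {n} (z : Fin n → Carrier) i → Span z 1ℚ (z i)
    Span-generator z zero = cons 1# 1ℚ 0# 0ℚ (oneN P) (Span-0 _) (sym (trans (+-identityʳ _) (*-identityˡ _))) ℚP.≤-refl
    Span-generator z (suc i) = cons 0# 0ℚ (z (suc i)) 1ℚ (zeroN P) (Span-generator _ i)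
      (sym (trans (+-congʳ (zeroˡ _)) (+-identityˡ _))) ℚP.≤-refl

    -- ℓ¹ bounds multiply when combinations are composed. The factor `b` serves the case in which
    -- the generators are controlled only after multiplication by a fixed element, as powers of x
    -- are by a further power of x.
    Span-substitute : ∀ {m n} (z : Fin n → Carrier) (w : Fin m → Carrier) {p q a} b → 0ℚ ℚ.≤ q → Span z p a →
                      (∀ i → Span w q (z i * b)) → Span w (p ℚ.* q) (a * b)
    Span-substitute {n = zero} z w b 0≤q (nil e h) f =
      Span-resp w (sym (trans (*-congʳ e) (zeroˡ b))) (Span-weaken w (*-nonNeg h 0≤q) (Span-0 w))
    Span-substitute {n = suc n} z w {p} {q} b 0≤q (cons c β a r nc s e h) f =
      Span-resp w (sym (trans (*-congʳ e) (solve 4 (λ c z a b → (c :* z :+ a) :* b := c :* (z :* b) :+ a :* b) refl c (z zero) a b)))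
        (Span-weaken w (≡.subst (ℚ._≤ p ℚ.* q) (ℚP.*-distribʳ-+ q β r) (*-monoʳ 0≤q h))
          (Span-+ w (Span-scale w nc (f zero)) (Span-substitute (λ i → z (suc i)) w b 0≤q s (λ i → f (suc i)))))
      where open KSolver

    Span-of-zeros : ∀ {n} (z : Fin n → Carrier) {q a} → (∀ i → z i ≈ 0#) → Span z q a → a ≈ 0#
    Span-of-zeros {zero} z f (nil e _) = e
    Span-of-zeros {suc n} z f (cons c _ a′ _ _ s e _) =
      trans e (trans (+-cong (trans (*-congˡ (f zero)) (zeroʳ c)) (Span-of-zeros _ (λ i → f (suc i)) s)) (+-identityˡ _))

  pow-+ : ∀ x m n → pow x (m ℕ.+ n) ≈ pow x m * pow x n
  pow-+ x zero n = sym (*-identityˡ _)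
  pow-+ x (suc m) n = trans (*-congˡ (pow-+ x m n)) (sym (*-assoc _ _ _))

  pow-inverse : ∀ {x y} → x * y ≈ 1# → ∀ n → pow x n * pow y n ≈ 1#
  pow-inverse e zero = *-identityˡ _
  pow-inverse {x} {y} e (suc n) = trans
    (solve 4 (λ x y p q → (x :* p) :* (y :* q) := (x :* y) :* (p :* q)) refl x y _ _)
    (trans (*-cong e (pow-inverse e n)) (*-identityˡ _))
    where open KSolver

  powers : Carrier → ∀ n → Fin (suc n) → Carrier
  powers x n i = pow x (toℕ i)

  module _ (P : PreNorm) where

    Span-pow : ∀ x n k → k ℕ.≤ n → Span P (powers x n) 1ℚ (pow x k)
    Span-pow x n k k≤n = ≡.subst (λ j → Span P (powers x n) 1ℚ (pow x j)) (FP.toℕ-fromℕ< (ℕ.s≤s k≤n))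
      (Span-generator P (powers x n) (fromℕ< (ℕ.s≤s k≤n)))

    toℕ≤ : ∀ {n} (i : Fin (suc n)) → toℕ i ℕ.≤ n
    toℕ≤ i = ℕP.≤-pred (FP.toℕ<n i)

    Span-mono-degree : ∀ x {m n q a} → m ℕ.≤ n → Span P (powers x m) q a → Span P (powers x n) q a
    Span-mono-degree x {m} {n} {q} m≤n s = ≡.subst₂ (λ p b → Span P (powers x n) p b) (ℚP.*-identityʳ q) ≡.refl
      (Span-resp P _ (*-identityʳ _) (Span-substitute P (powers x m) (powers x n) 1# 0≤1 s
        (λ i → Span-resp P _ (sym (*-identityʳ _)) (Span-pow x n (toℕ i) (ℕP.≤-trans (toℕ≤ i) m≤n)))))

    Span-powers-* : ∀ x {m n p q a b} → Span P (powers x m) p a → Span P (powers x n) q b →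
                    Span P (powers x (m ℕ.+ n)) (p ℚ.* q) (a * b)
    Span-powers-* x {m} {n} {p} {q} {a} {b} s t = Span-substitute P (powers x m) _ b (Span-nonNeg P _ t) s (λ i →
      ≡.subst₂ (Span P _) (ℚP.*-identityʳ q) ≡.refl (Span-resp P _ (*-comm _ _)
        (Span-substitute P (powers x n) (powers x (m ℕ.+ n)) (pow x (toℕ i)) 0≤1 t (λ j →
          Span-resp P _ (pow-+ x (toℕ j) (toℕ i))
            (Span-pow x (m ℕ.+ n) (toℕ j ℕ.+ toℕ i) (≡.subst (toℕ j ℕ.+ toℕ i ℕ.≤_) (ℕP.+-comm n m) (ℕP.+-mono-≤ (toℕ≤ j) (toℕ≤ i))))))))

  -- The largest norm below P on P's ring that gives x norm at most 1.
  adjoin : PreNorm → Carrier → PreNorm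
  adjoin P x = record
    { N = λ a q → ∃[ n ] Span P (powers x n) q a
    ; nonNeg = λ { (n , s) → Span-nonNeg P _ s }
    ; resp = λ { e (n , s) → n , Span-resp P _ e s }
    ; weaken = λ { l (n , s) → n , Span-weaken P _ l s }
    ; add = λ { (m , s) (n , t) → m ℕ.+ n , Span-+ P _ (Span-mono-degree P x (ℕP.m≤m+n m n) s) (Span-mono-degree P x (ℕP.m≤n+m n m) t) }
    ; mul = λ { (m , s) (n , t) → m ℕ.+ n , Span-powers-* P x s t }
    ; rat = λ r → 0 , embed (rat P r)
    }
    where
    embed : ∀ {a q} → N P a q → Span P (powers x 0) q a
    embed {a} {q} n = cons a q 0# 0ℚ n (nil refl ℚP.≤-refl) (sym (trans (+-identityʳ _) (*-identityʳ _))) (ℚP.≤-reflexive (ℚP.+-identityʳ q))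

  record _⊑_ (P Q : PreNorm) : Set where
    constructor mk⊑
    field lift : ∀ {x q} → N P x q → N Q x q
  open _⊑_ public

  ⊑-refl : ∀ {P} → P ⊑ P
  ⊑-refl = mk⊑ (λ n → n)

  ⊑-trans : ∀ {P Q R} → P ⊑ Q → Q ⊑ R → P ⊑ R
  ⊑-trans f g = mk⊑ (λ n → lift g (lift f n))

  ⊑-adjoin : ∀ P x → P ⊑ adjoin P x
  ⊑-adjoin P x = mk⊑ λ {a} {q} n → 0 , cons a q 0# 0ℚ n (nil refl ℚP.≤-refl) (sym (trans (+-identityʳ _) (*-identityʳ _))) (ℚP.≤-reflexive (ℚP.+-identityʳ q))

  adjoin-generator : ∀ P x → N (adjoin P x) x 1ℚ
  adjoin-generator P x = 1 , Span-resp P (powers x 1) (*-identityʳ x) (Span-pow P x 1 1 ℕP.≤-refl)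

  module Elimination (P : PreNorm) (proper : Proper P) where

    Small : ∀ {n} → (Fin n → Carrier) → Set
    Small z = ∀ i η → 0ℚ ℚ.< η → Span P z η (z i)

    ∃quarter : ∀ η → 0ℚ ℚ.< η → ∃[ ζ ] (0ℚ ℚ.< ζ × ζ ℚ.≤ 1ℚ × (ζ ℚ.+ ζ) ℚ.+ (ζ ℚ.+ ζ) ℚ.≤ η)
    ∃quarter η 0<η = ½ ℚ.* (½ ℚ.* η′) , *-pos 0<½ (*-pos 0<½ 0<η′) ,
        ℚP.≤-trans (*-monoˡ (ℚP.<⇒≤ 0<½) (*-monoˡ (ℚP.<⇒≤ 0<½) (ℚP.p⊓q≤q η 1ℚ))) (from-yes (½ ℚ.* (½ ℚ.* 1ℚ) ℚP.≤? 1ℚ)) ,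
        ≡.subst (ℚ._≤ η) (lem η′) (ℚP.p⊓q≤p η 1ℚ)
      where
      η′ = η ℚ.⊓ 1ℚ
      0<½ : 0ℚ ℚ.< ½
      0<½ = from-yes (0ℚ ℚP.<? ½)
      0<η′ : 0ℚ ℚ.< η′
      0<η′ with ℚP.⊓-sel η 1ℚ
      ... | inj₁ e = ≡.subst (0ℚ ℚ.<_) (≡.sym e) 0<η
      ... | inj₂ e = ≡.subst (0ℚ ℚ.<_) (≡.sym e) (from-yes (0ℚ ℚP.<? 1ℚ))
      lem : ∀ e → e ≡ (½ ℚ.* (½ ℚ.* e) ℚ.+ ½ ℚ.* (½ ℚ.* e)) ℚ.+ (½ ℚ.* (½ ℚ.* e) ℚ.+ ½ ℚ.* (½ ℚ.* e))
      lem = solve 1 (λ e → e := (con ½ :* (con ½ :* e) :+ con ½ :* (con ½ :* e)) :+ (con ½ :* (con ½ :* e) :+ con ½ :* (con ½ :* e))) ≡.refl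
        where open ℚSolver

    -- Multiplying the relation for `z (suc i)` by 1 - c₀ allows (1 - c₀) z₀ to be replaced by r₀.
    -- The factor 1 - c₀ is not inverted, since its inverse need have no bound; the term c₀
    -- `z (suc i)` stays on the right as a small multiple of a generator.
    eliminate : ∀ {n} (z : Fin (suc n) → Carrier) i {ζ η} → 0ℚ ℚ.< ζ → ζ ℚ.≤ 1ℚ → (ζ ℚ.+ ζ) ℚ.+ (ζ ℚ.+ ζ) ℚ.≤ η →
                Span P z ζ (z zero) → Span P z ζ (z (suc i)) → Span P (λ i → z (suc i)) η (z (suc i))
    eliminate z i {ζ} {η} 0<ζ ζ≤1 4ζ≤η = go
      where
      z′ = λ i → z (suc i)
      0≤ζ = ℚP.<⇒≤ 0<ζ
      ≤ζ : ∀ {b r} → 0ℚ ℚ.≤ r → b ℚ.+ r ℚ.≤ ζ → b ℚ.≤ ζ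
      ≤ζ {b} 0≤r h = ℚP.≤-trans (≤-by-gap _ 0≤r ≡.refl) h
      ≤ζ′ : ∀ {b r} → 0ℚ ℚ.≤ b → b ℚ.+ r ℚ.≤ ζ → r ℚ.≤ ζ
      ≤ζ′ {b} {r} 0≤b h = ℚP.≤-trans (≤-by-gap _ 0≤b (ℚP.+-comm r b)) h
      go : Span P z ζ (z zero) → Span P z ζ (z (suc i)) → Span P z′ η (z (suc i))
      go (cons c₀ b₀ r₀ q₀ n₀ s₀ e₀ h₀) (cons c b r q n s e h) =
        Span-resp P z′ (sym eq) (Span-weaken P z′ total≤η
          (Span-+ P z′ (Span-+ P z′ t₁ t₂) (Span-+ P z′ t₃ t₄)))
        where
        t₁ : Span P z′ ζ (c₀ * z (suc i))
        t₁ = ≡.subst (λ q → Span P z′ q _) (ℚP.*-identityʳ ζ)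
               (Span-scale P z′ (weaken P (≤ζ (Span-nonNeg P z′ s₀) h₀) n₀) (Span-generator P z′ i))
        t₂ : Span P z′ (ζ ℚ.* ζ) (c * r₀)
        t₂ = Span-scale P z′ (weaken P (≤ζ (Span-nonNeg P z′ s) h) n) (Span-weaken P z′ (≤ζ′ (nonNeg P n₀) h₀) s₀)
        t₃ : Span P z′ ζ r
        t₃ = Span-weaken P z′ (≤ζ′ (nonNeg P n) h) s
        t₄ : Span P z′ (ζ ℚ.* ζ) ((- c₀) * r)
        t₄ = Span-scale P z′ (negN P (weaken P (≤ζ (Span-nonNeg P z′ s₀) h₀) n₀)) t₃
        ζζ≤ζ : ζ ℚ.* ζ ℚ.≤ ζ
        ζζ≤ζ = ≡.subst (ζ ℚ.* ζ ℚ.≤_) (ℚP.*-identityʳ ζ) (*-monoˡ 0≤ζ ζ≤1)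
        total≤η : (ζ ℚ.+ ζ ℚ.* ζ) ℚ.+ (ζ ℚ.+ ζ ℚ.* ζ) ℚ.≤ η
        total≤η = ℚP.≤-trans (ℚP.+-mono-≤ (ℚP.+-monoʳ-≤ ζ ζζ≤ζ) (ℚP.+-monoʳ-≤ ζ ζζ≤ζ)) 4ζ≤η
        eq : z (suc i) ≈ (c₀ * z (suc i) + c * r₀) + (r + (- c₀) * r)
        eq = begin
          z (suc i)
            ≈⟨ solve 2 (λ c w → w := c :* w :+ (w :- c :* w)) refl c₀ (z (suc i)) ⟩
          c₀ * z (suc i) + (z (suc i) - c₀ * z (suc i))
            ≈⟨ +-congˡ (+-cong e (-‿cong (*-congˡ e))) ⟩
          c₀ * z (suc i) + ((c * z zero + r) - c₀ * (c * z zero + r))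
            ≈⟨ solve 5 (λ c₀ w c v r → c₀ :* w :+ ((c :* v :+ r) :- c₀ :* (c :* v :+ r)) := c₀ :* w :+ (c :* (v :- c₀ :* v) :+ (r :+ (:- c₀) :* r))) refl c₀ (z (suc i)) c (z zero) r ⟩
          c₀ * z (suc i) + (c * (z zero - c₀ * z zero) + (r + (- c₀) * r))
            ≈⟨ +-congˡ (+-congʳ (*-congˡ (trans (+-congʳ e₀) (solve 2 (λ t r → (t :+ r) :- t := r) refl (c₀ * z zero) r₀)))) ⟩
          c₀ * z (suc i) + (c * r₀ + (r + (- c₀) * r))
            ≈⟨ sym (+-assoc _ _ _) ⟩
          (c₀ * z (suc i) + c * r₀) + (r + (- c₀) * r) ∎
          where open KSolver

    small-tail : ∀ {n} (z : Fin (suc n) → Carrier) → Small z → Small (λ i → z (suc i))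
    small-tail z small i η 0<η = go (∃quarter η 0<η)
      where
      go : ∃[ ζ ] (0ℚ ℚ.< ζ × ζ ℚ.≤ 1ℚ × (ζ ℚ.+ ζ) ℚ.+ (ζ ℚ.+ ζ) ℚ.≤ η) → Span P (λ i → z (suc i)) η (z (suc i))
      go (ζ , 0<ζ , ζ≤1 , 4ζ≤η) = eliminate z i 0<ζ ζ≤1 4ζ≤η (small zero ζ 0<ζ) (small (suc i) ζ 0<ζ)

    -- Nakayama's lemma without determinants: the head is eliminated from the relations of the tail,
    -- and once the tail vanishes the head satisfies z = c z with ∣c∣ ≤ 1/2. A nonzero z would then
    -- give c = 1, against properness.
    small⇒zero : ∀ {n} (z : Fin n → Carrier) → Small z → ¬ ¬ (∀ i → z i ≈ 0#)
    small⇒zero {zero} z small k = k (λ ())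
    small⇒zero {suc n} z small k = small⇒zero (λ i → z (suc i)) (small-tail z small) λ tail≈0 →
      excluded-middle λ
        { (yes z₀≈0) → k (λ { zero → z₀≈0 ; (suc i) → tail≈0 i })
        ; (no z₀≉0) → nonzero-head tail≈0 z₀≉0 (small zero ½ (from-yes (0ℚ ℚP.<? ½))) }
      where
      nonzero-head : (∀ i → z (suc i) ≈ 0#) → ¬ (z zero ≈ 0#) → ¬ Span P z ½ (z zero)
      nonzero-head tail≈0 z₀≉0 (cons c b r q n s e h) =
        ℚP.<-irrefl ≡.refl (ℚP.<-≤-trans (from-yes (½ ℚP.<? 1ℚ)) (ℚP.≤-trans (proper b (resp P c≈1 n))
          (ℚP.≤-trans (≤-by-gap _ (Span-nonNeg P _ s) ≡.refl) h)))
        where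
        y = proj₁ (inverse (z zero) z₀≉0)
        zy≈1 = proj₂ (inverse (z zero) z₀≉0)
        c≈1 : c ≈ 1#
        c≈1 = begin
          c                    ≈⟨ *-identityʳ c ⟨
          c * 1#               ≈⟨ *-congˡ zy≈1 ⟨
          c * (z zero * y)     ≈⟨ *-assoc _ _ _ ⟨
          (c * z zero) * y     ≈⟨ *-congʳ (sym (trans e (trans (+-congˡ (Span-of-zeros P _ tail≈0 s)) (+-identityʳ _)))) ⟩
          z zero * y           ≈⟨ zy≈1 ⟩
          1# ∎

    -- Substituting the relations into themselves s times brings the coefficients down to θˢ.
    contracting⇒small : ∀ {n} (z : Fin n → Carrier) {θ} → 0ℚ ℚ.≤ θ → θ ℚ.< 1ℚ → (∀ i → Span P z θ (z i)) → Small z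
    contracting⇒small z {θ} 0≤θ θ<1 f i η 0<η = go (^-vanishes 0≤θ θ<1 η 0<η)
      where
      go : ∃[ s ] (θ ^ℚ s) ℚ.≤ η → Span P z η (z i)
      iterate : ∀ s i → Span P z (θ ^ℚ s) (z i)
      iterate zero i = Span-generator P z i
      iterate (suc s) i = Span-resp P z (*-identityʳ _)
        (Span-substitute P z z 1# (^-nonNeg s 0≤θ) (f i) (λ j → Span-resp P z (sym (*-identityʳ _)) (iterate s j)))
      go (s , h) = Span-weaken P z h (iterate s i)

    -- Relations 1 = Σ aᵢ xⁱ and 1 = Σ bᵢ yⁱ with small coefficients express each of 1, x, …, xᵐ⁺ⁿ by a small combination of them all.
    no-two-relations : ∀ {x y p q} → x * y ≈ 1# → p ℚ.< 1ℚ → q ℚ.< 1ℚ → N (adjoin P x) 1# p → N (adjoin P y) 1# q → ⊥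
    no-two-relations {x} {y} {p} {q} xy≈1 p<1 q<1 (m , s) (n , t) =
      small⇒zero z (contracting⇒small z 0≤θ θ<1 step) (λ z≈0 → 1≉0 (z≈0 zero))
      where
      z = powers x (m ℕ.+ n)
      θ = p ℚ.⊔ q
      0≤θ = ℚP.≤-trans (Span-nonNeg P _ s) (ℚP.p≤p⊔q p q)
      θ<1 : θ ℚ.< 1ℚ
      θ<1 with ℚP.⊔-sel p q
      ... | inj₁ e = ≡.subst (ℚ._< 1ℚ) (≡.sym e) p<1
      ... | inj₂ e = ≡.subst (ℚ._< 1ℚ) (≡.sym e) q<1
      shift-down : ∀ l i → l ℕ.≤ i → pow y l * pow x i ≈ pow x (i ℕ.∸ l)
      shift-down l i l≤i = begin
        pow y l * pow x i                          ≡⟨ ≡.cong (λ j → pow y l * pow x j) (≡.sym (ℕP.m+[n∸m]≡n l≤i)) ⟩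
        pow y l * pow x (l ℕ.+ (i ℕ.∸ l))          ≈⟨ *-congˡ (pow-+ x l _) ⟩
        pow y l * (pow x l * pow x (i ℕ.∸ l))      ≈⟨ *-assoc _ _ _ ⟨
        (pow y l * pow x l) * pow x (i ℕ.∸ l)      ≈⟨ *-congʳ (trans (*-comm _ _) (pow-inverse xy≈1 l)) ⟩
        1# * pow x (i ℕ.∸ l)                       ≈⟨ *-identityˡ _ ⟩
        pow x (i ℕ.∸ l) ∎
      step : ∀ i → Span P z θ (z i)
      step i with toℕ i ℕP.≤? n
      ... | yes i≤n = Span-weaken P z (ℚP.p≤p⊔q p q) (≡.subst (λ r → Span P z r (z i)) (ℚP.*-identityʳ p)
              (Span-resp P z (*-identityˡ _) (Span-substitute P (powers x m) z (pow x (toℕ i)) 0≤1 s (λ l →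
                Span-resp P z (pow-+ x (toℕ l) (toℕ i)) (Span-pow P x (m ℕ.+ n) (toℕ l ℕ.+ toℕ i) (ℕP.+-mono-≤ (toℕ≤ P l) i≤n))))))
      ... | no i≰n = Span-weaken P z (ℚP.p≤q⊔p p q) (≡.subst (λ r → Span P z r (z i)) (ℚP.*-identityʳ q)
              (Span-resp P z (*-identityˡ _) (Span-substitute P (powers y n) z (pow x (toℕ i)) 0≤1 t (λ l →
                Span-resp P z (sym (shift-down (toℕ l) (toℕ i) (ℕP.≤-trans (toℕ≤ P l) (ℕP.<⇒≤ (ℕP.≰⇒> i≰n)))))
                  (Span-pow P x (m ℕ.+ n) (toℕ i ℕ.∸ toℕ l) (ℕP.≤-trans (ℕP.m∸n≤m (toℕ i) (toℕ l)) (toℕ≤ P i)))))))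

  -- The key step of Chevalley's extension theorem in normed form: if both extensions were improper,
  -- each would yield a relation that expresses 1 with coefficients of total size below 1, and two
  -- such relations contradict each other.
  adjoin-or-adjoin-inverse : ∀ P → Proper P → ∀ x y → x * y ≈ 1# → ¬ ¬ (Proper (adjoin P x) ⊎ Proper (adjoin P y))
  adjoin-or-adjoin-inverse P proper x y xy≈1 k = improper (adjoin P x) (λ h → k (inj₁ h)) λ { (p , p<1 , s) →
      improper (adjoin P y) (λ h → k (inj₂ h)) λ { (q , q<1 , t) → Elimination.no-two-relations P proper xy≈1 p<1 q<1 s t } }
    where
    improper : ∀ Q → ¬ Proper Q → ¬ ¬ (∃[ q ] (q ℚ.< 1ℚ × N Q 1# q))
    improper Q np k = np (λ q n → ℚP.≮⇒≥ (λ q<1 → k (q , q<1 , n)))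

-- Finite families of extensions, maxima, and Gaussian rationals.

module Approximation (K : ACF₀) where
  open ACF₀ K
  open RationalEmbedding K
  open RationalLemmas
  open Norms K
  open PreNorm
  open import Data.Nat.Base using (zero; suc)
  open import Data.Integer.Base using (+_)
  open import Data.Fin.Base using (Fin; zero; suc; toℕ)
  open import Data.Rational.Base as ℚ using (ℚ; 0ℚ; 1ℚ; _/_)
  import Data.Rational.Properties as ℚP
  open import Data.Rational.Solver using () renaming (module +-*-Solver to ℚSolver)
  open import Data.Product using (∃-syntax; Σ-syntax; _×_; _,_; proj₁; proj₂)
  open import Data.Sum using (inj₁; inj₂)
  open import Data.List.Base using (List; []; _∷_)
  open import Data.List.Membership.Propositional using (_∈_)
  open import Data.List.Relation.Unary.Any using (here; there)
  open import Data.List.Relation.Unary.All as All using (All; []; _∷_)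
  open import Relation.Nullary using (¬_; yes; no)
  open import Relation.Nullary.Decidable using (from-yes)
  open import Relation.Binary.PropositionalEquality as ≡ using (_≡_)
  open import Relation.Binary.Reasoning.Setoid setoid

  Extension : PreNorm → (PreNorm → Set) → Set₁
  Extension P Φ = Σ[ Q ∈ PreNorm ] (P ⊑ Q × Proper Q × Φ Q)

  -- A condition that is monotone along `⊑` survives later extensions, so finitely many can be
  -- achieved one after the other. `P₀` lies below all intermediate norms and thus keeps the bounds
  -- that each step relies on.
  family : ∀ {n} (Φ : Fin n → PreNorm → Set) → (∀ i {P Q} → P ⊑ Q → Φ i P → Φ i Q) →
           ∀ P₀ → (∀ i P → P₀ ⊑ P → Proper P → ¬ ¬ Extension P (Φ i)) →
           ∀ P → P₀ ⊑ P → Proper P → ¬ ¬ Extension P (λ Q → ∀ i → Φ i Q)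
  family {zero} Φ mono P₀ step P P₀⊑P proper k = k (P , ⊑-refl , proper , λ ())
  family {suc n} Φ mono P₀ step P P₀⊑P proper k =
    step zero P P₀⊑P proper λ { (Q , P⊑Q , Q-proper , φ) →
      family (λ i → Φ (suc i)) (λ i → mono (suc i)) P₀ (λ i → step (suc i)) Q (⊑-trans P₀⊑P P⊑Q) Q-proper λ { (R , Q⊑R , R-proper , ψ) →
        k (R , ⊑-trans P⊑Q Q⊑R , R-proper , λ { zero → mono zero Q⊑R φ ; (suc i) → ψ i }) } }

  module _ {A : Set} (u v : A → Carrier) (uv≈1 : ∀ a → u a * v a ≈ 1#) where

    IsMaximum : A → List A → PreNorm → Set
    IsMaximum a xs Q = All (λ b → N Q (u b * v a) 1ℚ) xs

    -- Each new element is compared with the current maximum by adjoining their ratio or its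
    -- inverse. If the new element wins, the earlier bounds are carried over by multiplying with the
    -- bound on the old maximum.
    maximum : ∀ P → Proper P → ∀ x xs → ¬ ¬ Extension P (λ Q → ∃[ a ] (a ∈ x ∷ xs × IsMaximum a (x ∷ xs) Q))
    maximum P proper x [] k = k (P , ⊑-refl , proper , x , here ≡.refl , resp P (sym (uv≈1 x)) (oneN P) ∷ [])
    maximum P proper x (y ∷ xs) k = maximum P proper x xs λ { (Q , P⊑Q , Q-proper , a , a∈ , (mx ∷ m)) →
      let r = u y * v a
          r′ = u a * v y
          rr′≈1 : r * r′ ≈ 1#
          rr′≈1 = trans (solve 4 (λ a b c d → (a :* b) :* (c :* d) := (a :* d) :* (c :* b)) refl (u y) (v a) (u a) (v y))
                        (trans (*-cong (uv≈1 y) (uv≈1 a)) (*-identityˡ _))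
          insert : ∀ {b} → b ∈ x ∷ xs → b ∈ x ∷ y ∷ xs
          insert = λ { (here e) → here e ; (there t) → there (there t) }
      in adjoin-or-adjoin-inverse Q Q-proper r r′ rr′≈1 λ
        { (inj₁ proper-r) → k (adjoin Q r , ⊑-trans P⊑Q (⊑-adjoin Q r) , proper-r , a , insert a∈ ,
            lift (⊑-adjoin Q r) mx ∷ adjoin-generator Q r ∷ All.map (lift (⊑-adjoin Q r)) m)
        ; (inj₂ proper-r′) →
            let Q′ = adjoin Q r′
                Q⊑Q′ = ⊑-adjoin Q r′
                via-a : ∀ {b} → N Q (u b * v a) 1ℚ → N Q′ (u b * v y) 1ℚ
                via-a {b} n = resp Q′
                  (trans (solve 4 (λ b a c d → (b :* a) :* (c :* d) := (b :* d) :* (c :* a)) refl (u b) (v a) (u a) (v y))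
                    (trans (*-congˡ (uv≈1 a)) (*-identityʳ _)))
                  (mul Q′ (lift Q⊑Q′ n) (adjoin-generator Q r′))
            in k (Q′ , ⊑-trans P⊑Q Q⊑Q′ , proper-r′ , y , there (here ≡.refl) ,
                 via-a mx ∷ resp Q′ (sym (uv≈1 y)) (oneN Q′) ∷ All.map via-a m) } }
      where open KSolver

  private
    coefficients : Fin 2 → Carrier
    coefficients zero    = 1#
    coefficients (suc _) = 0#

    root : ∃[ i ] (pow i 2 + sumK (λ j → coefficients j * pow i (toℕ j)) ≈ 0#)
    root = algClosed 1 coefficients

  𝕚 : Carrier
  𝕚 = proj₁ root

  𝕚²≈-1 : 𝕚 * 𝕚 ≈ - 1#
  𝕚²≈-1 = begin
    𝕚 * 𝕚                        ≈⟨ *-congˡ (*-identityʳ 𝕚) ⟨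
    pow 𝕚 2                      ≈⟨ +-identityʳ _ ⟨
    pow 𝕚 2 + 0#                 ≈⟨ +-congˡ (-‿inverseʳ 1#) ⟨
    pow 𝕚 2 + (1# - 1#)          ≈⟨ +-assoc _ _ _ ⟨
    (pow 𝕚 2 + 1#) - 1#          ≈⟨ +-congʳ (+-congˡ constant-term) ⟨
    (pow 𝕚 2 + sumK (λ j → coefficients j * pow 𝕚 (toℕ j))) - 1#  ≈⟨ +-congʳ (proj₂ root) ⟩
    0# - 1#                      ≈⟨ +-identityˡ _ ⟩
    - 1# ∎
    where
    constant-term : sumK (λ j → coefficients j * pow 𝕚 (toℕ j)) ≈ 1#
    constant-term = trans (+-cong (*-identityˡ 1#) (trans (+-identityʳ _) (zeroˡ _))) (+-identityʳ 1#)

  -- The inverse of 𝕚 is -𝕚, so either alternative gives 𝕚 norm at most 1.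
  adjoin-𝕚 : ∀ P → Proper P → ¬ ¬ Extension P (λ Q → N Q 𝕚 1ℚ)
  adjoin-𝕚 P proper k = adjoin-or-adjoin-inverse P proper 𝕚 (- 𝕚) 𝕚*-𝕚≈1 λ
    { (inj₁ h) → k (adjoin P 𝕚 , ⊑-adjoin P 𝕚 , h , adjoin-generator P 𝕚)
    ; (inj₂ h) → k (adjoin P (- 𝕚) , ⊑-adjoin P (- 𝕚) , h ,
        resp (adjoin P (- 𝕚)) (-‿involutive 𝕚) (negN (adjoin P (- 𝕚)) (adjoin-generator P (- 𝕚)))) }
    where
    open import Algebra.Properties.Ring ring using (-‿involutive; -‿distribʳ-*)
    𝕚*-𝕚≈1 : 𝕚 * - 𝕚 ≈ 1#
    𝕚*-𝕚≈1 = trans (sym (-‿distribʳ-* 𝕚 𝕚)) (trans (-‿cong 𝕚²≈-1) (-‿involutive 1#))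

  ℚ[i] : Set
  ℚ[i] = ℚ × ℚ

  embed : ℚ[i] → Carrier
  embed (p , q) = ι p + 𝕚 * ι q

  N-ι : ∀ P {r} → 0ℚ ℚ.≤ r → N P (ι r) r
  N-ι P {r} 0≤r = ≡.subst (N P (ι r)) (ℚP.0≤p⇒∣p∣≡p 0≤r) (rat P r)

  -- Properness speaks of 1 only; multiplying by 1/r carries it to r. Together with `rat`, a proper
  -- norm therefore agrees with the absolute value on ℚ.
  ι-bound : ∀ P → Proper P → ∀ {r b} → N P (ι r) b → r ℚ.≤ b
  ι-bound P proper {r} {b} n with r ℚP.≤? 0ℚ
  ... | yes r≤0 = ℚP.≤-trans r≤0 (nonNeg P n)
  ... | no r≰0 = ≡.subst₂ ℚ._≤_ (ℚP.*-identityˡ r) eq (*-monoʳ (ℚP.<⇒≤ 0<r)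
      (proper (b ℚ.* s) (resp P e (mul P n (N-ι P (ℚP.<⇒≤ 0<s))))))
    where
    0<r = ℚP.≰⇒> r≰0
    instance
      r+ : ℚ.Positive r
      r+ = ℚ.positive 0<r
      r≢0 : ℚ.NonZero r
      r≢0 = ℚP.pos⇒nonZero r
    s = ℚ.1/ r
    0<s : 0ℚ ℚ.< s
    0<s = ℚP.positive⁻¹ s {{ℚP.1/pos⇒pos r}}
    e : ι r * ι s ≈ 1#
    e = trans (sym (ι-* r s)) (trans (ι-cong (ℚP.*-inverseʳ r)) ι-1)
    eq : b ℚ.* s ℚ.* r ≡ b
    eq = ≡.trans (ℚP.*-assoc b s r) (≡.trans (≡.cong (b ℚ.*_) (ℚP.*-inverseˡ r)) (ℚP.*-identityʳ b))

  -- Were u > 2e, four times the difference u² + v² - e(u + v) would be e² plus terms that are not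
  -- negative; `lem` is this certificate.
  sum-of-squares-bound : ∀ {u v e} → 0ℚ ℚ.< e → u ℚ.* u ℚ.+ v ℚ.* v ℚ.≤ e ℚ.* (u ℚ.+ v) → u ℚ.≤ e ℚ.+ e
  sum-of-squares-bound {u} {v} {e} 0<e h = ℚP.≮⇒≥ λ 2e<u → ℚP.<-irrefl ≡.refl (ℚP.<-≤-trans (*-pos 0<e 0<e)
      (ℚP.≤-trans (≤-by-gap _ (+-nonNeg (*-nonNeg (ℚP.<⇒≤ 0<4) (gap 2e<u)) (+-nonNeg (*-nonNeg (ℚP.<⇒≤ 0<6) (square-nonNeg e)) (square-nonNeg (v ℚ.+ v ℚ.- e)))) (lem u v e))
        (ℚP.≤-trans (*-monoˡ (ℚP.<⇒≤ 0<4) (p≤0 h)) (from-yes (c4 ℚ.* 0ℚ ℚP.≤? 0ℚ)))))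
    where
    c4 = + 4 / 1
    c6 = + 6 / 1
    0<4 : 0ℚ ℚ.< c4
    0<4 = from-yes (0ℚ ℚP.<? c4)
    0<6 : 0ℚ ℚ.< c6
    0<6 = from-yes (0ℚ ℚP.<? c6)
    gap : e ℚ.+ e ℚ.< u → 0ℚ ℚ.≤ (u ℚ.- (e ℚ.+ e)) ℚ.* (u ℚ.+ e)
    gap 2e<u = *-nonNeg (p≤q⇒0≤q-p (ℚP.<⇒≤ 2e<u)) (+-nonNeg (ℚP.≤-trans (+-nonNeg (ℚP.<⇒≤ 0<e) (ℚP.<⇒≤ 0<e)) (ℚP.<⇒≤ 2e<u)) (ℚP.<⇒≤ 0<e))
    p≤0 : ∀ {a b} → a ℚ.≤ b → a ℚ.- b ℚ.≤ 0ℚ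
    p≤0 {a} {b} a≤b = ≡.subst (a ℚ.- b ℚ.≤_) (ℚP.+-inverseʳ b) (ℚP.+-monoˡ-≤ (ℚ.- b) a≤b)
    open ℚSolver
    lem : ∀ u v e → e ℚ.* e ℚ.+ (c4 ℚ.* ((u ℚ.- (e ℚ.+ e)) ℚ.* (u ℚ.+ e)) ℚ.+ (c6 ℚ.* (e ℚ.* e) ℚ.+ (v ℚ.+ v ℚ.- e) ℚ.* (v ℚ.+ v ℚ.- e)))
          ≡ c4 ℚ.* (u ℚ.* u ℚ.+ v ℚ.* v ℚ.- e ℚ.* (u ℚ.+ v))
    lem = solve 3 (λ u v e → e :* e :+ (con c4 :* ((u :- (e :+ e)) :* (u :+ e)) :+ (con c6 :* (e :* e) :+ (v :+ v :- e) :* (v :+ v :- e)))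
          := con c4 :* (u :* u :+ v :* v :- e :* (u :+ v))) ≡.refl

  -- Multiplying by the conjugate, whose norm is at most ∣p∣ + ∣q∣, leads to the rational p² + q²,
  -- to which the lower bound of `ι-bound` applies. So a small Gaussian rational has small
  -- components.
  embed-bound : ∀ P → Proper P → N P 𝕚 1ℚ → ∀ {p q e} → 0ℚ ℚ.< e → N P (embed (p , q)) e →
                ℚ.∣ p ∣ ℚ.≤ e ℚ.+ e × ℚ.∣ q ∣ ℚ.≤ e ℚ.+ e
  embed-bound P proper n𝕚 {p} {q} {e} 0<e n =
      sum-of-squares-bound 0<e squares , sum-of-squares-bound 0<e (≡.subst₂ ℚ._≤_ (ℚP.+-comm (∣p∣ ℚ.* ∣p∣) _) (≡.cong (e ℚ.*_) (ℚP.+-comm ∣p∣ _)) squares)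
    where
    ∣p∣ = ℚ.∣ p ∣
    ∣q∣ = ℚ.∣ q ∣
    conjugate : N P (ι p - 𝕚 * ι q) (∣p∣ ℚ.+ ∣q∣)
    conjugate = subN P (rat P p) (≡.subst (N P _) (ℚP.*-identityˡ ∣q∣) (mul P n𝕚 (rat P q)))
    product : (ι p + 𝕚 * ι q) * (ι p - 𝕚 * ι q) ≈ ι (p ℚ.* p ℚ.+ q ℚ.* q)
    product = begin
      (ι p + 𝕚 * ι q) * (ι p - 𝕚 * ι q)   ≈⟨ solve 3 (λ p q i → (p :+ i :* q) :* (p :- i :* q) := p :* p :- (i :* i) :* (q :* q)) refl (ι p) (ι q) 𝕚 ⟩
      ι p * ι p - (𝕚 * 𝕚) * (ι q * ι q)   ≈⟨ +-congˡ (-‿cong (*-congʳ 𝕚²≈-1)) ⟩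
      ι p * ι p - (- 1#) * (ι q * ι q)    ≈⟨ +-congˡ (trans (-‿cong (-1*x≈-x _)) (-‿involutive _)) ⟩
      ι p * ι p + ι q * ι q               ≈⟨ +-cong (ι-* p p) (ι-* q q) ⟨
      ι (p ℚ.* p) + ι (q ℚ.* q)           ≈⟨ ι-+ (p ℚ.* p) (q ℚ.* q) ⟨
      ι (p ℚ.* p ℚ.+ q ℚ.* q) ∎
      where
      open KSolver
      open import Algebra.Properties.Ring ring using (-1*x≈-x; -‿involutive)
    abs-square : ∀ r → ℚ.∣ r ∣ ℚ.* ℚ.∣ r ∣ ≡ r ℚ.* r
    abs-square r = ≡.trans (≡.sym (ℚP.∣p*q∣≡∣p∣*∣q∣ r r)) (ℚP.0≤p⇒∣p∣≡p (square-nonNeg r))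
    squares : ∣p∣ ℚ.* ∣p∣ ℚ.+ ∣q∣ ℚ.* ∣q∣ ℚ.≤ e ℚ.* (∣p∣ ℚ.+ ∣q∣)
    squares = ≡.subst (ℚ._≤ e ℚ.* (∣p∣ ℚ.+ ∣q∣)) (≡.sym (≡.cong₂ ℚ._+_ (abs-square p) (abs-square q)))
      (ι-bound P proper (resp P product (mul P n conjugate)))

-- A finite certificate in place of Liouville's theorem.

module GelfandMazur (K : ACF₀) where
  open ACF₀ K
  open RationalEmbedding K
  open Norms K
  open Approximation K
  open PreNorm
  open import Data.Nat.Base as ℕ using (ℕ)
  open import Data.Integer.Base using (+_)
  open import Data.Rational.Base as ℚ using (ℚ; 0ℚ; 1ℚ; _/_)
  import Data.Rational.Properties as ℚP
  open import Data.Rational.Solver using () renaming (module +-*-Solver to ℚSolver)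
  open import Data.Product using (∃-syntax; _×_; _,_; proj₁; proj₂)
  open import Data.Sum using (_⊎_; inj₁; inj₂)
  open import Data.Empty using (⊥)
  open import Relation.Nullary using (¬_; yes; no)
  open import Relation.Nullary.Decidable using (from-yes)
  open import Relation.Binary.PropositionalEquality as ≡ using (_≡_)
  open import Relation.Binary.Reasoning.Setoid setoid
  open import Algebra.Properties.Ring ring using (-‿distribˡ-*)

  -- κ only has to be close enough to 1 for resolvent-bound below.
  κ θ : ℚ
  κ = + 81 / 80
  θ = + 80 / 81

  0<θ : 0ℚ ℚ.< θ
  0<θ = from-yes (0ℚ ℚP.<? θ)

  0≤κ : 0ℚ ℚ.≤ κ
  0≤κ = from-yes (0ℚ ℚP.≤? κ)

  ι-θκ : ι θ * ι κ ≈ 1#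
  ι-θκ = trans (sym (ι-* θ κ)) ι-1

  ι-κθ : ι κ * ι θ ≈ 1#
  ι-κθ = trans (*-comm _ _) ι-θκ

  Inverse≤κ : Carrier → PreNorm → Set
  Inverse≤κ y Q = ∃[ y′ ] (y * y′ ≈ 1# × N Q y′ κ)

  Inverse≤κ-mono : ∀ {y P Q} → P ⊑ Q → Inverse≤κ y P → Inverse≤κ y Q
  Inverse≤κ-mono P⊑Q (y′ , e , n) = y′ , e , lift P⊑Q n

  -- The elements κy and θ/y are inverse to each other, so one of them can be given norm at most 1.
  -- This compares y with the radius θ.
  dichotomy : ∀ P → Proper P → ∀ y → ¬ ¬ Extension P (λ Q → N Q y θ ⊎ Inverse≤κ y Q)
  dichotomy P proper y k = excluded-middle λ
    { (yes y≈0) → k (P , ⊑-refl , proper , inj₁ (resp P (sym y≈0) (weaken P (ℚP.<⇒≤ 0<θ) (zeroN P))))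
    ; (no y≉0) →
        let y′ = proj₁ (inverse y y≉0)
            yy′≈1 = proj₂ (inverse y y≉0)
        in adjoin-or-adjoin-inverse P proper (ι κ * y) (ι θ * y′) (unit yy′≈1) λ
          { (inj₁ h) → k (adjoin P (ι κ * y) , ⊑-adjoin P _ , h , inj₁ (rescale (adjoin P (ι κ * y)) θ κ (ℚP.<⇒≤ 0<θ) ι-θκ (adjoin-generator P _)))
          ; (inj₂ h) → k (adjoin P (ι θ * y′) , ⊑-adjoin P _ , h , inj₂ (y′ , yy′≈1 , rescale (adjoin P (ι θ * y′)) κ θ 0≤κ ι-κθ (adjoin-generator P _))) } }
    where
    open KSolver using (solve; _:=_; _:*_)
    unit : ∀ {y′} → y * y′ ≈ 1# → (ι κ * y) * (ι θ * y′) ≈ 1#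
    unit {y′} e = trans (solve 4 (λ a b c d → (a :* b) :* (c :* d) := (a :* c) :* (b :* d)) refl (ι κ) y (ι θ) y′)
                   (trans (*-cong ι-κθ e) (*-identityˡ _))
    rescale : ∀ Q r s {x} → 0ℚ ℚ.≤ r → ι r * ι s ≈ 1# → N Q (ι s * x) 1ℚ → N Q x r
    rescale Q r s 0≤r e n = resp Q (trans (sym (*-assoc _ _ _)) (trans (*-congʳ e) (*-identityˡ _)))
      (≡.subst (N Q _) (ℚP.*-identityʳ r) (mul Q (N-ι Q 0≤r) n))

  ⅓ : ℚ
  ⅓ = + 1 / 3

  fourth : Carrier → Carrier
  fourth x = (x * x) * (x * x)

  fourth-cong : ∀ {x y} → x ≈ y → fourth x ≈ fourth y
  fourth-cong e = *-cong (*-cong e e) (*-cong e e)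

  -- For a fourth root of unity ω: (1 - S⁴) / (1/S - ω) = S + ω S² + ω² S³ + ω³ S⁴.
  resolvent : ∀ {X S R ω} → X * S ≈ 1# → fourth ω ≈ 1# → (X - ω) * R ≈ 1# →
              (1# - fourth S) * R ≈ S + ω * (S * S) + (ω * ω) * (S * (S * S)) + (ω * (ω * ω)) * fourth S
  resolvent {X} {S} {R} {ω} XS≈1 ω⁴≈1 inv = begin
    G * R                              ≈⟨ trans (sym (*-identityˡ _)) (*-congʳ (sym XS≈1)) ⟩
    (X * S) * (G * R)                  ≈⟨ solve 4 (λ X S G R → (X :* S) :* (G :* R) := X :* ((S :* G) :* R)) refl X S G R ⟩
    X * ((S * G) * R)                  ≈⟨ *-congˡ (*-congʳ SG) ⟩
    X * ((p * (1# - ω * S)) * R)       ≈⟨ *-congˡ (*-congʳ (*-congˡ (+-congʳ (sym XS≈1)))) ⟩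
    X * ((p * (X * S - ω * S)) * R)    ≈⟨ solve 5 (λ X p S w R → X :* ((p :* (X :* S :- w :* S)) :* R) := p :* ((X :* S) :* ((X :- w) :* R))) refl X p S ω R ⟩
    p * ((X * S) * ((X - ω) * R))      ≈⟨ *-congˡ (trans (*-cong XS≈1 inv) (*-identityˡ _)) ⟩
    p * 1#                             ≈⟨ *-identityʳ _ ⟩
    p ∎
    where
    open KSolver
    G = 1# - fourth S
    p = S + ω * (S * S) + (ω * ω) * (S * (S * S)) + (ω * (ω * ω)) * fourth S
    SG : S * G ≈ p * (1# - ω * S)
    SG = begin
      S * (1# - fourth S)              ≈⟨ solve 3 (λ S o f → S :* (o :- f) := S :* o :- (S :* f)) refl S 1# (fourth S) ⟩
      S * 1# - S * fourth S            ≈⟨ +-congˡ (-‿cong (trans (sym (*-identityˡ _)) (*-congʳ (sym ω⁴≈1)))) ⟩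
      S * 1# - fourth ω * (S * fourth S) ≈⟨ +-cong (*-identityʳ _) refl ⟩
      S - fourth ω * (S * fourth S)    ≈⟨ solve 2 (λ S w → S :- ((w :* w) :* (w :* w)) :* (S :* ((S :* S) :* (S :* S)))
                                            := (S :+ w :* (S :* S) :+ (w :* w) :* (S :* (S :* S)) :+ (w :* (w :* w)) :* ((S :* S) :* (S :* S))) :* (con 1ℚ :- w :* S)) refl S ω ⟩
      p * (ι 1ℚ - ω * S)               ≈⟨ *-congˡ (+-congʳ ι-1) ⟩
      p * (1# - ω * S) ∎

  -- The four resolvents combine to isolate the powers of S that are ≡ 1 mod 4.
  resolvent-identity : ∀ {S p₀ p₁ p₂ p₃} →
    p₀ ≈ (S + S * (S * S)) + (S * S + fourth S) → p₂ ≈ (S + S * (S * S)) - (S * S + fourth S) →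
    p₁ ≈ (S - S * (S * S)) + 𝕚 * (S * S - fourth S) → p₃ ≈ (S - S * (S * S)) - 𝕚 * (S * S - fourth S) →
    (fourth p₀ - fourth p₂) - 𝕚 * (fourth p₁ - fourth p₃) ≈ ι (+ 16 / 1) * (S * fourth S) + (ι (+ 160 / 1) * (S * (fourth S * fourth S)) + ι (+ 80 / 1) * (S * (fourth S * (fourth S * fourth S))))
  resolvent-identity {S} {p₀} {p₁} {p₂} {p₃} e₀ e₂ e₁ e₃ = begin
    (fourth p₀ - fourth p₂) - 𝕚 * (fourth p₁ - fourth p₃)
      ≈⟨ +-cong (+-cong (fourth-cong e₀) (-‿cong (fourth-cong e₂))) (-‿cong (*-congˡ (+-cong (fourth-cong e₁) (-‿cong (fourth-cong e₃))))) ⟩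
    (fourth (a + b) - fourth (a - b)) - 𝕚 * (fourth (c + 𝕚 * d) - fourth (c - 𝕚 * d))
      ≈⟨ solve 5 (λ a b c d i → let f = λ x → (x :* x) :* (x :* x) in
           (f (a :+ b) :- f (a :- b)) :- i :* (f (c :+ i :* d) :- f (c :- i :* d))
           := con c8 :* ((a :* b) :* (a :* a :+ b :* b)) :- (i :* i) :* (con c8 :* ((c :* d) :* (c :* c :+ (i :* i) :* (d :* d))))) refl a b c d 𝕚 ⟩
    ι c8 * ((a * b) * (a * a + b * b)) - (𝕚 * 𝕚) * (ι c8 * ((c * d) * (c * c + (𝕚 * 𝕚) * (d * d))))
      ≈⟨ +-congˡ (-‿cong (*-cong i²≈ (*-congˡ (*-congˡ (+-congˡ (*-congʳ i²≈)))))) ⟩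
    ι c8 * ((a * b) * (a * a + b * b)) - (ι (ℚ.- 1ℚ)) * (ι c8 * ((c * d) * (c * c + (ι (ℚ.- 1ℚ)) * (d * d))))
      ≈⟨ solve 1 (λ S → let S³ = S :* (S :* S) ; S⁴ = (S :* S) :* (S :* S) ; a = S :+ S³ ; b = S :* S :+ S⁴ ; c = S :- S³ ; d = S :* S :- S⁴ in
           con c8 :* ((a :* b) :* (a :* a :+ b :* b)) :- con (ℚ.- 1ℚ) :* (con c8 :* ((c :* d) :* (c :* c :+ con (ℚ.- 1ℚ) :* (d :* d))))
           := con (+ 16 / 1) :* (S :* S⁴) :+ (con (+ 160 / 1) :* (S :* (S⁴ :* S⁴)) :+ con (+ 80 / 1) :* (S :* (S⁴ :* (S⁴ :* S⁴))))) refl S ⟩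
    ι (+ 16 / 1) * (S * fourth S) + (ι (+ 160 / 1) * (S * (fourth S * fourth S)) + ι (+ 80 / 1) * (S * (fourth S * (fourth S * fourth S)))) ∎
    where
    open KSolver
    c8 = + 8 / 1
    a = S + S * (S * S)
    b = S * S + fourth S
    c = S - S * (S * S)
    d = S * S - fourth S
    i²≈ : 𝕚 * 𝕚 ≈ ι (ℚ.- 1ℚ)
    i²≈ = trans 𝕚²≈-1 (sym (trans (ι-neg 1ℚ) (-‿cong ι-1)))

  module _ (Q : PreNorm) (n𝕚 : N Q 𝕚 1ℚ) where

    private
      num : ∀ a b .{{_ : ℕ.NonZero b}} → ℚ
      num a b = + a / b

    -- The five inverses in `resolvent-bound` all have norm at most κ/3 = 27/80, whose fourth power
    -- is just below 13/1000.
    N-fourth : ∀ {x} → N Q x (κ ℚ.* ⅓) → N Q (fourth x) (num 13 1000)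
    N-fourth n = weaken Q (from-yes (((κ ℚ.* ⅓) ℚ.* (κ ℚ.* ⅓)) ℚ.* ((κ ℚ.* ⅓) ℚ.* (κ ℚ.* ⅓)) ℚP.≤? num 13 1000)) (mul Q (mul Q n n) (mul Q n n))

    -- 16 = X⁵ G⁴ Z - 160 S⁴ - 80 S⁸, where the right-hand side has norm below 16.
    resolvent-bound : ∀ {X S R₀ R₁ R₂ R₃} → Proper Q → N Q X (num 3 1) → X * S ≈ 1# → N Q S (κ ℚ.* ⅓) →
      (X - 1#) * R₀ ≈ 1# → (X - 𝕚) * R₁ ≈ 1# → (X - (- 1#)) * R₂ ≈ 1# → (X - (- 𝕚)) * R₃ ≈ 1# →
      N Q R₀ (κ ℚ.* ⅓) → N Q R₁ (κ ℚ.* ⅓) → N Q R₂ (κ ℚ.* ⅓) → N Q R₃ (κ ℚ.* ⅓) → ⊥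
    resolvent-bound {X} {S} {R₀} {R₁} {R₂} {R₃} proper nX XS≈1 nS i₀ i₁ i₂ i₃ n₀ n₁ n₂ n₃ =
      ℚP.<-irrefl ≡.refl (ℚP.<-≤-trans (from-yes (num 156 10 ℚP.<? num 16 1)) (ι-bound Q proper (resp Q (sym identity) total)))
      where
      open KSolver
      G = 1# - fourth S
      Z = (fourth R₀ - fourth R₂) - 𝕚 * (fourth R₁ - fourth R₃)
      X⁵ = X * fourth X
      S⁴ = fourth S
      nX⁵ : N Q X⁵ (num 243 1)
      nX⁵ = mul Q nX (mul Q (mul Q nX nX) (mul Q nX nX))
      nG : N Q G (1ℚ ℚ.+ num 13 1000)
      nG = subN Q (oneN Q) (N-fourth nS)
      nG⁴ : N Q (fourth G) (num 53 50)
      nG⁴ = weaken Q (from-yes (((1ℚ ℚ.+ num 13 1000) ℚ.* (1ℚ ℚ.+ num 13 1000)) ℚ.* ((1ℚ ℚ.+ num 13 1000) ℚ.* (1ℚ ℚ.+ num 13 1000)) ℚP.≤? num 53 50))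
              (mul Q (mul Q nG nG) (mul Q nG nG))
      nZ : N Q Z (num 13 250)
      nZ = subN Q (subN Q (N-fourth n₀) (N-fourth n₂)) (mul Q n𝕚 (subN Q (N-fourth n₁) (N-fourth n₃)))
      total : N Q (X⁵ * (fourth G * Z) - (ι (num 160 1) * S⁴ + ι (num 80 1) * (S⁴ * S⁴))) (num 156 10)
      total = weaken Q (from-yes (num 243 1 ℚ.* (num 53 50 ℚ.* num 13 250) ℚ.+ (num 160 1 ℚ.* num 13 1000 ℚ.+ num 80 1 ℚ.* (num 13 1000 ℚ.* num 13 1000)) ℚP.≤? num 156 10))
        (subN Q (mul Q nX⁵ (mul Q nG⁴ nZ)) (add Q (mul Q (rat Q (num 160 1)) (N-fourth nS)) (mul Q (rat Q (num 80 1)) (mul Q (N-fourth nS) (N-fourth nS)))))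
      pw : Carrier → Carrier
      pw ω = S + ω * (S * S) + (ω * ω) * (S * (S * S)) + (ω * (ω * ω)) * fourth S
      i²≈ : 𝕚 * 𝕚 ≈ ι (ℚ.- 1ℚ)
      i²≈ = trans 𝕚²≈-1 (sym (trans (ι-neg 1ℚ) (-‿cong ι-1)))
      1-fourth : fourth 1# ≈ 1#
      1-fourth = trans (*-cong (*-identityˡ _) (*-identityˡ _)) (*-identityˡ _)
      -1-fourth : fourth (- 1#) ≈ 1#
      -1-fourth = trans (solve 1 (λ x → (:- x :* :- x) :* (:- x :* :- x) := (x :* x) :* (x :* x)) refl 1#) 1-fourth
      𝕚-fourth : fourth 𝕚 ≈ 1#
      𝕚-fourth = trans (*-cong 𝕚²≈-1 𝕚²≈-1) (trans (solve 1 (λ x → :- x :* :- x := x :* x) refl 1#) (*-identityˡ _))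
      -𝕚-fourth : fourth (- 𝕚) ≈ 1#
      -𝕚-fourth = trans (solve 1 (λ x → (:- x :* :- x) :* (:- x :* :- x) := (x :* x) :* (x :* x)) refl 𝕚) 𝕚-fourth
      p₀ : pw 1# ≈ (S + S * (S * S)) + (S * S + fourth S)
      p₀ = begin
        pw 1#    ≈⟨ +-cong (+-cong (+-congˡ (*-identityˡ _)) (trans (*-congʳ (*-identityˡ _)) (*-identityˡ _))) (trans (*-congʳ (trans (*-identityˡ _) (*-identityˡ _))) (*-identityˡ _)) ⟩
        S + S * S + S * (S * S) + fourth S ≈⟨ solve 4 (λ a b c d → a :+ b :+ c :+ d := (a :+ c) :+ (b :+ d)) refl S (S * S) (S * (S * S)) (fourth S) ⟩
        (S + S * (S * S)) + (S * S + fourth S) ∎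
      p₂ : pw (- 1#) ≈ (S + S * (S * S)) - (S * S + fourth S)
      p₂ = begin
        pw (- 1#)  ≈⟨ solve 4 (λ S w f a → S :+ (:- w) :* (S :* S) :+ ((:- w) :* (:- w)) :* a :+ ((:- w) :* ((:- w) :* (:- w))) :* f
                          := S :- w :* (S :* S) :+ (w :* w) :* a :- (w :* (w :* w)) :* f) refl S 1# (fourth S) (S * (S * S)) ⟩
        S - 1# * (S * S) + (1# * 1#) * (S * (S * S)) - (1# * (1# * 1#)) * fourth S
                   ≈⟨ +-cong (+-cong (+-congˡ (-‿cong (*-identityˡ _))) (trans (*-congʳ (*-identityˡ _)) (*-identityˡ _))) (-‿cong (trans (*-congʳ (trans (*-identityˡ _) (*-identityˡ _))) (*-identityˡ _))) ⟩
        S - S * S + S * (S * S) - fourth S ≈⟨ solve 4 (λ a b c d → a :- b :+ c :- d := (a :+ c) :- (b :+ d)) refl S (S * S) (S * (S * S)) (fourth S) ⟩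
        (S + S * (S * S)) - (S * S + fourth S) ∎
      reduce : ∀ ω → ω * ω ≈ ι (ℚ.- 1ℚ) → pw ω ≈ (S - S * (S * S)) + ω * (S * S - fourth S)
      reduce ω e = begin
        pw ω     ≈⟨ +-cong (+-congˡ (*-congʳ e)) (*-congʳ (*-congˡ e)) ⟩
        S + ω * (S * S) + ι (ℚ.- 1ℚ) * (S * (S * S)) + (ω * ι (ℚ.- 1ℚ)) * fourth S
                 ≈⟨ solve 5 (λ w a b c d → a :+ w :* b :+ con (ℚ.- 1ℚ) :* c :+ (w :* con (ℚ.- 1ℚ)) :* d := (a :- c) :+ w :* (b :- d)) refl ω S (S * S) (S * (S * S)) (fourth S) ⟩
        (S - S * (S * S)) + ω * (S * S - fourth S) ∎
      p₁ : pw 𝕚 ≈ (S - S * (S * S)) + 𝕚 * (S * S - fourth S)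
      p₁ = reduce 𝕚 i²≈
      p₃ : pw (- 𝕚) ≈ (S - S * (S * S)) - 𝕚 * (S * S - fourth S)
      p₃ = trans (reduce (- 𝕚) (trans (solve 1 (λ x → :- x :* :- x := x :* x) refl 𝕚) i²≈)) (+-congˡ (sym (-‿distribˡ-* _ _)))
      G⁴Z : fourth G * Z ≈ ι (num 16 1) * (S * S⁴) + (ι (num 160 1) * (S * (S⁴ * S⁴)) + ι (num 80 1) * (S * (S⁴ * (S⁴ * S⁴))))
      G⁴Z = begin
        fourth G * Z   ≈⟨ solve 6 (λ G a b c d i → let f = λ x → (x :* x) :* (x :* x) in
                             f G :* ((f a :- f b) :- i :* (f c :- f d)) := (f (G :* a) :- f (G :* b)) :- i :* (f (G :* c) :- f (G :* d)))
                             refl G R₀ R₂ R₁ R₃ 𝕚 ⟩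
        (fourth (G * R₀) - fourth (G * R₂)) - 𝕚 * (fourth (G * R₁) - fourth (G * R₃))
          ≈⟨ resolvent-identity (trans (resolvent XS≈1 1-fourth i₀) p₀) (trans (resolvent XS≈1 -1-fourth i₂) p₂)
                                (trans (resolvent XS≈1 𝕚-fourth i₁) p₁) (trans (resolvent XS≈1 -𝕚-fourth i₃) p₃) ⟩
        ι (num 16 1) * (S * S⁴) + (ι (num 160 1) * (S * (S⁴ * S⁴)) + ι (num 80 1) * (S * (S⁴ * (S⁴ * S⁴)))) ∎
      XS⁵≈1 : X⁵ * (S * S⁴) ≈ 1#
      XS⁵≈1 = trans (solve 2 (λ X S → (X :* ((X :* X) :* (X :* X))) :* (S :* ((S :* S) :* (S :* S))) := (X :* S) :* (((X :* S) :* (X :* S)) :* ((X :* S) :* (X :* S)))) refl X S)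
                (trans (*-cong XS≈1 (fourth-cong XS≈1)) (trans (*-identityˡ _) 1-fourth))
      identity : ι (num 16 1) ≈ X⁵ * (fourth G * Z) - (ι (num 160 1) * S⁴ + ι (num 80 1) * (S⁴ * S⁴))
      identity = sym (begin
        X⁵ * (fourth G * Z) - (ι (num 160 1) * S⁴ + ι (num 80 1) * (S⁴ * S⁴))
          ≈⟨ +-congʳ (*-congˡ G⁴Z) ⟩
        X⁵ * (ι (num 16 1) * (S * S⁴) + (ι (num 160 1) * (S * (S⁴ * S⁴)) + ι (num 80 1) * (S * (S⁴ * (S⁴ * S⁴))))) - (ι (num 160 1) * S⁴ + ι (num 80 1) * (S⁴ * S⁴))
          ≈⟨ solve 3 (λ x s f → x :* (con (num 16 1) :* (s :* f) :+ (con (num 160 1) :* (s :* (f :* f)) :+ con (num 80 1) :* (s :* (f :* (f :* f))))) :- (con (num 160 1) :* f :+ con (num 80 1) :* (f :* f))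
               := (x :* (s :* f)) :* (con (num 16 1) :+ (con (num 160 1) :* f :+ con (num 80 1) :* (f :* f))) :- (con (num 160 1) :* f :+ con (num 80 1) :* (f :* f))) refl X⁵ S S⁴ ⟩
        (X⁵ * (S * S⁴)) * (ι (num 16 1) + (ι (num 160 1) * S⁴ + ι (num 80 1) * (S⁴ * S⁴))) - (ι (num 160 1) * S⁴ + ι (num 80 1) * (S⁴ * S⁴))
          ≈⟨ +-congʳ (trans (*-congʳ XS⁵≈1) (*-identityˡ _)) ⟩
        (ι (num 16 1) + (ι (num 160 1) * S⁴ + ι (num 80 1) * (S⁴ * S⁴))) - (ι (num 160 1) * S⁴ + ι (num 80 1) * (S⁴ * S⁴))
          ≈⟨ trans (+-assoc _ _ _) (trans (+-congˡ (-‿inverseʳ _)) (+-identityʳ _)) ⟩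
        ι (num 16 1) ∎)

-- Approximation of bounded elements by Gaussian rationals.

module GaussianApproximation (K : ACF₀) where
  open ACF₀ K
  open RationalEmbedding K
  open RationalLemmas
  open Norms K
  open Approximation K
  open GelfandMazur K
  open PreNorm
  open import Data.Nat.Base as ℕ using (ℕ; zero; suc)
  import Data.Nat.Properties as ℕP
  open import Data.Integer.Base using (+_)
  open import Data.Rational.Base as ℚ using (ℚ; 0ℚ; 1ℚ; _/_)
  import Data.Rational.Properties as ℚP
  open import Data.Rational.Solver using () renaming (module +-*-Solver to ℚSolver)
  open import Data.Product using (∃-syntax; _,_)
  open import Data.Sum using (inj₁; inj₂)
  open import Data.Empty using (⊥)
  open import Relation.Nullary using (¬_)
  open import Relation.Nullary.Decidable using (from-yes)
  open import Relation.Binary.PropositionalEquality as ≡ using (_≡_)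
  open import Relation.Binary.Reasoning.Setoid setoid

  origin : ℚ[i]
  origin = 0ℚ , 0ℚ

  embed-origin : embed origin ≈ 0#
  embed-origin = trans (+-cong ι-0 (trans (*-congˡ ι-0) (zeroʳ 𝕚))) (+-identityʳ _)

  _⊕_ : ℚ[i] → ℚ[i] → ℚ[i]
  (p , q) ⊕ (r , s) = p ℚ.+ r , q ℚ.+ s

  _⊙_ : ℚ → ℚ[i] → ℚ[i]
  c ⊙ (p , q) = c ℚ.* p , c ℚ.* q

  _⊗_ : ℚ[i] → ℚ[i] → ℚ[i]
  (p , q) ⊗ (r , s) = p ℚ.* r ℚ.- q ℚ.* s , p ℚ.* s ℚ.+ q ℚ.* r

  embed-⊕ : ∀ z w → embed (z ⊕ w) ≈ embed z + embed w
  embed-⊕ (p , q) (r , s) = trans (+-cong (ι-+ p r) (*-congˡ (ι-+ q s)))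
    (solve 5 (λ p q r s i → (p :+ r) :+ i :* (q :+ s) := (p :+ i :* q) :+ (r :+ i :* s)) refl (ι p) (ι q) (ι r) (ι s) 𝕚)
    where open KSolver

  embed-⊙ : ∀ c z → embed (c ⊙ z) ≈ ι c * embed z
  embed-⊙ c (p , q) = trans (+-cong (ι-* c p) (*-congˡ (ι-* c q)))
    (solve 4 (λ c p q i → c :* p :+ i :* (c :* q) := c :* (p :+ i :* q)) refl (ι c) (ι p) (ι q) 𝕚)
    where open KSolver

  embed-⊗ : ∀ z w → embed (z ⊗ w) ≈ embed z * embed w
  embed-⊗ (p , q) (r , s) = begin
    ι (p ℚ.* r ℚ.- q ℚ.* s) + 𝕚 * ι (p ℚ.* s ℚ.+ q ℚ.* r)
      ≈⟨ +-cong (trans (ι-+ (p ℚ.* r) _) (+-cong (ι-* p r) (trans (ι-neg (q ℚ.* s)) (-‿cong (ι-* q s))))) (*-congˡ (trans (ι-+ (p ℚ.* s) _) (+-cong (ι-* p s) (ι-* q r)))) ⟩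
    (ι p * ι r - ι q * ι s) + 𝕚 * (ι p * ι s + ι q * ι r)
      ≈⟨ +-congʳ (+-congˡ (sym (trans (*-congʳ 𝕚²≈-1) (-1*x≈-x _)))) ⟩
    (ι p * ι r + (𝕚 * 𝕚) * (ι q * ι s)) + 𝕚 * (ι p * ι s + ι q * ι r)
      ≈⟨ solve 5 (λ p q r s i → (p :* r :+ (i :* i) :* (q :* s)) :+ i :* (p :* s :+ q :* r) := (p :+ i :* q) :* (r :+ i :* s)) refl (ι p) (ι q) (ι r) (ι s) 𝕚 ⟩
    (ι p + 𝕚 * ι q) * (ι r + 𝕚 * ι s) ∎
    where
    open KSolver
    open import Algebra.Properties.Ring ring using (-1*x≈-x)

  ApproximatedBy : Carrier → ℚ → PreNorm → Set
  ApproximatedBy x ε Q = ∃[ z ] N Q (x - embed z) ε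

  module _ {x : Carrier} where

    -- Multiplication by 3 turns the centres 0 and iᵏ/3 into 0 and the fourth roots of unity, and
    -- the bound κ on the inverses into κ/3. These are the hypotheses of `resolvent-bound`, which
    -- excludes that x is far from all five centres.
    directions : ∀ P → Proper P → N P 𝕚 1ℚ → N P x 1ℚ →
                 Inverse≤κ (x - embed origin) P → Inverse≤κ (x - embed (⅓ , 0ℚ)) P → Inverse≤κ (x - embed (0ℚ , ⅓)) P →
                 Inverse≤κ (x - embed (ℚ.- ⅓ , 0ℚ)) P → Inverse≤κ (x - embed (0ℚ , ℚ.- ⅓)) P → ⊥
    directions P proper n𝕚 nx (s , es , ns) (r₀ , e₀ , n₀) (r₁ , e₁ , n₁) (r₂ , e₂ , n₂) (r₃ , e₃ , n₃) =
      resolvent-bound P n𝕚 proper (mul P (rat P three) nx)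
        (trans (*-congʳ (sym (trans (+-congˡ -0#≈0#) (+-identityʳ _)))) (scaled origin es (trans (*-congˡ embed-origin) (zeroʳ _)))) (small ns)
        (scaled (⅓ , 0ℚ) e₀ (trans (*-congˡ (trans (+-congˡ (trans (*-congˡ ι-0) (zeroʳ 𝕚))) (+-identityʳ _))) 3·⅓))
        (scaled (0ℚ , ⅓) e₁ (trans (*-congˡ (trans (+-congʳ ι-0) (+-identityˡ _))) (trans (swap _ _ _) (trans (*-congˡ 3·⅓) (*-identityʳ 𝕚)))))
        (scaled (ℚ.- ⅓ , 0ℚ) e₂ (trans (*-congˡ (trans (+-congˡ (trans (*-congˡ ι-0) (zeroʳ 𝕚))) (+-identityʳ _))) 3·-⅓))
        (scaled (0ℚ , ℚ.- ⅓) e₃ (trans (*-congˡ (trans (+-congʳ ι-0) (+-identityˡ _))) (trans (swap _ _ _) (trans (*-congˡ 3·-⅓) (trans (*-comm _ _) (-1*x≈-x 𝕚))))))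
        (small n₀) (small n₁) (small n₂) (small n₃)
      where
      open KSolver
      open import Algebra.Properties.Ring ring using (-1*x≈-x; -0#≈0#)
      three = + 3 / 1
      3·⅓ : ι three * ι ⅓ ≈ 1#
      3·⅓ = trans (sym (ι-* three ⅓)) ι-1
      3·-⅓ : ι three * ι (ℚ.- ⅓) ≈ - 1#
      3·-⅓ = trans (sym (ι-* three (ℚ.- ⅓))) (trans (ι-neg 1ℚ) (-‿cong ι-1))
      swap : ∀ a b c → a * (b * c) ≈ b * (a * c)
      swap = solve 3 (λ a b c → a :* (b :* c) := b :* (a :* c)) refl
      small : ∀ {r} → N P r κ → N P (r * ι ⅓) (κ ℚ.* ⅓)
      small n = mul P n (rat P ⅓)
      scaled : ∀ z {r ω} → (x - embed z) * r ≈ 1# → ι three * embed z ≈ ω → (ι three * x - ω) * (r * ι ⅓) ≈ 1#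
      scaled z {r} {ω} e eω = begin
        (ι three * x - ω) * (r * ι ⅓)                  ≈⟨ *-congʳ (+-congˡ (-‿cong eω)) ⟨
        (ι three * x - ι three * embed z) * (r * ι ⅓)  ≈⟨ solve 5 (λ t x z r s → (t :* x :- t :* z) :* (r :* s) := ((x :- z) :* r) :* (t :* s)) refl (ι three) x (embed z) r (ι ⅓) ⟩
        ((x - embed z) * r) * (ι three * ι ⅓)          ≈⟨ *-cong e 3·⅓ ⟩
        1# * 1#                                        ≈⟨ *-identityˡ _ ⟩
        1# ∎

    -- Every point of the unit disc lies within θ of 0 or of one of the points iᵏ/3.
    coarse-approximation : ∀ P → Proper P → N P 𝕚 1ℚ → N P x 1ℚ → ¬ ¬ Extension P (ApproximatedBy x θ)
    coarse-approximation P proper n𝕚 nx k =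
      try P ⊑-refl proper origin λ { (P₀ , u₀ , h₀ , v₀) →
      try P₀ u₀ h₀ (⅓ , 0ℚ) λ { (P₁ , u₁ , h₁ , v₁) →
      try P₁ (⊑-trans u₀ u₁) h₁ (0ℚ , ⅓) λ { (P₂ , u₂ , h₂ , v₂) →
      try P₂ (⊑-trans u₀ (⊑-trans u₁ u₂)) h₂ (ℚ.- ⅓ , 0ℚ) λ { (P₃ , u₃ , h₃ , v₃) →
      try P₃ (⊑-trans u₀ (⊑-trans u₁ (⊑-trans u₂ u₃))) h₃ (0ℚ , ℚ.- ⅓) λ { (P₄ , u₄ , h₄ , v₄) →
        let u = ⊑-trans u₀ (⊑-trans u₁ (⊑-trans u₂ (⊑-trans u₃ u₄))) in
        directions P₄ h₄ (lift u n𝕚) (lift u nx) (Inverse≤κ-mono (⊑-trans u₁ (⊑-trans u₂ (⊑-trans u₃ u₄))) v₀)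
          (Inverse≤κ-mono (⊑-trans u₂ (⊑-trans u₃ u₄)) v₁) (Inverse≤κ-mono (⊑-trans u₃ u₄) v₂) (Inverse≤κ-mono u₄ v₃) v₄ } } } } }
      where
      try : ∀ Q → P ⊑ Q → Proper Q → ∀ z → ¬ ¬ Extension Q (Inverse≤κ (x - embed z))
      try Q P⊑Q h z k′ = dichotomy Q h (x - embed z) λ
        { (R , Q⊑R , R-proper , inj₁ n) → k (R , ⊑-trans P⊑Q Q⊑R , R-proper , z , n)
        ; (R , Q⊑R , R-proper , inj₂ v) → k′ (R , Q⊑R , R-proper , v) }

  θ^κ^ : ∀ n → (θ ^ℚ n) ℚ.* (κ ^ℚ n) ≡ 1ℚ
  θ^κ^ zero = ≡.refl
  θ^κ^ (suc n) = ≡.trans (lem θ (θ ^ℚ n) κ (κ ^ℚ n)) (≡.cong₂ ℚ._*_ {x = θ ℚ.* κ} ≡.refl (θ^κ^ n))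
    where
    open ℚSolver
    lem : ∀ a b c d → (a ℚ.* b) ℚ.* (c ℚ.* d) ≡ (a ℚ.* c) ℚ.* (b ℚ.* d)
    lem = solve 4 (λ a b c d → (a :* b) :* (c :* d) := (a :* c) :* (b :* d)) ≡.refl

  -- The remainder after n steps has norm at most θⁿ. Multiplied by κⁿ it lies in the unit disc
  -- again, so another coarse approximation gains a further factor θ.
  approximation^ : ∀ n {x} P → Proper P → N P 𝕚 1ℚ → N P x 1ℚ → ¬ ¬ Extension P (ApproximatedBy x (θ ^ℚ n))
  approximation^ zero P proper n𝕚 nx k = k (P , ⊑-refl , proper , origin ,
    resp P (sym (trans (+-congˡ (trans (-‿cong embed-origin) -0#≈0#)) (+-identityʳ _))) nx)
    where open import Algebra.Properties.Ring ring using (-0#≈0#)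
  approximation^ (suc n) {x} P proper n𝕚 nx k =
    approximation^ n P proper n𝕚 nx λ { (Q , P⊑Q , Q-proper , z , m) →
      coarse-approximation {x = ι c * (x - embed z)} Q Q-proper (lift P⊑Q n𝕚) (rescaled Q m) λ { (R , Q⊑R , R-proper , w , m′) →
        k (R , ⊑-trans P⊑Q Q⊑R , R-proper , z ⊕ (t ⊙ w) , resp R (correction z w) (≡.subst (N R _) (ℚP.*-comm t θ) (mul R (N-ι R 0≤t) m′))) } }
    where
    t = θ ^ℚ n
    c = κ ^ℚ n
    0≤t : 0ℚ ℚ.≤ t
    0≤t = ^-nonNeg n (ℚP.<⇒≤ 0<θ)
    rescaled : ∀ Q {y} → N Q y t → N Q (ι c * y) 1ℚ
    rescaled Q m = ≡.subst (N Q _) (≡.trans (ℚP.*-comm c t) (θ^κ^ n)) (mul Q (N-ι Q (^-nonNeg n 0≤κ)) m)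
    open KSolver
    correction : ∀ z w → ι t * (ι c * (x - embed z) - embed w) ≈ x - embed (z ⊕ (t ⊙ w))
    correction z w = begin
      ι t * (ι c * (x - embed z) - embed w)              ≈⟨ solve 5 (λ t c x z w → t :* (c :* (x :- z) :- w) := (t :* c) :* (x :- z) :- t :* w) refl (ι t) (ι c) x (embed z) (embed w) ⟩
      (ι t * ι c) * (x - embed z) - ι t * embed w        ≈⟨ +-congʳ (trans (*-congʳ (trans (sym (ι-* t c)) (trans (ι-cong (θ^κ^ n)) ι-1))) (*-identityˡ _)) ⟩
      (x - embed z) - ι t * embed w                      ≈⟨ solve 3 (λ x z w → (x :- z) :- w := x :- (z :+ w)) refl x (embed z) (ι t * embed w) ⟩
      x - (embed z + ι t * embed w)                      ≈⟨ +-congˡ (-‿cong (trans (embed-⊕ z (t ⊙ w)) (+-congˡ (embed-⊙ t w)))) ⟨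
      x - embed (z ⊕ (t ⊙ w)) ∎

  module _ {x : Carrier} {b ε : ℚ} (0<ε : 0ℚ ℚ.< ε) where

    approximation : ∀ P → Proper P → N P 𝕚 1ℚ → N P x b → ¬ ¬ Extension P (ApproximatedBy x ε)
    approximation P proper n𝕚 nx = bounded (unbounded b)
      where
      bounded : ∃[ n ] b ℚ.≤ fromℕ n → ¬ ¬ Extension P (ApproximatedBy x ε)
      bounded (n , b≤n) = refine (^-vanishes (ℚP.<⇒≤ 0<θ) (from-yes (θ ℚP.<? 1ℚ)) (ε ℚ.* s) (*-pos 0<ε 0<s))
        where
        -- The successor keeps the scaling factor invertible even when the bound on x is 0.
        c = fromℕ (suc n)
        0<c : 0ℚ ℚ.< c
        0<c = fromℕ-mono-< {0} {suc n} (ℕ.s≤s ℕ.z≤n)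
        instance
          c+ : ℚ.Positive c
          c+ = ℚ.positive 0<c
          c≢0 : ℚ.NonZero c
          c≢0 = ℚP.pos⇒nonZero c
        s = ℚ.1/ c
        0<s : 0ℚ ℚ.< s
        0<s = ℚP.positive⁻¹ s {{ℚP.1/pos⇒pos c}}
        sc≡1 : s ℚ.* c ≡ 1ℚ
        sc≡1 = ℚP.*-inverseˡ c
        cs≡1 : c ℚ.* s ≡ 1ℚ
        cs≡1 = ℚP.*-inverseʳ c
        unit-norm : N P (ι s * x) 1ℚ
        unit-norm = weaken P (≡.subst (s ℚ.* b ℚ.≤_) sc≡1 (*-monoˡ (ℚP.<⇒≤ 0<s) (ℚP.≤-trans b≤n (fromℕ-mono-≤ (ℕP.n≤1+n n)))))
                      (mul P (N-ι P (ℚP.<⇒≤ 0<s)) nx)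
        open KSolver
        back : ∀ z → ι c * (ι s * x - embed z) ≈ x - embed (c ⊙ z)
        back z = trans (solve 4 (λ c s x z → c :* (s :* x :- z) := (c :* s) :* x :- c :* z) refl (ι c) (ι s) x (embed z))
          (+-cong (trans (*-congʳ (trans (sym (ι-* c s)) (trans (ι-cong cs≡1) ι-1))) (*-identityˡ x)) (-‿cong (sym (embed-⊙ c z))))
        cεs : c ℚ.* (ε ℚ.* s) ≡ ε
        cεs = ≡.trans (ℚSolver.solve 3 (λ c e s → c ℚSolver.:* (e ℚSolver.:* s) ℚSolver.:= e ℚSolver.:* (c ℚSolver.:* s)) ≡.refl c ε s)
                (≡.trans (≡.cong (ε ℚ.*_) cs≡1) (ℚP.*-identityʳ ε))
        refine : ∃[ l ] (θ ^ℚ l) ℚ.≤ ε ℚ.* s → ¬ ¬ Extension P (ApproximatedBy x ε)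
        refine (l , h) k = approximation^ l P proper n𝕚 unit-norm λ { (Q , P⊑Q , Q-proper , z , m) →
          k (Q , P⊑Q , Q-proper , c ⊙ z , resp Q (back z)
            (≡.subst (N Q _) cεs (mul Q (N-ι Q (ℚP.<⇒≤ 0<c)) (weaken Q h m)))) }

-- Sums of rationals.

module RationalSums where
  open RationalLemmas
  open import Data.Nat.Base using (zero; suc)
  open import Data.Fin.Base using (Fin; zero; suc)
  open import Data.Rational.Base
  open import Data.Rational.Properties
  open import Algebra.Bundles using (CommutativeRing)
  open import Relation.Binary.PropositionalEquality using (_≡_; refl; sym; trans; cong; cong₂)
  open import Algebra.Properties.Semiring.Sum (CommutativeRing.semiring +-*-commutativeRing) public
    using (sum; ∑-distrib-+; ∑-comm; *-distribˡ-sum; *-distribʳ-sum) renaming (sum-cong-≋ to sum-cong)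

  sum-mono : ∀ {n} {f g : Fin n → ℚ} → (∀ i → f i ≤ g i) → sum f ≤ sum g
  sum-mono {zero} h = ≤-refl
  sum-mono {suc n} h = +-mono-≤ (h zero) (sum-mono (λ i → h (suc i)))

  sum-nonNeg : ∀ {n} {f : Fin n → ℚ} → (∀ i → 0ℚ ≤ f i) → 0ℚ ≤ sum f
  sum-nonNeg {zero} h = ≤-refl
  sum-nonNeg {suc n} h = +-nonNeg (h zero) (sum-nonNeg (λ i → h (suc i)))

  sum-zero : ∀ {n} {f : Fin n → ℚ} → (∀ i → f i ≡ 0ℚ) → sum f ≡ 0ℚ
  sum-zero {zero} h = refl
  sum-zero {suc n} h = trans (cong₂ _+_ (h zero) (sum-zero (λ i → h (suc i)))) (+-identityˡ 0ℚ)

  sum-const : ∀ n c → sum {n} (λ _ → c) ≡ fromℕ n * c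
  sum-const zero c = sym (*-zeroˡ c)
  sum-const (suc n) c = trans (cong₂ _+_ (sym (*-identityˡ c)) (sum-const n c))
    (trans (sym (*-distribʳ-+ c 1ℚ (fromℕ n))) (cong (_* c) (sym (fromℕ-+ 1 n))))

open import Data.Rational.Base using (ℚ)

-- Bessel's inequality and a comparison of traces.

module Bessel
  {V : Set} (0ᵥ : V) (_+ᵥ_ : V → V → V) (_·ᵥ_ : ℚ → V → V) (⟨_,_⟩ : V → V → ℚ)
  where
  open RationalLemmas
  open RationalSums
  open import Data.Nat.Base using (ℕ; zero; suc)
  open import Data.Fin.Base using (Fin; zero; suc)
  open import Data.Rational.Base
  open import Data.Rational.Properties
  open import Data.Rational.Solver using (module +-*-Solver)
  open import Data.Product using (_,_)
  open import Relation.Binary.PropositionalEquality using (_≡_; refl; sym; trans; cong; cong₂; subst; subst₂; module ≡-Reasoning)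

  comb : ∀ {p} → (Fin p → ℚ) → (Fin p → V) → V
  comb {zero} α u = 0ᵥ
  comb {suc p} α u = (α zero ·ᵥ u zero) +ᵥ comb (λ q → α (suc q)) (λ q → u (suc q))

  module _
    (comm : ∀ u v → ⟨ u , v ⟩ ≡ ⟨ v , u ⟩) (nonNegative-form : ∀ u → 0ℚ ≤ ⟨ u , u ⟩)
    (zero-left : ∀ v → ⟨ 0ᵥ , v ⟩ ≡ 0ℚ) (add-left : ∀ u w v → ⟨ u +ᵥ w , v ⟩ ≡ ⟨ u , v ⟩ + ⟨ w , v ⟩)
    (scale-left : ∀ c u v → ⟨ c ·ᵥ u , v ⟩ ≡ c * ⟨ u , v ⟩)
    where

    comb-left : ∀ {p} (α : Fin p → ℚ) u v → ⟨ comb α u , v ⟩ ≡ sum (λ q → α q * ⟨ u q , v ⟩)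
    comb-left {zero} α u v = zero-left v
    comb-left {suc p} α u v = trans (add-left _ _ v) (cong₂ _+_ (scale-left _ _ v) (comb-left (λ q → α (suc q)) (λ q → u (suc q)) v))

    module Step {p : ℕ} (u : Fin (suc p) → V) {r : ℚ} (r-inverse : r * ⟨ u zero , u zero ⟩ ≡ 1ℚ) where
      open ≡-Reasoning
      open +-*-Solver

      u₀ = u zero

      orthogonalize : V → V
      orthogonalize w = w +ᵥ ((- (⟨ w , u₀ ⟩ * r)) ·ᵥ u₀)

      orth-left : ∀ w v → ⟨ orthogonalize w , v ⟩ ≡ ⟨ w , v ⟩ - ⟨ w , u₀ ⟩ * r * ⟨ u₀ , v ⟩
      orth-left w v = trans (add-left _ _ v) (cong (⟨ w , v ⟩ +_) (trans (scale-left _ u₀ v) (sym (neg-distribˡ-* (⟨ w , u₀ ⟩ * r) ⟨ u₀ , v ⟩))))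

      orth-orthogonal : ∀ w → ⟨ orthogonalize w , u₀ ⟩ ≡ 0ℚ
      orth-orthogonal w = begin
        ⟨ orthogonalize w , u₀ ⟩                            ≡⟨ orth-left w u₀ ⟩
        ⟨ w , u₀ ⟩ - ⟨ w , u₀ ⟩ * r * ⟨ u₀ , u₀ ⟩           ≡⟨ cong (λ t → ⟨ w , u₀ ⟩ - t) (trans (*-assoc ⟨ w , u₀ ⟩ r _) (trans (cong (⟨ w , u₀ ⟩ *_) r-inverse) (*-identityʳ _))) ⟩
        ⟨ w , u₀ ⟩ - ⟨ w , u₀ ⟩                             ≡⟨ +-inverseʳ ⟨ w , u₀ ⟩ ⟩
        0ℚ ∎

      orth-norm : ∀ w → ⟨ orthogonalize w , orthogonalize w ⟩ ≡ ⟨ w , w ⟩ - r * (⟨ w , u₀ ⟩ * ⟨ w , u₀ ⟩)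
      orth-norm w = begin
        ⟨ orthogonalize w , orthogonalize w ⟩   ≡⟨ orth-left w (orthogonalize w) ⟩
        ⟨ w , orthogonalize w ⟩ - ⟨ w , u₀ ⟩ * r * ⟨ u₀ , orthogonalize w ⟩
          ≡⟨ cong₂ (λ a b → a - ⟨ w , u₀ ⟩ * r * b) (trans (comm w _) (orth-left w w)) (trans (comm u₀ _) (orth-orthogonal w)) ⟩
        (⟨ w , w ⟩ - ⟨ w , u₀ ⟩ * r * ⟨ u₀ , w ⟩) - ⟨ w , u₀ ⟩ * r * 0ℚ
          ≡⟨ cong (λ a → (⟨ w , w ⟩ - ⟨ w , u₀ ⟩ * r * a) - ⟨ w , u₀ ⟩ * r * 0ℚ) (comm u₀ w) ⟩
        (⟨ w , w ⟩ - ⟨ w , u₀ ⟩ * r * ⟨ w , u₀ ⟩) - ⟨ w , u₀ ⟩ * r * 0ℚ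
          ≡⟨ solve 3 (λ n g r → (n :- g :* r :* g) :- g :* r :* con 0ℚ := n :- r :* (g :* g)) refl ⟨ w , w ⟩ ⟨ w , u₀ ⟩ r ⟩
        ⟨ w , w ⟩ - r * (⟨ w , u₀ ⟩ * ⟨ w , u₀ ⟩) ∎

      u′ : Fin p → V
      u′ q = orthogonalize (u (suc q))

      -- Rewrites a combination of the projected vectors in terms of the original ones; the
      -- coefficient at u₀ absorbs all the projections. In this way both hypotheses on u pass to the
      -- complement of u₀.
      extend : (Fin p → ℚ) → Fin (suc p) → ℚ
      extend α zero = - (sum (λ q → α q * ⟨ u (suc q) , u₀ ⟩) * r)
      extend α (suc q) = α q

      comb-extend : ∀ α v → ⟨ comb α u′ , v ⟩ ≡ ⟨ comb (extend α) u , v ⟩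
      comb-extend α v = begin
        ⟨ comb α u′ , v ⟩    ≡⟨ comb-left α u′ v ⟩
        sum (λ q → α q * ⟨ u′ q , v ⟩)
          ≡⟨ sum-cong (λ q → trans (cong (α q *_) (orth-left (u (suc q)) v))
               (lem (α q) ⟨ u (suc q) , v ⟩ ⟨ u (suc q) , u₀ ⟩ r ⟨ u₀ , v ⟩)) ⟩
        sum (λ q → (α q * ⟨ u (suc q) , u₀ ⟩) * (- (r * ⟨ u₀ , v ⟩)) + α q * ⟨ u (suc q) , v ⟩)
          ≡⟨ ∑-distrib-+ (λ q → (α q * ⟨ u (suc q) , u₀ ⟩) * (- (r * ⟨ u₀ , v ⟩))) _ ⟩
        sum (λ q → (α q * ⟨ u (suc q) , u₀ ⟩) * (- (r * ⟨ u₀ , v ⟩))) + sum (λ q → α q * ⟨ u (suc q) , v ⟩)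
          ≡⟨ cong (_+ sum (λ q → α q * ⟨ u (suc q) , v ⟩)) (sym (*-distribʳ-sum (- (r * ⟨ u₀ , v ⟩)) (λ q → α q * ⟨ u (suc q) , u₀ ⟩))) ⟩
        sum (λ q → α q * ⟨ u (suc q) , u₀ ⟩) * (- (r * ⟨ u₀ , v ⟩)) + sum (λ q → α q * ⟨ u (suc q) , v ⟩)
          ≡⟨ cong (_+ sum (λ q → α q * ⟨ u (suc q) , v ⟩)) (solve 3 (λ s r n → s :* (:- (r :* n)) := (:- (s :* r)) :* n) refl (sum (λ q → α q * ⟨ u (suc q) , u₀ ⟩)) r ⟨ u₀ , v ⟩) ⟩
        extend α zero * ⟨ u₀ , v ⟩ + sum (λ q → α q * ⟨ u (suc q) , v ⟩)
          ≡⟨ comb-left (extend α) u v ⟨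
        ⟨ comb (extend α) u , v ⟩ ∎
        where
        lem : ∀ a n g r h → a * (n - g * r * h) ≡ (a * g) * (- (r * h)) + a * n
        lem = solve 5 (λ a n g r h → a :* (n :- g :* r :* h) := (a :* g) :* (:- (r :* h)) :+ a :* n) refl

      comb-extend₂ : ∀ α → ⟨ comb α u′ , comb α u′ ⟩ ≡ ⟨ comb (extend α) u , comb (extend α) u ⟩
      comb-extend₂ α = trans (comb-extend α _) (trans (comm _ _) (comb-extend α _))

      comb-orthogonal : ∀ α → ⟨ comb α u′ , u₀ ⟩ ≡ 0ℚ
      comb-orthogonal α = trans (comb-left α u′ u₀) (sum-zero (λ q → trans (cong (α q *_) (orth-orthogonal (u (suc q)))) (*-zeroʳ (α q))))

      orth-comb : ∀ w α → ⟨ orthogonalize w , comb α u′ ⟩ ≡ ⟨ w , comb (extend α) u ⟩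
      orth-comb w α = begin
        ⟨ orthogonalize w , comb α u′ ⟩                         ≡⟨ orth-left w _ ⟩
        ⟨ w , comb α u′ ⟩ - ⟨ w , u₀ ⟩ * r * ⟨ u₀ , comb α u′ ⟩  ≡⟨ cong₂ (λ a b → a - ⟨ w , u₀ ⟩ * r * b) (trans (comm w _) (trans (comb-extend α w) (comm _ w))) (trans (comm u₀ _) (comb-orthogonal α)) ⟩
        ⟨ w , comb (extend α) u ⟩ - ⟨ w , u₀ ⟩ * r * 0ℚ         ≡⟨ solve 3 (λ a g r → a :- g :* r :* con 0ℚ := a) refl _ ⟨ w , u₀ ⟩ r ⟩
        ⟨ w , comb (extend α) u ⟩ ∎

    -- On an orthogonal basis b of the span of u, Bessel's inequality bounds Σ‖f‖² from below by the
    -- sum of ⟨f, b⟩²/‖b‖², and each b contributes at least c. Basis vectors are split off one at a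
    -- time, projecting both u and f; dividing by ‖u₀‖² instead of normalising avoids square roots.
    -- Vectors are compared only through the form, never for equality.
    dimension-bound : ∀ {p s} (u : Fin p → V) (f : Fin s → V) {c} → 0ℚ ≤ c →
      (∀ α → sum (λ q → α q * α q) ≤ ⟨ comb α u , comb α u ⟩) →
      (∀ α → c * ⟨ comb α u , comb α u ⟩ ≤ sum (λ k → ⟨ f k , comb α u ⟩ * ⟨ f k , comb α u ⟩)) →
      fromℕ p * c ≤ sum (λ k → ⟨ f k , f k ⟩)
    dimension-bound {zero} u f {c} 0≤c _ _ = subst (_≤ sum (λ k → ⟨ f k , f k ⟩)) (sym (*-zeroˡ c)) (sum-nonNeg (λ k → nonNegative-form (f k)))
    dimension-bound {suc p} u f {c} 0≤c nondegenerate seen = subst₂ _≤_ eqˡ eqʳ (+-mono-≤ r-part ih)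
      where
      u₀ = u zero
      n₀ = ⟨ u₀ , u₀ ⟩
      δ₀ : Fin (suc p) → ℚ
      δ₀ zero = 1ℚ
      δ₀ (suc _) = 0ℚ
      comb-δ₀ : ∀ v → ⟨ comb δ₀ u , v ⟩ ≡ ⟨ u₀ , v ⟩
      comb-δ₀ v = trans (comb-left δ₀ u v) (trans (cong₂ _+_ (*-identityˡ ⟨ u₀ , v ⟩) (sum-zero (λ q → *-zeroˡ ⟨ u (suc q) , v ⟩))) (+-identityʳ _))
      n₀-eq : ⟨ comb δ₀ u , comb δ₀ u ⟩ ≡ n₀
      n₀-eq = trans (comb-δ₀ _) (trans (comm _ _) (comb-δ₀ u₀))
      1≤n₀ : 1ℚ ≤ n₀
      1≤n₀ = subst₂ _≤_ (trans (cong (1ℚ * 1ℚ +_) (sum-zero {p} {λ _ → 0ℚ * 0ℚ} (λ _ → refl))) refl) n₀-eq (nondegenerate δ₀)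
      0<n₀ : 0ℚ < n₀
      0<n₀ = <-≤-trans (from-yes (0ℚ <? 1ℚ)) 1≤n₀ where open import Relation.Nullary.Decidable using (from-yes)
      instance
        n₀+ : Positive n₀
        n₀+ = positive 0<n₀
        n₀≢0 : NonZero n₀
        n₀≢0 = pos⇒nonZero n₀
      r = 1/ n₀
      0≤r : 0ℚ ≤ r
      0≤r = <⇒≤ (positive⁻¹ r {{1/pos⇒pos n₀}})
      r-inverse : r * n₀ ≡ 1ℚ
      r-inverse = *-inverseˡ n₀
      open Step u {r} r-inverse hiding (u₀)
      ih : fromℕ p * c ≤ sum (λ k → ⟨ orthogonalize (f k) , orthogonalize (f k) ⟩)
      ih = dimension-bound u′ (λ k → orthogonalize (f k)) 0≤c
        -- Dropping the square of the coefficient at u₀ only lowers the left-hand side.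
        (λ α → ≤-trans (≤-by-gap (extend α zero * extend α zero) (square-nonNeg (extend α zero)) (+-comm (sum (λ q → α q * α q)) _))
                 (subst (sum (λ q → extend α q * extend α q) ≤_) (sym (comb-extend₂ α)) (nondegenerate (extend α))))
        (λ α → subst₂ _≤_ (cong (c *_) (sym (comb-extend₂ α))) (sum-cong (λ k → cong₂ _*_ (sym (orth-comb (f k) α)) (sym (orth-comb (f k) α)))) (seen (extend α)))
      G = sum (λ k → ⟨ f k , u₀ ⟩ * ⟨ f k , u₀ ⟩)
      r-part : r * (c * n₀) ≤ r * G
      r-part = *-monoˡ 0≤r (subst₂ _≤_ (cong (c *_) n₀-eq)
        (sum-cong (λ k → cong₂ _*_ (trans (comm (f k) _) (trans (comb-δ₀ (f k)) (comm u₀ (f k)))) (trans (comm (f k) _) (trans (comb-δ₀ (f k)) (comm u₀ (f k)))))) (seen δ₀))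
      open +-*-Solver
      eqˡ : r * (c * n₀) + fromℕ p * c ≡ fromℕ (suc p) * c
      eqˡ = trans (cong (_+ fromℕ p * c) (trans (solve 3 (λ r c n → r :* (c :* n) := (r :* n) :* c) refl r c n₀) (cong (_* c) r-inverse)))
              (trans (sym (*-distribʳ-+ c 1ℚ (fromℕ p))) (cong (_* c) (sym (fromℕ-+ 1 p))))
      eqʳ : r * G + sum (λ k → ⟨ orthogonalize (f k) , orthogonalize (f k) ⟩) ≡ sum (λ k → ⟨ f k , f k ⟩)
      eqʳ = trans (cong₂ _+_ (*-distribˡ-sum r (λ k → ⟨ f k , u₀ ⟩ * ⟨ f k , u₀ ⟩)) (sum-cong (λ k → orth-norm (f k))))
        (trans (sym (∑-distrib-+ (λ k → r * (⟨ f k , u₀ ⟩ * ⟨ f k , u₀ ⟩)) _)) (sum-cong (λ k → solve 2 (λ a b → a :+ (b :- a) := b) refl (r * (⟨ f k , u₀ ⟩ * ⟨ f k , u₀ ⟩)) ⟨ f k , f k ⟩)))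

-- Gaussian elimination with largest pivots.

module PivotElimination (K : ACF₀) where
  open ACF₀ K
  open Norms K
  open Approximation K
  open PreNorm
  open import Data.Nat.Base as ℕ using (ℕ; zero; suc)
  import Data.Nat.Properties as ℕP
  open import Data.Fin.Base using (Fin; zero; suc; punchIn)
  import Data.Fin.Properties as FP
  open import Data.Rational.Base using (1ℚ)
  open import Data.Product using (∃-syntax; _×_; _,_; proj₁; proj₂)
  open import Data.Empty using (⊥-elim)
  open import Data.List.Base using (List; _∷_; tabulate)
  open import Data.List.Membership.Propositional using (_∈_)
  open import Data.List.Membership.Propositional.Properties using (∈-tabulate⁺)
  open import Data.List.Relation.Unary.All as All using (All; _∷_)
  open import Relation.Nullary using (¬_; Dec; yes; no)
  open import Relation.Binary.PropositionalEquality as ≡ using (_≡_; _≢_)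
  open import Function.Base using (id)
  open import Relation.Binary.Reasoning.Setoid setoid

  ¬¬-Fin : ∀ {n} {P : Fin n → Set} → (∀ i → ¬ ¬ P i) → ¬ ¬ (∀ i → P i)
  ¬¬-Fin {zero} f k = k (λ ())
  ¬¬-Fin {suc n} f k = f zero λ p → ¬¬-Fin (λ i → f (suc i)) λ ps → k (λ { zero → p ; (suc i) → ps i })

  module _ {A : Set} (u v : A → Carrier) (uv≈1 : ∀ a → u a * v a ≈ 1#) where

    maximum-of-list : ∀ P → Proper P → ∀ {x} xs → x ∈ xs → ¬ ¬ Extension P (λ Q → ∃[ a ] (a ∈ xs × ∀ b → b ∈ xs → N Q (u b * v a) 1ℚ))
    maximum-of-list P proper (y ∷ ys) x∈ k = maximum u v uv≈1 P proper y ys λ { (Q , P⊑Q , Q-proper , a , a∈ , m) →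
      k (Q , P⊑Q , Q-proper , a , a∈ , λ b → All.lookup m) }

  maximum-Fin : ∀ {n} (u v : Fin n → Carrier) → (∀ j → u j * v j ≈ 1#) → ∀ P → Proper P → Fin n →
                ¬ ¬ Extension P (λ Q → ∃[ j ] (∀ i → N Q (u i * v j) 1ℚ))
  maximum-Fin {n} u v uv≈1 P proper j₀ k =
    maximum-of-list u v uv≈1 P proper (tabulate id) (∈-tabulate⁺ {f = id} j₀) λ { (Q , P⊑Q , Q-proper , j , _ , m) →
      k (Q , P⊑Q , Q-proper , j , λ i → m i (∈-tabulate⁺ {f = id} i)) }

  -- Only units can be compared, so zero entries are replaced by the nonzero entry at `j₀` before
  -- the maximum is taken; they satisfy the resulting bound trivially.
  largest-entry : ∀ {n} (x : Fin n → Carrier) j₀ → ¬ (x j₀ ≈ 0#) → ∀ P → Proper P →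
                  ¬ ¬ Extension P (λ Q → ∃[ j ] ∃[ y ] (x j * y ≈ 1# × ∀ i → N Q (x i * y) 1ℚ))
  largest-entry {n} x j₀ x₀≉0 P proper k = ¬¬-Fin (λ j → excluded-middle {A = x j ≈ 0#}) λ zero? →
    let ux : ∀ j → Dec (x j ≈ 0#) → ∃[ u ] ∃[ v ] (u * v ≈ 1#)
        ux = λ { j (yes _) → x j₀ , inverse (x j₀) x₀≉0 ; j (no x≉0) → x j , inverse (x j) x≉0 }
        bounded : ∀ Q y i (d : Dec (x i ≈ 0#)) → N Q (proj₁ (ux i d) * y) 1ℚ → N Q (x i * y) 1ℚ
        bounded = λ { Q y i (yes e) n → resp Q (sym (trans (*-congʳ e) (zeroˡ y))) (weaken Q 0≤1 (zeroN Q)) ; Q y i (no _) n → n }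
        witness : ∀ j (d : Dec (x j ≈ 0#)) → ∃[ j′ ] (x j′ * proj₁ (proj₂ (ux j d)) ≈ 1#)
        witness = λ { j (yes _) → j₀ , proj₂ (inverse (x j₀) x₀≉0) ; j (no x≉0) → j , proj₂ (inverse (x j) x≉0) }
    in maximum-Fin (λ j → proj₁ (ux j (zero? j))) (λ j → proj₁ (proj₂ (ux j (zero? j)))) (λ j → proj₂ (proj₂ (ux j (zero? j)))) P proper j₀
       λ { (Q , P⊑Q , Q-proper , j , m) →
         let y = proj₁ (proj₂ (ux j (zero? j)))
             j′ , e = witness j (zero? j)
         in k (Q , P⊑Q , Q-proper , j′ , y , e , λ i → bounded Q y i (zero? i) (m i)) }

  record Subspace (m : ℕ) : Set₁ where
    field
      member   : (Fin m → Carrier) → Set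
      ≈-closed : ∀ {f g} → (∀ i → f i ≈ g i) → member f → member g
      +-closed : ∀ {f g} → member f → member g → member (λ i → f i + g i)
      *-closed : ∀ c {f} → member f → member (λ i → c * f i)
  open Subspace public

  -- A reduced echelon form: functions in U that form an identity matrix at the columns
  -- `e (pivot q)`. It certifies that U restricted to the columns e has dimension at least p,
  -- without mentioning linear independence.
  record IdentityAt {m n : ℕ} (U : Subspace m) (e : Fin n → Fin m) (p : ℕ) : Set where
    field
      function    : Fin p → Fin m → Carrier
      ∈U          : ∀ q → member U (function q)
      pivot       : Fin p → Fin n
      at-own      : ∀ q → function q (e (pivot q)) ≈ 1#
      at-other    : ∀ {q q′} → q ≢ q′ → function q (e (pivot q′)) ≈ 0#
  open IdentityAt public

  Rank≥ : ∀ {m} → Subspace m → ℕ → Set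
  Rank≥ U p = IdentityAt U id p

  Bounded : ∀ {m n p} {U : Subspace m} {e : Fin n → Fin m} → PreNorm → IdentityAt U e p → Set
  Bounded {e = e} P c = ∀ q j → ∃[ b ] N P (function c q (e j)) b

  module _ {m n : ℕ} (U : Subspace m) (e : Fin n → Fin m) where

    -- `c` is already reduced at columns of e. `w` is still to be treated; its pivots may be any
    -- elements of `Fin m` and certify that it stays independent.
    record State (P : PreNorm) (p r : ℕ) : Set where
      field
        c         : IdentityAt U e p
        w         : Rank≥ U r
        c-bounded : Bounded P c
        w-vanish  : ∀ t q → function w t (e (pivot c q)) ≈ 0#
    open State

    -- Rank and nullity of the restriction to the columns e: p functions are independent there, and
    -- r vanish there.
    record Result (d : ℕ) (P : PreNorm) : Set where
      field
        p r       : ℕ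
        p+r≡d     : p ℕ.+ r ≡ d
        c         : IdentityAt U e p
        w         : Rank≥ U r
        c-bounded : Bounded P c
        w-vanish  : ∀ t j → function w t (e j) ≈ 0#

    -- Division by the largest entry bounds the new row by 1 on e, so clearing its column keeps the
    -- rows of `c` bounded. The rows of `w` may be unbounded; row t is consumed, and the others
    -- remain an identity at their pivots because row t vanishes there.
    pivot-step : ∀ {P Q p r} → P ⊑ Q → (s : State P p (suc r)) → ∀ t j y → function (w s) t (e j) * y ≈ 1# →
                 (∀ i → N Q (function (w s) t (e i) * y) 1ℚ) → State Q (suc p) r
    pivot-step {P} {Q} {p} {r} P⊑Q s t j y inv bd = record
      { c = record
        { function = c′ ; ∈U = λ { zero → new∈U ; (suc q) → sub∈U (∈U C q) _ }
        ; pivot = λ { zero → j ; (suc q) → pivot C q }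
        ; at-own = λ { zero → trans (*-comm _ _) inv ; (suc q) → sub-unchanged {function C q} (at-own C q) (new-vanish q) }
        ; at-other = λ { {zero} {zero} h → ⊥-elim (h ≡.refl) ; {zero} {suc q} h → new-vanish q
                       ; {suc q} {zero} h → sub-at-pivot (function C q)
                       ; {suc q} {suc q′} h → sub-unchanged {function C q} (at-other C (λ { ≡.refl → h ≡.refl })) (new-vanish q′) } }
      ; w = record
        { function = λ u → subtract (function W (punchIn t u)) ; ∈U = λ u → sub∈U (∈U W (punchIn t u)) _
        ; pivot = λ u → pivot W (punchIn t u)
        ; at-own = λ u → sub-unchanged {function W (punchIn t u)} (at-own W (punchIn t u)) (new-other u)
        ; at-other = λ {u} {u′} h → sub-unchanged {function W (punchIn t u)} (at-other W (λ eq → h (FP.punchIn-injective t u u′ eq))) (new-other u′) }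
      ; c-bounded = λ
        { zero i → 1ℚ , resp Q (*-comm _ _) (bd i)
        ; (suc q) i → _ , subN Q (lift P⊑Q (proj₂ (c-bounded s q i)))
                            (mul Q (lift P⊑Q (proj₂ (c-bounded s q j))) (resp Q (*-comm _ _) (bd i))) }
      ; w-vanish = λ { u zero → sub-at-pivot (function W (punchIn t u)) ; u (suc q) → sub-unchanged {function W (punchIn t u)} (w-vanish s (punchIn t u) q) (new-vanish q) }
      }
      where
      C = c s
      W = w s
      new : Fin m → Carrier
      new i = y * function W t i
      subtract : (Fin m → Carrier) → Fin m → Carrier
      subtract f i = f i - f (e j) * new i
      c′ : Fin (suc p) → Fin m → Carrier
      c′ zero = new
      c′ (suc q) = subtract (function C q)
      new∈U : member U new
      new∈U = *-closed U y (∈U W t)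
      sub∈U : ∀ {f} → member U f → ∀ x → member U (λ i → f i - x * new i)
      sub∈U f∈ x = ≈-closed U (λ i → +-congˡ (sym (-‿distribˡ-* x (new i)))) (+-closed U f∈ (*-closed U (- x) new∈U))
        where open import Algebra.Properties.Ring ring using (-‿distribˡ-*)
      new-vanish : ∀ q → new (e (pivot C q)) ≈ 0#
      new-vanish q = trans (*-congˡ (w-vanish s t q)) (zeroʳ y)
      new-other : ∀ u → new (pivot W (punchIn t u)) ≈ 0#
      new-other u = trans (*-congˡ (at-other W (λ eq → FP.punchInᵢ≢i t u (≡.sym eq)))) (zeroʳ y)
      sub-unchanged : ∀ {f i x} → f i ≈ x → new i ≈ 0# → subtract f i ≈ x
      sub-unchanged {f} {i} {x} fi≈x n≈0 = begin
        f i - f (e j) * new i   ≈⟨ +-cong fi≈x (-‿cong (trans (*-congˡ n≈0) (zeroʳ _))) ⟩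
        x - 0#                  ≈⟨ +-congˡ -0#≈0# ⟩
        x + 0#                  ≈⟨ +-identityʳ x ⟩
        x ∎
        where open import Algebra.Properties.Ring ring using (-0#≈0#)
      sub-at-pivot : ∀ f → subtract f (e j) ≈ 0#
      sub-at-pivot f = begin
        f (e j) - f (e j) * new (e j)   ≈⟨ +-congˡ (-‿cong (*-congˡ (trans (*-comm _ _) inv))) ⟩
        f (e j) - f (e j) * 1#          ≈⟨ +-congˡ (-‿cong (*-identityʳ _)) ⟩
        f (e j) - f (e j)               ≈⟨ -‿inverseʳ _ ⟩
        0# ∎

    eliminate-state : ∀ {p} r P → Proper P → State P p r → ¬ ¬ Extension P (Result (p ℕ.+ r))
    eliminate-state {p} zero P proper s k = k (P , ⊑-refl , proper , record
      { p = p ; r = 0 ; p+r≡d = ≡.refl ; c = c s ; w = w s ; c-bounded = c-bounded s ; w-vanish = λ () })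
    eliminate-state {p} (suc r) P proper s k = excluded-middle {A = ∃[ t ] ∃[ j ] ¬ (function (w s) t (e j) ≈ 0#)} λ
      { (yes (t , j , x≉0)) → largest-entry (λ i → function (w s) t (e i)) j x≉0 P proper λ { (Q , P⊑Q , Q-proper , j′ , y , inv , bd) →
          eliminate-state r Q Q-proper (pivot-step P⊑Q s t j′ y inv bd) λ { (R , Q⊑R , R-proper , result) →
            k (R , ⊑-trans P⊑Q Q⊑R , R-proper , ≡.subst (λ d → Result d R) (≡.sym (ℕP.+-suc p r)) result) } }
      ; (no none) → ¬¬-Fin {P = λ t → ∀ j → function (w s) t (e j) ≈ 0#} (λ t → ¬¬-Fin {P = λ j → function (w s) t (e j) ≈ 0#} (λ j x≉0 → none (t , j , x≉0))) λ vanish →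
          k (P , ⊑-refl , proper , record
            { p = p ; r = suc r ; p+r≡d = ≡.refl ; c = c s ; w = w s ; c-bounded = c-bounded s ; w-vanish = vanish }) }

    elimination : ∀ {d} P → Proper P → Rank≥ U d → ¬ ¬ Extension P (Result d)
    elimination {d} P proper w = eliminate-state d P proper record
      { c = record { function = λ () ; ∈U = λ () ; pivot = λ () ; at-own = λ () ; at-other = λ { {()} } }
      ; w = w ; c-bounded = λ () ; w-vanish = λ _ () }

open import Algebra.Bundles using (CommutativeMonoid)

-- Sums of natural numbers and Kronecker deltas.

module NaturalSums where
  open import Data.Nat.Base
  open import Data.Nat.Properties
  open import Data.Fin.Base using (Fin; zero; suc)
  import Data.Fin.Properties as FP
  open import Relation.Nullary using (Dec; yes; no; ¬_)
  open import Data.Empty using (⊥-elim)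
  open import Relation.Binary.PropositionalEquality using (_≡_; refl; trans; cong; cong₂)
  open import Algebra.Properties.Semiring.Sum +-*-semiring public
    using (sum; ∑-distrib-+; ∑-comm; *-distribˡ-sum; *-distribʳ-sum) renaming (sum-cong-≋ to sum-cong)

  sum-mono : ∀ {n} {f g : Fin n → ℕ} → (∀ i → f i ≤ g i) → sum f ≤ sum g
  sum-mono {zero} h = z≤n
  sum-mono {suc n} h = +-mono-≤ (h zero) (sum-mono (λ i → h (suc i)))

  sum-const : ∀ n c → sum {n} (λ _ → c) ≡ n * c
  sum-const zero c = refl
  sum-const (suc n) c = cong (c +_) (sum-const n c)

  term≤sum : ∀ {k} (f : Fin k → ℕ) i → f i ≤ sum f
  term≤sum f zero = m≤m+n _ _
  term≤sum f (suc i) = ≤-trans (term≤sum (λ i → f (suc i)) i) (m≤n+m _ (f zero))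

  indicator : ∀ {P : Set} → Dec P → ℕ
  indicator (yes _) = 1
  indicator (no _) = 0

  δ : ∀ {n} → Fin n → Fin n → ℕ
  δ i j = indicator (i FP.≟ j)

  δ-refl : ∀ {n} (i : Fin n) → δ i i ≡ 1
  δ-refl i with i FP.≟ i
  ... | yes _ = refl
  ... | no i≢i = ⊥-elim (i≢i refl)

  δ-≢ : ∀ {n} {i j : Fin n} → ¬ (i ≡ j) → δ i j ≡ 0
  δ-≢ {i = i} {j} i≢j with i FP.≟ j
  ... | yes i≡j = ⊥-elim (i≢j i≡j)
  ... | no _ = refl

  δ-suc : ∀ {n} (i j : Fin n) → δ (suc i) (suc j) ≡ δ i j
  δ-suc i j with i FP.≟ j
  ... | yes _ = refl
  ... | no _ = refl

  δ-sum : ∀ {n} (i : Fin n) (f : Fin n → ℕ) → sum (λ j → δ i j * f j) ≡ f i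
  δ-sum {suc n} zero f = trans (cong₂ _+_ (+-identityʳ (f zero)) (trans (sum-const n 0) (*-zeroʳ n))) (+-identityʳ _)
  δ-sum {suc n} (suc i) f = trans (sum-cong (λ j → cong (_* f (suc j)) (δ-suc i j))) (δ-sum i (λ j → f (suc j)))

-- Sums along an assignment in a commutative monoid.

module Aggregate {a ℓ} (M : CommutativeMonoid a ℓ) where
  open CommutativeMonoid M
  open import Data.Nat.Base using (zero; suc)
  open import Data.Fin.Base using (Fin; zero; suc)
  open import Data.Vec.Base using (Vec; _∷_; lookup; _[_]≔_)
  open import Algebra.Properties.CommutativeMonoid.Sum M using (sum; sum-cong-≋)
  open import Data.Fin.Base using (splitAt)
  open import Data.Sum.Base using (inj₁; inj₂; [_,_]′)
  open import Relation.Binary.PropositionalEquality as ≡ using (_≡_)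
  open import Relation.Binary.Reasoning.Setoid setoid

  sum-split : ∀ m {n} (f : Fin m → Carrier) (g : Fin n → Carrier) → sum (λ k → [ f , g ]′ (splitAt m k)) ≈ sum f ∙ sum g
  sum-split zero f g = sym (identityˡ (sum g))
  sum-split (suc m) f g = trans (∙-congˡ (trans (sum-cong-≋ λ k → reflexive (lem k)) (sum-split m (λ i → f (suc i)) g))) (sym (assoc _ _ _))
    where
    lem : ∀ k → [ f , g ]′ (splitAt (suc m) (suc k)) ≡ [ (λ i → f (suc i)) , g ]′ (splitAt m k)
    lem k with splitAt m k
    ... | inj₁ _ = ≡.refl
    ... | inj₂ _ = ≡.refl

  -- Used additively to count the rows that a point receives, and multiplicatively for the weight of
  -- an assignment.
  aggregate : ∀ {A : Set} {n} → (Fin n → A → Carrier) → Vec A n → Carrier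
  aggregate f σ = sum (λ r → f r (lookup σ r))

  -- A monoid has no subtraction, so each side carries the term that the other side has lost.
  aggregate-update : ∀ {A : Set} {n} (f : Fin n → A → Carrier) (σ : Vec A n) r x →
    aggregate f (σ [ r ]≔ x) ∙ f r (lookup σ r) ≈ aggregate f σ ∙ f r x
  aggregate-update f (y ∷ σ) zero x = begin
    (f zero x ∙ t) ∙ f zero y   ≈⟨ comm _ _ ⟩
    f zero y ∙ (f zero x ∙ t)   ≈⟨ ∙-congˡ (comm _ _) ⟩
    f zero y ∙ (t ∙ f zero x)   ≈⟨ assoc _ _ _ ⟨
    (f zero y ∙ t) ∙ f zero x ∎
    where t = aggregate (λ r → f (suc r)) σ
  aggregate-update f (y ∷ σ) (suc r) x = begin
    (f zero y ∙ aggregate (λ r → f (suc r)) (σ [ r ]≔ x)) ∙ f (suc r) (lookup σ r)   ≈⟨ assoc _ _ _ ⟩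
    f zero y ∙ (aggregate (λ r → f (suc r)) (σ [ r ]≔ x) ∙ f (suc r) (lookup σ r))   ≈⟨ ∙-congˡ (aggregate-update (λ r → f (suc r)) σ r x) ⟩
    f zero y ∙ (aggregate (λ r → f (suc r)) σ ∙ f (suc r) x)                         ≈⟨ assoc _ _ _ ⟨
    (f zero y ∙ aggregate (λ r → f (suc r)) σ) ∙ f (suc r) x ∎

-- Scaling by optimal assignments.

module Scaling (K : ACF₀) where
  open ACF₀ K
  open RationalEmbedding K
  open Norms K
  open Approximation K
  open PivotElimination K
  open PreNorm
  open NaturalSums
  open import Data.Nat.Base as ℕ using (ℕ; zero; suc)
  import Data.Nat.Properties as ℕP
  open import Data.Fin.Base using (Fin; zero; suc)
  import Data.Fin.Properties as FP
  open import Data.Rational.Base using (1ℚ)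
  open import Data.Product using (∃-syntax; _×_; _,_; proj₁; proj₂)
  open import Data.List.Base using (List; []; _∷_; filter; cartesianProduct; allFin; cartesianProductWith; [_])
  open import Data.List.Membership.Propositional using (_∈_)
  open import Data.List.Membership.Propositional.Properties using (∈-filter⁺; ∈-filter⁻; ∈-cartesianProduct⁺; ∈-allFin; ∈-cartesianProductWith⁺)
  open import Data.List.Relation.Unary.Any using (here)
  open import Data.Vec.Base using (Vec; []; _∷_; lookup; _[_]≔_; replicate)
  open import Data.Vec.Properties using (lookup-replicate; []≔-lookup)
  open import Relation.Nullary using (¬_; Dec; yes; no)
  open import Relation.Binary.PropositionalEquality as ≡ using (_≡_)
  import Relation.Binary.Reasoning.Setoid setoid as ≈-Reasoning
  open Aggregate ℕP.+-0-commutativeMonoid using () renaming (aggregate to total; aggregate-update to total-update)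
  open Aggregate *-commutativeMonoid using () renaming (aggregate to product; aggregate-update to product-update)

  allVec : ∀ n → List (Vec (Fin 3) n)
  allVec zero = [ [] ]
  allVec (suc n) = cartesianProductWith _∷_ (allFin 3) (allVec n)

  ∈-allVec : ∀ {n} (σ : Vec (Fin 3) n) → σ ∈ allVec n
  ∈-allVec [] = here ≡.refl
  ∈-allVec (x ∷ σ) = ∈-cartesianProductWith⁺ _∷_ (∈-allFin x) (∈-allVec σ)

  -- A row r is a three-term relation among the points row r 0, row r 1, row r 2, owned by row r 0.
  module _ {n R : ℕ} (row : Fin R → Fin 3 → Fin n) (a a⁻¹ : Fin R → Fin 3 → Carrier)
           (aa⁻¹≈1 : ∀ r x → a r x * a⁻¹ r x ≈ 1#) where

    owned : Fin n → ℕ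
    owned c = sum (λ r → δ (row r zero) c)

    count : Vec (Fin 3) R → Fin n → ℕ
    count σ c = total (λ r x → δ (row r x) c) σ

    Configuration : Set
    Configuration = Vec (Fin 3) R × Fin n

    -- Every row is assigned to one of its points, and one extra token to an arbitrary point, so that each point c receives
    -- owned c items, except l, which receives one more.
    Surplus : Fin n → Configuration → Set
    Surplus l (σ , p) = ∀ c → count σ c ℕ.+ δ p c ≡ owned c ℕ.+ δ l c

    surplus? : ∀ l s → Dec (Surplus l s)
    surplus? l (σ , p) = FP.all? (λ c → count σ c ℕ.+ δ p c ℕP.≟ owned c ℕ.+ δ l c)

    configurations : List Configuration
    configurations = cartesianProduct (allVec R) (allFin n)

    -- Ensures that the maximum for l is taken over a nonempty family. The extra token makes this
    -- possible, since it can be placed at any l.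
    owner-configuration : ∀ l → Surplus l (replicate R zero , l)
    owner-configuration l c = ≡.cong (ℕ._+ δ l c) (sum-cong (λ r → ≡.cong (λ x → δ (row r x) c) (lookup-replicate r zero)))

    -- Taking a row away from l uses up its surplus, and the new point gains one. This exchange is
    -- what relates the maxima at l and at `row r x`.
    reassign : ∀ {l σ p} → Surplus l (σ , p) → ∀ r → row r (lookup σ r) ≡ l → ∀ x → Surplus (row r x) (σ [ r ]≔ x , p)
    reassign {l} {σ} {p} s r e x c = ℕP.+-cancelʳ-≡ (δ l c) _ _ (begin
      (count (σ [ r ]≔ x) c ℕ.+ δ p c) ℕ.+ δ l c              ≡⟨ ≡.cong (λ j → (count (σ [ r ]≔ x) c ℕ.+ δ p c) ℕ.+ δ j c) (≡.sym e) ⟩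
      (count (σ [ r ]≔ x) c ℕ.+ δ p c) ℕ.+ δ (row r (lookup σ r)) c  ≡⟨ swap (count (σ [ r ]≔ x) c) (δ p c) _ ⟩
      (count (σ [ r ]≔ x) c ℕ.+ δ (row r (lookup σ r)) c) ℕ.+ δ p c  ≡⟨ ≡.cong (ℕ._+ δ p c) (total-update (λ r x → δ (row r x) c) σ r x) ⟩
      (count σ c ℕ.+ δ (row r x) c) ℕ.+ δ p c                 ≡⟨ swap (count σ c) _ (δ p c) ⟩
      (count σ c ℕ.+ δ p c) ℕ.+ δ (row r x) c                 ≡⟨ ≡.cong (ℕ._+ δ (row r x) c) (s c) ⟩
      (owned c ℕ.+ δ l c) ℕ.+ δ (row r x) c                   ≡⟨ swap (owned c) (δ l c) _ ⟩
      (owned c ℕ.+ δ (row r x) c) ℕ.+ δ l c                   ∎)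
      where
      open ≡.≡-Reasoning
      swap : ∀ a b c → (a ℕ.+ b) ℕ.+ c ≡ (a ℕ.+ c) ℕ.+ b
      swap a b c = ≡.trans (ℕP.+-assoc a b c) (≡.trans (≡.cong (a ℕ.+_) (ℕP.+-comm b c)) (≡.sym (ℕP.+-assoc a c b)))

    weight weight⁻¹ : Configuration → Carrier
    weight (σ , _) = product a σ
    weight⁻¹ (σ , _) = product a⁻¹ σ

    product-inverse : ∀ {k} (b b⁻¹ : Fin k → Fin 3 → Carrier) → (∀ r x → b r x * b⁻¹ r x ≈ 1#) → ∀ σ → product b σ * product b⁻¹ σ ≈ 1#
    product-inverse b b⁻¹ e [] = *-identityˡ _
    product-inverse b b⁻¹ e (x ∷ σ) = trans
      (solve 4 (λ b p c q → (b :* p) :* (c :* q) := (b :* c) :* (p :* q)) refl (b zero x) (product (λ r → b (suc r)) σ) (b⁻¹ zero x) (product (λ r → b⁻¹ (suc r)) σ))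
      (trans (*-cong (e zero x) (product-inverse (λ r → b (suc r)) (λ r → b⁻¹ (suc r)) (λ r → e (suc r)) σ)) (*-identityˡ _))
      where open KSolver

    weight-inverse : ∀ s → weight s * weight⁻¹ s ≈ 1#
    weight-inverse (σ , _) = product-inverse a a⁻¹ aa⁻¹≈1 σ

    Heaviest : Fin n → PreNorm → Set
    Heaviest l Q = ∃[ s ] (Surplus l s × ∀ t → Surplus l t → N Q (weight t * weight⁻¹ s) 1ℚ)

    heaviest : ∀ l P → Proper P → ¬ ¬ Extension P (Heaviest l)
    heaviest l P proper k =
      maximum-of-list weight weight⁻¹ weight-inverse P proper (filter (surplus? l) configurations) (listed (replicate R zero , l) (owner-configuration l))
        λ { (Q , P⊑Q , Q-proper , s , s∈ , m) →
          k (Q , P⊑Q , Q-proper , s , proj₂ (∈-filter⁻ (surplus? l) {xs = configurations} s∈) , λ t t-surplus → m t (listed t t-surplus)) }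
      where
      listed : ∀ t → Surplus l t → t ∈ filter (surplus? l) configurations
      listed (σ , p) s = ∈-filter⁺ (surplus? l) (∈-cartesianProduct⁺ (∈-allVec σ) (∈-allFin p)) s

    -- Moving a row from j to another of its points x turns a surplus at j into a surplus at x. Dividing each column by its maximal
    -- weight, maximality at x therefore says that the entry of the row at x is at most the one at j.
    record Scaled (Q : PreNorm) : Set where
      field
        potential potential⁻¹ : Fin n → Carrier
        potential-inverse : ∀ l → potential l * potential⁻¹ l ≈ 1#
        chosen : Fin n → Fin R → Fin 3
        X : Fin n → Fin R → Fin 3 → Carrier
        X-bound : ∀ j r → row r (chosen j r) ≡ j → ∀ x → N Q (X j r x) 1ℚ
        X-chosen : ∀ j r → row r (chosen j r) ≡ j → X j r (chosen j r) ≈ 1#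
        X-relation : ∀ j r → row r (chosen j r) ≡ j → ∃[ d ] ∀ x → X j r x * potential (row r x) ≈ d * a r x
        chosen-count : ∀ j → owned j ℕ.≤ sum (λ r → δ (row r (chosen j r)) j)

    -- The potential of l is the optimal weight with surplus at l, which is how dual potentials of
    -- an assignment problem arise. `X j r x` compares the configuration after an exchange with the
    -- optimal one at its new surplus point, so optimality there bounds it by 1.
    scaled : ∀ {Q} → (∀ l → Heaviest l Q) → Scaled Q
    scaled {Q} h = record
      { potential = pot
      ; potential⁻¹ = pot⁻¹
      ; potential-inverse = λ l → weight-inverse (best l)
      ; chosen = chosen
      ; X = X
      ; X-bound = λ j r e x → proj₂ (proj₂ (h (row r x))) (proj₁ (best j) [ r ]≔ x , proj₂ (best j)) (reassign {σ = proj₁ (best j)} {proj₂ (best j)} (proj₁ (proj₂ (h j))) r e x)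
      ; X-chosen = λ j r e → trans (*-congʳ (reflexive (≡.cong (product a) ([]≔-lookup (proj₁ (best j)) r))))
                      (≡.subst (λ i → product a (proj₁ (best j)) * pot⁻¹ i ≈ 1#) (≡.sym e) (weight-inverse (best j)))
      ; X-relation = λ j r e → product a (proj₁ (best j)) * a⁻¹ r (chosen j r) , λ x → X-eq j r x
      ; chosen-count = λ j → count-bound j
      }
      where
      best : Fin n → Configuration
      best l = proj₁ (h l)
      pot pot⁻¹ : Fin n → Carrier
      pot l = weight (best l)
      pot⁻¹ l = weight⁻¹ (best l)
      chosen : Fin n → Fin R → Fin 3
      chosen j r = lookup (proj₁ (best j)) r
      X : Fin n → Fin R → Fin 3 → Carrier
      X j r x = product a (proj₁ (best j) [ r ]≔ x) * pot⁻¹ (row r x)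
      X-eq : ∀ j r x → X j r x * pot (row r x) ≈ (product a (proj₁ (best j)) * a⁻¹ r (chosen j r)) * a r x
      X-eq j r x = begin
        (w′ * pot⁻¹ (row r x)) * pot (row r x)           ≈⟨ *-assoc _ _ _ ⟩
        w′ * (pot⁻¹ (row r x) * pot (row r x))           ≈⟨ *-congˡ (trans (*-comm _ _) (weight-inverse (best (row r x)))) ⟩
        w′ * 1#                                          ≈⟨ *-congˡ (aa⁻¹≈1 r (chosen j r)) ⟨
        w′ * (a r (chosen j r) * a⁻¹ r (chosen j r))     ≈⟨ *-assoc _ _ _ ⟨
        (w′ * a r (chosen j r)) * a⁻¹ r (chosen j r)     ≈⟨ *-congʳ (product-update a (proj₁ (best j)) r x) ⟩
        (product a (proj₁ (best j)) * a r x) * a⁻¹ r (chosen j r) ≈⟨ trans (*-assoc _ _ _) (trans (*-congˡ (*-comm _ _)) (sym (*-assoc _ _ _))) ⟩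
        (product a (proj₁ (best j)) * a⁻¹ r (chosen j r)) * a r x ∎
        where
        open ≈-Reasoning
        w′ = product a (proj₁ (best j) [ r ]≔ x)
      -- The token itself may sit at j, which costs at most the one surplus item.
      count-bound : ∀ j → owned j ℕ.≤ count (proj₁ (best j)) j
      count-bound j = ℕP.+-cancelʳ-≤ 1 _ _ (ℕP.≤-trans (ℕP.≤-reflexive (≡.trans (≡.cong (owned j ℕ.+_) (≡.sym (δ-refl j))) (≡.sym (proj₁ (proj₂ (h j)) j))))
        (ℕP.+-monoʳ-≤ (count (proj₁ (best j)) j) (δ≤1 (proj₂ (best j)) j)))
        where
        δ≤1 : ∀ {k} (i j : Fin k) → δ i j ℕ.≤ 1
        δ≤1 i j with i FP.≟ j
        ... | yes _ = ℕP.≤-refl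
        ... | no _ = ℕ.z≤n

    scaling : ∀ P → Proper P → ¬ ¬ Extension P Scaled
    scaling P proper k = family Heaviest (λ l P⊑Q (s , su , m) → s , su , λ t ts → lift P⊑Q (m t ts)) P (λ l Q _ → heaviest l Q) P ⊑-refl proper
      λ { (Q , P⊑Q , Q-proper , h) → k (Q , P⊑Q , Q-proper , scaled h) }

-- Rank bound for approximate relations with rational coefficients.

module NumericalRank where
  open RationalLemmas
  open RationalSums
  module ℕΣ = NaturalSums
  open NaturalSums using (δ; indicator)
  open import Data.Nat.Base as ℕ using (ℕ; zero; suc)
  import Data.Nat.Properties as ℕP
  open import Data.Fin.Base using (Fin; zero; suc; splitAt)
  import Data.Fin.Properties as FP
  open import Data.Rational.Base hiding (floor)
  open import Data.Rational.Properties
  open import Data.Rational.Solver using (module +-*-Solver)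
  open import Algebra.Bundles using (CommutativeRing)
  open import Data.Product using (_×_; _,_; proj₁; proj₂)
  open import Data.Sum using (inj₁; inj₂; [_,_]′)
  open import Data.Empty using (⊥-elim)
  open import Relation.Nullary using (¬_; Dec; yes; no)
  open import Relation.Nullary.Decidable using (from-yes)
  open import Relation.Binary.PropositionalEquality using (_≡_; _≢_; refl; sym; trans; cong; cong₂; subst; subst₂; module ≡-Reasoning)
  open Aggregate (CommutativeRing.+-commutativeMonoid +-*-commutativeRing) using (sum-split)
  open +-*-Solver using (solve; _:=_; _:+_; _:*_; _:-_; :-_; con)

  δℚ : ∀ {n} → Fin n → Fin n → ℚ
  δℚ i j = fromℕ (δ i j)

  δℚ-sum : ∀ {n} (i : Fin n) (f : Fin n → ℚ) → sum (λ j → δℚ i j * f j) ≡ f i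
  δℚ-sum {suc n} zero f = trans (cong₂ _+_ (*-identityˡ (f zero)) (sum-zero {n} {λ j → δℚ zero (suc j) * f (suc j)} (λ j → *-zeroˡ (f (suc j))))) (+-identityʳ (f zero))
  δℚ-sum {suc n} (suc i) f = trans (cong₂ _+_ (*-zeroˡ (f zero)) (trans (sum-cong (λ j → cong (λ t → fromℕ t * f (suc j)) (ℕΣ.δ-suc i j))) (δℚ-sum i (λ j → f (suc j))))) (+-identityˡ (f (suc i)))

  fromℕ-sum : ∀ {n} (f : Fin n → ℕ) → fromℕ (ℕΣ.sum f) ≡ sum (λ i → fromℕ (f i))
  fromℕ-sum {zero} f = refl
  fromℕ-sum {suc n} f = trans (fromℕ-+ (f zero) (ℕΣ.sum (λ i → f (suc i)))) (cong (fromℕ (f zero) +_) (fromℕ-sum (λ i → f (suc i))))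

  ∣sum∣≤ : ∀ {n} (f g : Fin n → ℚ) → (∀ i → ∣ f i ∣ ≤ g i) → ∣ sum f ∣ ≤ sum g
  ∣sum∣≤ {zero} f g h = ≤-refl
  ∣sum∣≤ {suc n} f g h = ≤-trans (∣p+q∣≤∣p∣+∣q∣ (f zero) (sum (λ i → f (suc i)))) (+-mono-≤ (h zero) (∣sum∣≤ (λ i → f (suc i)) (λ i → g (suc i)) (λ i → h (suc i))))

  square-abs : ∀ p → ∣ p ∣ * ∣ p ∣ ≡ p * p
  square-abs p = trans (sym (∣p*q∣≡∣p∣*∣q∣ p p)) (0≤p⇒∣p∣≡p (square-nonNeg p))

  square-mono : ∀ {p q} → ∣ p ∣ ≤ q → p * p ≤ q * q
  square-mono {p} {q} h = subst (_≤ q * q) (square-abs p) (*-mono (0≤∣p∣ p) h (0≤∣p∣ p) h)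

  2ℚ : ℚ
  2ℚ = fromℕ 2

  -- A crude Cauchy-Schwarz inequality from (a + s)² ≤ 2a² + 2s². The exponential factor does no
  -- harm, because the precision η is chosen after p.
  square-sum : ∀ {p} (x : Fin p → ℚ) → sum x * sum x ≤ (2ℚ ^ℚ p) * sum (λ q → x q * x q)
  square-sum {zero} x = ≤-refl
  square-sum {suc p} x = ≤-trans (≤-by-gap ((a - s) * (a - s)) (square-nonNeg (a - s)) (lem a s))
      (≤-trans (+-mono-≤ (*-monoˡ 0≤2 a²≤) (*-monoˡ 0≤2 (square-sum (λ q → x (suc q))))) (≤-reflexive (lem′ t (a * a) Q)))
    where
    a = x zero
    s = sum (λ q → x (suc q))
    t = 2ℚ ^ℚ p
    Q = sum (λ q → x (suc q) * x (suc q))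
    0≤2 : 0ℚ ≤ 2ℚ
    0≤2 = from-yes (0ℚ ≤? 2ℚ)
    1≤^ : ∀ k → 1ℚ ≤ 2ℚ ^ℚ k
    1≤^ zero = ≤-refl
    1≤^ (suc k) = ≤-trans (from-yes (1ℚ ≤? 2ℚ * 1ℚ)) (*-monoˡ 0≤2 (1≤^ k))
    a²≤ : a * a ≤ t * (a * a)
    a²≤ = subst (_≤ t * (a * a)) (*-identityˡ (a * a)) (*-monoʳ (square-nonNeg a) (1≤^ p))
    lem : ∀ a s → (a + s) * (a + s) + (a - s) * (a - s) ≡ 2ℚ * (a * a) + 2ℚ * (s * s)
    lem = solve 2 (λ a s → (a :+ s) :* (a :+ s) :+ (a :- s) :* (a :- s) := con 2ℚ :* (a :* a) :+ con 2ℚ :* (s :* s)) refl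
    lem′ : ∀ t b Q → 2ℚ * (t * b) + 2ℚ * (t * Q) ≡ (2ℚ * t) * (b + Q)
    lem′ = solve 3 (λ t b Q → con 2ℚ :* (t :* b) :+ con 2ℚ :* (t :* Q) := (con 2ℚ :* t) :* (b :+ Q)) refl

  -- Real and imaginary parts of a complex vector. The form below is the real part of the Hermitian
  -- product, so p complex vectors are handled through their rational combinations.
  Vector : ℕ → Set
  Vector n = (Fin n → ℚ) × (Fin n → ℚ)

  module _ {n : ℕ} where
    0ᵥ : Vector n
    0ᵥ = (λ _ → 0ℚ) , (λ _ → 0ℚ)

    _+ᵥ_ : Vector n → Vector n → Vector n
    (x , y) +ᵥ (z , w) = (λ j → x j + z j) , (λ j → y j + w j)

    _·ᵥ_ : ℚ → Vector n → Vector n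
    c ·ᵥ (x , y) = (λ j → c * x j) , (λ j → c * y j)

    ⟨_,_⟩ : Vector n → Vector n → ℚ
    ⟨ (x , y) , (z , w) ⟩ = sum (λ j → x j * z j + y j * w j)

    ⟨⟩-comm : ∀ u v → ⟨ u , v ⟩ ≡ ⟨ v , u ⟩
    ⟨⟩-comm (x , y) (z , w) = sum-cong (λ j → cong₂ _+_ (*-comm (x j) (z j)) (*-comm (y j) (w j)))

    ⟨⟩-nonNeg : ∀ u → 0ℚ ≤ ⟨ u , u ⟩
    ⟨⟩-nonNeg (x , y) = sum-nonNeg (λ j → +-nonNeg (square-nonNeg (x j)) (square-nonNeg (y j)))

    ⟨⟩-zero : ∀ v → ⟨ 0ᵥ , v ⟩ ≡ 0ℚ
    ⟨⟩-zero (z , w) = sum-zero (λ j → cong₂ _+_ (*-zeroˡ (z j)) (*-zeroˡ (w j)))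

    ⟨⟩-add : ∀ u w v → ⟨ u +ᵥ w , v ⟩ ≡ ⟨ u , v ⟩ + ⟨ w , v ⟩
    ⟨⟩-add (x , y) (x′ , y′) (z , w) = trans (sum-cong (λ j → lem (x j) (x′ j) (y j) (y′ j) (z j) (w j))) (∑-distrib-+ (λ j → x j * z j + y j * w j) _)
      where
      lem : ∀ x x′ y y′ z w → (x + x′) * z + (y + y′) * w ≡ (x * z + y * w) + (x′ * z + y′ * w)
      lem = solve 6 (λ x x′ y y′ z w → (x :+ x′) :* z :+ (y :+ y′) :* w := (x :* z :+ y :* w) :+ (x′ :* z :+ y′ :* w)) refl

    ⟨⟩-scale : ∀ c u v → ⟨ c ·ᵥ u , v ⟩ ≡ c * ⟨ u , v ⟩
    ⟨⟩-scale c (x , y) (z , w) = trans (sum-cong (λ j → lem c (x j) (y j) (z j) (w j))) (sym (*-distribˡ-sum c (λ j → x j * z j + y j * w j)))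
      where
      lem : ∀ c x y z w → (c * x) * z + (c * y) * w ≡ c * (x * z + y * w)
      lem = solve 5 (λ c x y z w → (c :* x) :* z :+ (c :* y) :* w := c :* (x :* z :+ y :* w)) refl

    open Bessel {Vector n} 0ᵥ _+ᵥ_ _·ᵥ_ ⟨_,_⟩ public

    comb-re : ∀ {p} (α : Fin p → ℚ) u j → proj₁ (comb α u) j ≡ sum (λ q → α q * proj₁ (u q) j)
    comb-re {zero} α u j = refl
    comb-re {suc p} α u j = cong (α zero * proj₁ (u zero) j +_) (comb-re (λ q → α (suc q)) (λ q → u (suc q)) j)

    comb-im : ∀ {p} (α : Fin p → ℚ) u j → proj₂ (comb α u) j ≡ sum (λ q → α q * proj₂ (u q) j)
    comb-im {zero} α u j = refl
    comb-im {suc p} α u j = cong (α zero * proj₂ (u zero) j +_) (comb-im (λ q → α (suc q)) (λ q → u (suc q)) j)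

  ∑∑ : ∀ {R} → (Fin R → Fin 3 → ℚ) → ℚ
  ∑∑ f = sum (λ r → sum (λ x → f r x))

  ∑∑-cong : ∀ {R} {f g : Fin R → Fin 3 → ℚ} → (∀ r x → f r x ≡ g r x) → ∑∑ f ≡ ∑∑ g
  ∑∑-cong e = sum-cong (λ r → sum-cong (e r))

  ∑∑-+ : ∀ {R} (f g : Fin R → Fin 3 → ℚ) → ∑∑ (λ r x → f r x + g r x) ≡ ∑∑ f + ∑∑ g
  ∑∑-+ f g = trans (sum-cong (λ r → ∑-distrib-+ (f r) (g r))) (∑-distrib-+ (λ r → sum (f r)) (λ r → sum (g r)))

  ∑∑-comm : ∀ {R n} (f : Fin n → Fin R → Fin 3 → ℚ) → sum (λ l → ∑∑ (f l)) ≡ ∑∑ (λ r x → sum (λ l → f l r x))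
  ∑∑-comm f = trans (∑-comm (λ l r → sum (f l r))) (sum-cong (λ r → ∑-comm (λ l x → f l r x)))

  ∑∑-distribʳ : ∀ {R} c (f : Fin R → Fin 3 → ℚ) → ∑∑ f * c ≡ ∑∑ (λ r x → f r x * c)
  ∑∑-distribʳ c f = trans (*-distribʳ-sum c (λ r → sum (f r))) (sum-cong (λ r → *-distribʳ-sum c (f r)))

  ∑∑-distribˡ : ∀ {R} c (f : Fin R → Fin 3 → ℚ) → c * ∑∑ f ≡ ∑∑ (λ r x → c * f r x)
  ∑∑-distribˡ c f = trans (*-distribˡ-sum c (λ r → sum (f r))) (sum-cong (λ r → *-distribˡ-sum c (f r)))

  ∣∑∑∣≤ : ∀ {R} (f g : Fin R → Fin 3 → ℚ) → (∀ r x → ∣ f r x ∣ ≤ g r x) → ∣ ∑∑ f ∣ ≤ ∑∑ g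
  ∣∑∑∣≤ f g h = ∣sum∣≤ (λ r → sum (f r)) (λ r → sum (g r)) (λ r → ∣sum∣≤ (f r) (g r) (h r))

  module _ {n R : ℕ} (row : Fin R → Fin 3 → Fin n) (chosen : Fin n → Fin R → Fin 3) where

    Active : Fin n → Fin R → Set
    Active j r = row r (chosen j r) ≡ j

    active? : ∀ j r → Dec (Active j r)
    active? j r = row r (chosen j r) FP.≟ j

    activeCount : Fin n → ℕ
    activeCount j = ℕΣ.sum (λ r → δ (row r (chosen j r)) j)

    gate : ∀ {A : Set} → Dec A → Fin 3 → Fin 3 → ℕ
    gate (yes _) y x = 1 ℕ.∸ indicator (x FP.≟ y)
    gate (no _) y x = 0

    -- Marks the off-diagonal entries of the relations that are averaged in row j. The decision is
    -- passed to `gate`, where it can be treated as a variable.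
    side : Fin n → Fin R → Fin 3 → ℕ
    side j r = gate (active? j r) (chosen j r)

    gate-no : ∀ {A : Set} (d : Dec A) → ¬ A → ∀ y x → gate d y x ≡ 0
    gate-no (yes a) h y x = ⊥-elim (h a)
    gate-no (no _) h y x = refl

    gate-same : ∀ {A : Set} (d : Dec A) y → gate d y y ≡ 0
    gate-same (yes _) y = cong (1 ℕ.∸_) (ℕΣ.δ-refl y)
    gate-same (no _) y = refl

    gate-yes : ∀ {A : Set} (d : Dec A) → A → ∀ {y x} → x ≢ y → gate d y x ≡ 1
    gate-yes (yes _) a h = cong (1 ℕ.∸_) (ℕΣ.δ-≢ h)
    gate-yes (no h′) a h = ⊥-elim (h′ a)

    side-inactive : ∀ {j r} → ¬ Active j r → ∀ x → side j r x ≡ 0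
    side-inactive {j} {r} h = gate-no (active? j r) h (chosen j r)

    side-chosen : ∀ j r → side j r (chosen j r) ≡ 0
    side-chosen j r = gate-same (active? j r) (chosen j r)

    side-other : ∀ {j r x} → Active j r → x ≢ chosen j r → side j r x ≡ 1
    side-other {j} {r} e h = gate-yes (active? j r) e h

    gate-sum : ∀ {A : Set} (d : Dec A) y → ℕΣ.sum (gate d y) ≡ 2 ℕ.* indicator d
    gate-sum (no _) y = refl
    gate-sum (yes _) zero = refl
    gate-sum (yes _) (suc zero) = refl
    gate-sum (yes _) (suc (suc zero)) = refl

    side-sum : ∀ j r → ℕΣ.sum (side j r) ≡ 2 ℕ.* δ (row r (chosen j r)) j
    side-sum j r = gate-sum (active? j r) (chosen j r)

    coincidence : Fin n → Fin n → ℕ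
    coincidence j l = ℕΣ.sum (λ r → ℕΣ.sum (λ x → side j r x ℕ.* δ (row r x) l))

    coincidence-sum : ∀ j → ℕΣ.sum (coincidence j) ≡ 2 ℕ.* activeCount j
    coincidence-sum j = trans (ℕΣ.∑-comm (λ l r → ℕΣ.sum (λ x → side j r x ℕ.* δ (row r x) l)))
      (trans (ℕΣ.sum-cong (λ r → trans (ℕΣ.∑-comm (λ l x → side j r x ℕ.* δ (row r x) l)) (ℕΣ.sum-cong (λ x → collapse (side j r x) (row r x)))))
        (trans (ℕΣ.sum-cong (side-sum j)) (sym (ℕΣ.*-distribˡ-sum 2 (λ r → δ (row r (chosen j r)) j)))))
      where
      collapse : ∀ s i → ℕΣ.sum (λ l → s ℕ.* δ i l) ≡ s
      collapse s i = trans (ℕΣ.sum-cong (λ l → ℕP.*-comm s (δ i l))) (ℕΣ.δ-sum i (λ _ → s))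

    module _ {M : ℕ} (load : ∀ j l x x′ → x ≢ x′ → ℕΣ.sum (λ r → δ (row r x) j ℕ.* δ (row r x′) l) ℕ.≤ M) where

      pairs : Fin n → Fin n → Fin 3 → Fin 3 → Fin R → ℕ
      pairs j l y x r = δ (row r y) j ℕ.* δ (row r x) l

      side-bound : ∀ j l r x → side j r x ℕ.* δ (row r x) l ℕ.≤ ℕΣ.sum (λ y → (1 ℕ.∸ indicator (y FP.≟ x)) ℕ.* pairs j l y x r)
      side-bound j l r x = cases (active? j r) (x FP.≟ chosen j r)
        where
        Goal = side j r x ℕ.* δ (row r x) l ℕ.≤ ℕΣ.sum (λ y → (1 ℕ.∸ indicator (y FP.≟ x)) ℕ.* pairs j l y x r)
        vanish : side j r x ≡ 0 → Goal
        vanish e = ℕP.≤-trans (ℕP.≤-reflexive (cong (ℕ._* δ (row r x) l) e)) ℕ.z≤n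
        cases : Dec (Active j r) → Dec (x ≡ chosen j r) → Goal
        cases (no h) _ = vanish (side-inactive h x)
        cases (yes _) (yes refl) = vanish (side-chosen j r)
        cases (yes e) (no h) = ℕP.≤-trans (ℕP.≤-reflexive (trans (cong (ℕ._* δ (row r x) l) (side-other e h)) (sym e′)))
            (ℕΣ.term≤sum (λ y → (1 ℕ.∸ indicator (y FP.≟ x)) ℕ.* pairs j l y x r) (chosen j r))
          where
          e′ : (1 ℕ.∸ indicator (chosen j r FP.≟ x)) ℕ.* pairs j l (chosen j r) x r ≡ 1 ℕ.* δ (row r x) l
          e′ = trans (cong₂ (λ s t → (1 ℕ.∸ s) ℕ.* (t ℕ.* δ (row r x) l)) (ℕΣ.δ-≢ (λ c≡x → h (sym c≡x))) (trans (cong (λ i → δ i j) e) (ℕΣ.δ-refl j)))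
                 (ℕP.*-identityˡ (1 ℕ.* δ (row r x) l))

      -- The chosen position varies with the row, so all 6 ordered pairs of distinct positions are
      -- summed; each of them meets (j, l) in at most M rows.
      coincidence-bound : ∀ j l → coincidence j l ℕ.≤ 6 ℕ.* M
      coincidence-bound j l = ℕP.≤-trans (ℕΣ.sum-mono (λ r → ℕΣ.sum-mono (side-bound j l r)))
        (ℕP.≤-trans (ℕP.≤-reflexive (trans (ℕΣ.∑-comm (λ r x → ℕΣ.sum (λ y → w y x ℕ.* pairs j l y x r)))
            (ℕΣ.sum-cong (λ x → trans (ℕΣ.∑-comm (λ r y → w y x ℕ.* pairs j l y x r)) (ℕΣ.sum-cong (λ y → sym (ℕΣ.*-distribˡ-sum (w y x) (pairs j l y x))))))))
          (ℕP.≤-trans (ℕΣ.sum-mono (λ x → ℕΣ.sum-mono (λ y → bd y x))) (ℕP.≤-reflexive (total M))))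
        where
        w : Fin 3 → Fin 3 → ℕ
        w y x = 1 ℕ.∸ indicator (y FP.≟ x)
        bd : ∀ y x → w y x ℕ.* ℕΣ.sum (pairs j l y x) ℕ.≤ w y x ℕ.* M
        bd y x with y FP.≟ x
        ... | yes _ = ℕ.z≤n
        ... | no y≢x = ℕP.*-monoʳ-≤ 1 (load j l y x y≢x)
        open import Data.Nat.Solver renaming (module +-*-Solver to ℕSolver)
        total : ∀ M → ℕΣ.sum {3} (λ x → ℕΣ.sum {3} (λ y → w y x ℕ.* M)) ≡ 6 ℕ.* M
        total = ℕSolver.solve 1 (λ M → let z = ℕSolver.con 0 ℕSolver.:* M ; o = ℕSolver.con 1 ℕSolver.:* M ; _⊞_ = ℕSolver._:+_ ; k0 = ℕSolver.con 0 in
          ((z ⊞ (o ⊞ (o ⊞ k0))) ⊞ ((o ⊞ (z ⊞ (o ⊞ k0))) ⊞ ((o ⊞ (o ⊞ (z ⊞ k0))) ⊞ k0))) ℕSolver.:= ℕSolver.con 6 ℕSolver.:* M) refl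

    -- X + iY are the coefficients and u the columns of C; the relations hold only up to η. Chosen
    -- positions and pivots have exact values, so the diagonal of I + F and the identity inside C
    -- carry no error.
    module Bound {M κ p : ℕ} {η : ℚ}
      (load : ∀ j l x x′ → x ≢ x′ → ℕΣ.sum (λ r → δ (row r x) j ℕ.* δ (row r x′) l) ℕ.≤ M)
      (1≤κ : 1 ℕ.≤ κ) (enough : ∀ j → κ ℕ.≤ activeCount j)
      (X Y : Fin n → Fin R → Fin 3 → ℚ)
      (X-inactive : ∀ j r → ¬ Active j r → ∀ x → X j r x ≡ 0ℚ) (Y-inactive : ∀ j r → ¬ Active j r → ∀ x → Y j r x ≡ 0ℚ)
      (X-chosen : ∀ j r → Active j r → X j r (chosen j r) ≡ 1ℚ) (Y-chosen : ∀ j r → Active j r → Y j r (chosen j r) ≡ 0ℚ)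
      (X-bound : ∀ j r x → ∣ X j r x ∣ ≤ (fromℕ 4)) (Y-bound : ∀ j r x → ∣ Y j r x ∣ ≤ (fromℕ 4))
      (u : Fin p → Vector n) (pivot : Fin p → Fin n)
      (pivot-injective : ∀ {q q′} → pivot q ≡ pivot q′ → q ≡ q′)
      (own : ∀ q → proj₁ (u q) (pivot q) ≡ 1ℚ) (other : ∀ q q′ → q ≢ q′ → proj₁ (u q) (pivot q′) ≡ 0ℚ)
      (error-re : ∀ j q → ∣ ∑∑ (λ r x → X j r x * proj₁ (u q) (row r x) - Y j r x * proj₂ (u q) (row r x)) ∣ ≤ η)
      (error-im : ∀ j q → ∣ ∑∑ (λ r x → X j r x * proj₂ (u q) (row r x) + Y j r x * proj₁ (u q) (row r x)) ∣ ≤ η)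
      (0≤η : 0ℚ ≤ η) (η-small : fromℕ n * (fromℕ 8 * ((2ℚ ^ℚ p) * (η * η))) ≤ 1ℚ)
      where

      c : Fin n → ℚ
      c j = fromℕ (activeCount j)

      1≤c : ∀ j → 1ℚ ≤ c j
      1≤c j = fromℕ-mono-≤ {1} (ℕP.≤-trans 1≤κ (enough j))

      0<c : ∀ j → 0ℚ < c j
      0<c j = <-≤-trans (from-yes (0ℚ <? 1ℚ)) (1≤c j)

      ρ : Fin n → ℚ
      ρ j = (1/ c j) {{pos⇒nonZero (c j) {{positive (0<c j)}}}}

      ρc : ∀ j → ρ j * c j ≡ 1ℚ
      ρc j = *-inverseˡ (c j) {{pos⇒nonZero (c j) {{positive (0<c j)}}}}

      0<ρ : ∀ j → 0ℚ < ρ j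
      0<ρ j = positive⁻¹ (ρ j) {{1/pos⇒pos (c j) {{positive (0<c j)}}}}

      ρ≤1 : ∀ j → ρ j ≤ 1ℚ
      ρ≤1 j = subst₂ _≤_ (*-identityʳ (ρ j)) (ρc j) (*-monoˡ (<⇒≤ (0<ρ j)) (1≤c j))

      off : (Fin n → Fin R → Fin 3 → ℚ) → Fin n → Fin R → Fin 3 → ℚ
      off Z j r x = fromℕ (side j r x) * Z j r x

      -- Row j of F is `ρ j` times row j of T X + i T Y.
      T : (Fin n → Fin R → Fin 3 → ℚ) → Fin n → Fin n → ℚ
      T Z j l = ∑∑ (λ r x → off Z j r x * δℚ (row r x) l)

      T-apply : ∀ Z j (v : Fin n → ℚ) → sum (λ l → T Z j l * v l) ≡ ∑∑ (λ r x → off Z j r x * v (row r x))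
      T-apply Z j v = begin
        sum (λ l → T Z j l * v l)                                            ≡⟨ sum-cong (λ l → ∑∑-distribʳ (v l) (λ r x → off Z j r x * δℚ (row r x) l)) ⟩
        sum (λ l → ∑∑ (λ r x → (off Z j r x * δℚ (row r x) l) * v l))        ≡⟨ ∑∑-comm (λ l r x → (off Z j r x * δℚ (row r x) l) * v l) ⟩
        ∑∑ (λ r x → sum (λ l → (off Z j r x * δℚ (row r x) l) * v l))        ≡⟨ ∑∑-cong (λ r x → trans (sum-cong (λ l → *-assoc (off Z j r x) (δℚ (row r x) l) (v l)))
                                                                                  (trans (sym (*-distribˡ-sum (off Z j r x) (λ l → δℚ (row r x) l * v l))) (cong (off Z j r x *_) (δℚ-sum (row r x) v)))) ⟩
        ∑∑ (λ r x → off Z j r x * v (row r x)) ∎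
        where open ≡-Reasoning

      diagonal : (Fin n → Fin R → Fin 3 → ℚ) → Fin n → Fin R → Fin 3 → ℚ
      diagonal Z j r x = Z j r x - off Z j r x

      diagonal-inactive : ∀ Z j r → ¬ Active j r → ∀ x → Z j r x ≡ 0ℚ → diagonal Z j r x ≡ 0ℚ
      diagonal-inactive Z j r h x e = trans (cong (λ t → Z j r x - fromℕ t * Z j r x) (side-inactive h x)) (trans (cong (λ z → z - 0ℚ * z) e) refl)

      diagonal-chosen : ∀ Z j r → diagonal Z j r (chosen j r) ≡ Z j r (chosen j r)
      diagonal-chosen Z j r = trans (cong (λ t → Z j r (chosen j r) - fromℕ t * Z j r (chosen j r)) (side-chosen j r))
        (solve 1 (λ z → z :- con 0ℚ :* z := z) refl (Z j r (chosen j r)))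

      diagonal-other : ∀ Z j r x → Active j r → x ≢ chosen j r → diagonal Z j r x ≡ 0ℚ
      diagonal-other Z j r x e h = trans (cong (λ t → Z j r x - fromℕ t * Z j r x) (side-other e h))
        (solve 1 (λ z → z :- con 1ℚ :* z := con 0ℚ) refl (Z j r x))

      diagonal-term : ∀ Z (z : ℚ) → (∀ j r → ¬ Active j r → ∀ x → Z j r x ≡ 0ℚ) → (∀ j r → Active j r → Z j r (chosen j r) ≡ z) →
                      ∀ j r (v : Fin n → ℚ) x → diagonal Z j r x * v (row r x) ≡ δℚ (chosen j r) x * (fromℕ (δ (row r (chosen j r)) j) * (z * v j))
      diagonal-term Z z inactive at-chosen j r v x = cases (active? j r) (x FP.≟ chosen j r)
        where
        cases : Dec (Active j r) → Dec (x ≡ chosen j r) → diagonal Z j r x * v (row r x) ≡ δℚ (chosen j r) x * (fromℕ (δ (row r (chosen j r)) j) * (z * v j))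
        cases (no h) _ = trans (cong (_* v (row r x)) (diagonal-inactive Z j r h x (inactive j r h x))) (trans (*-zeroˡ (v (row r x)))
          (sym (trans (cong (λ t → δℚ (chosen j r) x * (fromℕ t * (z * v j))) (ℕΣ.δ-≢ h)) (trans (cong (δℚ (chosen j r) x *_) (*-zeroˡ (z * v j))) (*-zeroʳ (δℚ (chosen j r) x))))))
        cases (yes e) (yes refl) = trans (cong₂ _*_ (trans (diagonal-chosen Z j r) (at-chosen j r e)) (cong v e))
          (sym (trans (cong₂ (λ s t → fromℕ s * (fromℕ t * (z * v j))) (ℕΣ.δ-refl (chosen j r)) (trans (cong (λ i → δ i j) e) (ℕΣ.δ-refl j)))
            (trans (*-identityˡ (1ℚ * (z * v j))) (*-identityˡ (z * v j)))))
        cases (yes e) (no h) = trans (cong (_* v (row r x)) (diagonal-other Z j r x e h)) (trans (*-zeroˡ (v (row r x)))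
          (sym (trans (cong (λ t → fromℕ t * (fromℕ (δ (row r (chosen j r)) j) * (z * v j))) (ℕΣ.δ-≢ (λ e′ → h (sym e′)))) (*-zeroˡ (fromℕ (δ (row r (chosen j r)) j) * (z * v j))))))

      split : ∀ Z (z : ℚ) → (∀ j r → ¬ Active j r → ∀ x → Z j r x ≡ 0ℚ) → (∀ j r → Active j r → Z j r (chosen j r) ≡ z) →
              ∀ j (v : Fin n → ℚ) → ∑∑ (λ r x → Z j r x * v (row r x)) ≡ c j * (z * v j) + sum (λ l → T Z j l * v l)
      split Z z inactive at-chosen j v = begin
        ∑∑ (λ r x → Z j r x * v (row r x))
          ≡⟨ ∑∑-cong (λ r x → solve 3 (λ a b v → a :* v := (a :- b) :* v :+ b :* v) refl (Z j r x) (off Z j r x) (v (row r x))) ⟩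
        ∑∑ (λ r x → diagonal Z j r x * v (row r x) + off Z j r x * v (row r x))
          ≡⟨ ∑∑-+ (λ r x → diagonal Z j r x * v (row r x)) (λ r x → off Z j r x * v (row r x)) ⟩
        ∑∑ (λ r x → diagonal Z j r x * v (row r x)) + ∑∑ (λ r x → off Z j r x * v (row r x))
          ≡⟨ cong₂ _+_ (trans (∑∑-cong (λ r x → diagonal-term Z z inactive at-chosen j r v x))
               (trans (sum-cong (λ r → δℚ-sum (chosen j r) (λ _ → fromℕ (δ (row r (chosen j r)) j) * (z * v j)))) (rows-sum j (z * v j)))) (sym (T-apply Z j v)) ⟩
        c j * (z * v j) + sum (λ l → T Z j l * v l) ∎
        where
        open ≡-Reasoning
        rows-sum : ∀ j (v : ℚ) → sum (λ r → fromℕ (δ (row r (chosen j r)) j) * v) ≡ c j * v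
        rows-sum j v = trans (sym (*-distribʳ-sum v (λ r → fromℕ (δ (row r (chosen j r)) j)))) (cong (_* v) (sym (fromℕ-sum (λ r → δ (row r (chosen j r)) j))))

      abs-off : ∀ Z j r x → (∀ j r x → ∣ Z j r x ∣ ≤ (fromℕ 4)) → ∀ l → ∣ off Z j r x * δℚ (row r x) l ∣ ≤ (fromℕ 4) * fromℕ (side j r x ℕ.* δ (row r x) l)
      abs-off Z j r x bd l = subst₂ _≤_ (sym (trans (∣p*q∣≡∣p∣*∣q∣ (off Z j r x) (δℚ (row r x) l))
            (cong₂ _*_ (trans (∣p*q∣≡∣p∣*∣q∣ s (Z j r x)) (cong (_* ∣ Z j r x ∣) (0≤p⇒∣p∣≡p (fromℕ-nonNeg (side j r x))))) (0≤p⇒∣p∣≡p (fromℕ-nonNeg (δ (row r x) l))))))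
          (trans (solve 3 (λ s d f → (s :* f) :* d := f :* (s :* d)) refl s (δℚ (row r x) l) (fromℕ 4)) (cong ((fromℕ 4) *_) (sym (fromℕ-* (side j r x) (δ (row r x) l)))))
          (*-monoʳ (fromℕ-nonNeg (δ (row r x) l)) (*-monoˡ (fromℕ-nonNeg (side j r x)) (bd j r x)))
        where s = fromℕ (side j r x)

      abs-T : ∀ Z → (∀ j r x → ∣ Z j r x ∣ ≤ (fromℕ 4)) → ∀ j l → ∣ T Z j l ∣ ≤ (fromℕ 4) * fromℕ (coincidence j l)
      abs-T Z bd j l = ≤-trans (∣∑∑∣≤ (λ r x → off Z j r x * δℚ (row r x) l) (λ r x → (fromℕ 4) * fromℕ (side j r x ℕ.* δ (row r x) l)) (λ r x → abs-off Z j r x bd l))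
        (≤-reflexive (trans (sym (∑∑-distribˡ (fromℕ 4) (λ r x → fromℕ (side j r x ℕ.* δ (row r x) l))))
          (cong ((fromℕ 4) *_) (trans (sum-cong (λ r → sym (fromℕ-sum (λ x → side j r x ℕ.* δ (row r x) l)))) (sym (fromℕ-sum (λ r → ℕΣ.sum (λ x → side j r x ℕ.* δ (row r x) l))))))))

      Mℚ : ℚ
      Mℚ = fromℕ M

      -- A sum of squares is at most the maximum times the sum: coincidences are at most 6M and add
      -- up to twice the number of active rows. With 4² from the size of the coefficients, the
      -- constant is 16 · 6 · 2 = 192.
      square-T : ∀ Z → (∀ j r x → ∣ Z j r x ∣ ≤ (fromℕ 4)) → ∀ j → sum (λ l → T Z j l * T Z j l) ≤ fromℕ 192 * (Mℚ * c j)
      square-T Z bd j = ≤-trans (sum-mono term) (≤-reflexive total)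
        where
        t : Fin n → ℚ
        t l = fromℕ (coincidence j l)
        term : ∀ l → T Z j l * T Z j l ≤ (fromℕ 96 * Mℚ) * t l
        term l = ≤-trans (square-mono {T Z j l} (abs-T Z bd j l))
          (≤-trans (≤-reflexive (solve 1 (λ t → (con (fromℕ 4) :* t) :* (con (fromℕ 4) :* t) := (con (fromℕ 16) :* t) :* t) refl (t l)))
            (≤-trans (*-monoʳ (fromℕ-nonNeg (coincidence j l)) (*-monoˡ (fromℕ-nonNeg 16) (fromℕ-mono-≤ (coincidence-bound load j l))))
              (≤-reflexive (trans (cong (λ z → (fromℕ 16 * z) * t l) (fromℕ-* 6 M)) (solve 2 (λ m t → (con (fromℕ 16) :* (con (fromℕ 6) :* m)) :* t := (con (fromℕ 96) :* m) :* t) refl Mℚ (t l))))))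
        total : sum (λ l → (fromℕ 96 * Mℚ) * t l) ≡ fromℕ 192 * (Mℚ * c j)
        total = trans (sym (*-distribˡ-sum (fromℕ 96 * Mℚ) t))
          (trans (cong ((fromℕ 96 * Mℚ) *_) (trans (sym (fromℕ-sum (coincidence j))) (trans (cong fromℕ (coincidence-sum j)) (fromℕ-* 2 (activeCount j)))))
            (solve 2 (λ m c → (con (fromℕ 96) :* m) :* (con (fromℕ 2) :* c) := con (fromℕ 192) :* (m :* c)) refl Mℚ (c j)))

      -- Pairing with these vectors yields the real and the imaginary part of row j of F applied to
      -- a vector.
      f-re f-im : Fin n → Vector n
      f-re j = (λ l → ρ j * T X j l) , (λ l → - (ρ j * T Y j l))
      f-im j = (λ l → ρ j * T Y j l) , (λ l → ρ j * T X j l)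

      S : Fin n → ℚ
      S j = ρ j * ρ j * (sum (λ l → T X j l * T X j l) + sum (λ l → T Y j l * T Y j l))

      f-re-norm : ∀ j → ⟨ f-re j , f-re j ⟩ ≡ S j
      f-re-norm j = trans (sum-cong (λ l → solve 3 (λ r x y → (r :* x) :* (r :* x) :+ (:- (r :* y)) :* (:- (r :* y)) := (r :* r) :* (x :* x :+ y :* y)) refl (ρ j) (T X j l) (T Y j l)))
        (trans (sym (*-distribˡ-sum (ρ j * ρ j) (λ l → T X j l * T X j l + T Y j l * T Y j l))) (cong (ρ j * ρ j *_) (∑-distrib-+ (λ l → T X j l * T X j l) (λ l → T Y j l * T Y j l))))

      f-im-norm : ∀ j → ⟨ f-im j , f-im j ⟩ ≡ S j
      f-im-norm j = trans (sum-cong (λ l → solve 3 (λ r x y → (r :* y) :* (r :* y) :+ (r :* x) :* (r :* x) := (r :* r) :* (x :* x :+ y :* y)) refl (ρ j) (T X j l) (T Y j l)))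
        (trans (sym (*-distribˡ-sum (ρ j * ρ j) (λ l → T X j l * T X j l + T Y j l * T Y j l))) (cong (ρ j * ρ j *_) (∑-distrib-+ (λ l → T X j l * T X j l) (λ l → T Y j l * T Y j l))))

      -- The factor `ρ j` enters twice: one cancels the number of active rows, the other is at most
      -- 1/κ. This is the gain from averaging.
      S-bound : ∀ j → fromℕ κ * S j ≤ fromℕ 384 * Mℚ
      S-bound j = begin
        k * (r * r * (sum (λ l → T X j l * T X j l) + sum (λ l → T Y j l * T Y j l)))
          ≤⟨ *-monoˡ (fromℕ-nonNeg κ) (*-monoˡ (square-nonNeg r) (+-mono-≤ (square-T X X-bound j) (square-T Y Y-bound j))) ⟩
        k * (r * r * (fromℕ 192 * (Mℚ * c j) + fromℕ 192 * (Mℚ * c j)))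
          ≡⟨ solve 4 (λ k r m c → k :* (r :* r :* (con (fromℕ 192) :* (m :* c) :+ con (fromℕ 192) :* (m :* c))) := (con (fromℕ 384) :* m) :* ((k :* r) :* (r :* c))) refl k r Mℚ (c j) ⟩
        (fromℕ 384 * Mℚ) * ((k * r) * (r * c j))
          ≡⟨ cong (λ z → (fromℕ 384 * Mℚ) * ((k * r) * z)) (ρc j) ⟩
        (fromℕ 384 * Mℚ) * ((k * r) * 1ℚ)
          ≤⟨ *-monoˡ (*-nonNeg (fromℕ-nonNeg 384) (fromℕ-nonNeg M)) (*-monoʳ (from-yes (0ℚ ≤? 1ℚ)) kr≤1) ⟩
        (fromℕ 384 * Mℚ) * (1ℚ * 1ℚ)
          ≡⟨ trans (cong ((fromℕ 384 * Mℚ) *_) (*-identityˡ 1ℚ)) (*-identityʳ (fromℕ 384 * Mℚ)) ⟩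
        fromℕ 384 * Mℚ ∎
        where
        open ≤-Reasoning
        k = fromℕ κ
        r = ρ j
        kr≤1 : k * r ≤ 1ℚ
        kr≤1 = subst (k * r ≤_) (trans (*-comm (c j) r) (ρc j)) (*-monoʳ (<⇒≤ (0<ρ j)) (fromℕ-mono-≤ (enough j)))

      E-re E-im : Fin n → Vector n → ℚ
      E-re j v = ∑∑ (λ r x → X j r x * proj₁ v (row r x) - Y j r x * proj₂ v (row r x))
      E-im j v = ∑∑ (λ r x → X j r x * proj₂ v (row r x) + Y j r x * proj₁ v (row r x))

      X-split : ∀ j v → ∑∑ (λ r x → X j r x * v (row r x)) ≡ c j * (1ℚ * v j) + sum (λ l → T X j l * v l)
      X-split = split X 1ℚ X-inactive X-chosen
      Y-split : ∀ j v → ∑∑ (λ r x → Y j r x * v (row r x)) ≡ c j * (0ℚ * v j) + sum (λ l → T Y j l * v l)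
      Y-split = split Y 0ℚ Y-inactive Y-chosen

      apply-f : ∀ j (A B : Fin n → ℚ) v → ⟨ ((λ l → ρ j * A l) , (λ l → ρ j * B l)) , v ⟩ ≡ ρ j * (sum (λ l → A l * proj₁ v l) + sum (λ l → B l * proj₂ v l))
      apply-f j A B v = trans (sum-cong (λ l → solve 5 (λ r a b x y → (r :* a) :* x :+ (r :* b) :* y := r :* (a :* x :+ b :* y)) refl (ρ j) (A l) (B l) (proj₁ v l) (proj₂ v l)))
        (trans (sym (*-distribˡ-sum (ρ j) (λ l → A l * proj₁ v l + B l * proj₂ v l))) (cong (ρ j *_) (∑-distrib-+ (λ l → A l * proj₁ v l) (λ l → B l * proj₂ v l))))

      -- On exact solutions of (I + F) v = 0 the matrix F acts as -1; the error of the relations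
      -- enters with the factor `ρ j`, which is at most 1.
      f-re-apply : ∀ j v → ⟨ f-re j , v ⟩ ≡ ρ j * E-re j v - proj₁ v j
      f-re-apply j v = begin
        ⟨ f-re j , v ⟩
          ≡⟨ sum-cong (λ l → cong (λ z → (ρ j * T X j l) * proj₁ v l + z * proj₂ v l) (neg-distribʳ-* (ρ j) (T Y j l))) ⟩
        ⟨ ((λ l → ρ j * T X j l) , (λ l → ρ j * - T Y j l)) , v ⟩
          ≡⟨ apply-f j (T X j) (λ l → - T Y j l) v ⟩
        ρ j * (a + sum (λ l → - T Y j l * proj₂ v l))
          ≡⟨ cong (λ z → ρ j * (a + z)) (trans (sum-cong (λ l → solve 2 (λ t w → (:- t) :* w := con (- 1ℚ) :* (t :* w)) refl (T Y j l) (proj₂ v l))) (sym (*-distribˡ-sum (- 1ℚ) (λ l → T Y j l * proj₂ v l)))) ⟩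
        ρ j * (a + (- 1ℚ) * b)
          ≡⟨ solve 5 (λ r c a b x → r :* (a :+ con (- 1ℚ) :* b) := r :* ((c :* (con 1ℚ :* x) :+ a) :- (c :* (con 0ℚ :* con 0ℚ) :+ b)) :- (r :* c) :* x) refl (ρ j) (c j) a b (proj₁ v j) ⟩
        ρ j * ((c j * (1ℚ * proj₁ v j) + a) - (c j * (0ℚ * 0ℚ) + b)) - (ρ j * c j) * proj₁ v j
          ≡⟨ cong₂ (λ s t → ρ j * s - t) (sym E-eq) (trans (cong (_* proj₁ v j) (ρc j)) (*-identityˡ (proj₁ v j))) ⟩
        ρ j * E-re j v - proj₁ v j ∎
        where
        open ≡-Reasoning
        a = sum (λ l → T X j l * proj₁ v l)
        b = sum (λ l → T Y j l * proj₂ v l)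
        E-eq : E-re j v ≡ (c j * (1ℚ * proj₁ v j) + a) - (c j * (0ℚ * 0ℚ) + b)
        E-eq = begin
          E-re j v
            ≡⟨ ∑∑-cong (λ r x → cong (X j r x * proj₁ v (row r x) +_) (solve 2 (λ t w → :- (t :* w) := con (- 1ℚ) :* (t :* w)) refl (Y j r x) (proj₂ v (row r x)))) ⟩
          ∑∑ (λ r x → X j r x * proj₁ v (row r x) + (- 1ℚ) * (Y j r x * proj₂ v (row r x)))
            ≡⟨ ∑∑-+ (λ r x → X j r x * proj₁ v (row r x)) (λ r x → (- 1ℚ) * (Y j r x * proj₂ v (row r x))) ⟩
          ∑∑ (λ r x → X j r x * proj₁ v (row r x)) + ∑∑ (λ r x → (- 1ℚ) * (Y j r x * proj₂ v (row r x)))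
            ≡⟨ cong₂ _+_ (X-split j (proj₁ v)) (trans (sym (∑∑-distribˡ (- 1ℚ) (λ r x → Y j r x * proj₂ v (row r x)))) (cong ((- 1ℚ) *_) (Y-split j (proj₂ v)))) ⟩
          (c j * (1ℚ * proj₁ v j) + a) + (- 1ℚ) * (c j * (0ℚ * proj₂ v j) + b)
            ≡⟨ solve 4 (λ s c w b → s :+ con (- 1ℚ) :* (c :* (con 0ℚ :* w) :+ b) := s :- (c :* (con 0ℚ :* con 0ℚ) :+ b)) refl (c j * (1ℚ * proj₁ v j) + a) (c j) (proj₂ v j) b ⟩
          (c j * (1ℚ * proj₁ v j) + a) - (c j * (0ℚ * 0ℚ) + b) ∎

      f-im-apply : ∀ j v → ⟨ f-im j , v ⟩ ≡ ρ j * E-im j v - proj₂ v j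
      f-im-apply j v = begin
        ⟨ f-im j , v ⟩        ≡⟨ apply-f j (T Y j) (T X j) v ⟩
        ρ j * (b + a)
          ≡⟨ solve 5 (λ r c a b x → r :* (b :+ a) := r :* ((c :* (con 1ℚ :* x) :+ a) :+ (c :* (con 0ℚ :* con 0ℚ) :+ b)) :- (r :* c) :* x) refl (ρ j) (c j) a b (proj₂ v j) ⟩
        ρ j * ((c j * (1ℚ * proj₂ v j) + a) + (c j * (0ℚ * 0ℚ) + b)) - (ρ j * c j) * proj₂ v j
          ≡⟨ cong₂ (λ s t → ρ j * s - t) (sym E-eq) (trans (cong (_* proj₂ v j) (ρc j)) (*-identityˡ (proj₂ v j))) ⟩
        ρ j * E-im j v - proj₂ v j ∎
        where
        open ≡-Reasoning
        a = sum (λ l → T X j l * proj₂ v l)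
        b = sum (λ l → T Y j l * proj₁ v l)
        E-eq : E-im j v ≡ (c j * (1ℚ * proj₂ v j) + a) + (c j * (0ℚ * 0ℚ) + b)
        E-eq = trans (∑∑-+ (λ r x → X j r x * proj₂ v (row r x)) (λ r x → Y j r x * proj₁ v (row r x)))
          (cong₂ _+_ (X-split j (proj₂ v)) (trans (Y-split j (proj₁ v)) (solve 3 (λ c w b → c :* (con 0ℚ :* w) :+ b := c :* (con 0ℚ :* con 0ℚ) :+ b) refl (c j) (proj₁ v j) b)))

      f : Fin (n ℕ.+ n) → Vector n
      f k = [ f-re , f-im ]′ (splitAt n k)

      sum-f : (G : Vector n → ℚ) → sum (λ k → G (f k)) ≡ sum (λ j → G (f-re j)) + sum (λ j → G (f-im j))
      sum-f G = trans (sum-cong (λ k → cases (splitAt n k))) (sum-split n (λ j → G (f-re j)) (λ j → G (f-im j)))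
        where
        cases : ∀ s → G ([ f-re , f-im ]′ s) ≡ [ (λ j → G (f-re j)) , (λ j → G (f-im j)) ]′ s
        cases (inj₁ _) = refl
        cases (inj₂ _) = refl

      module _ (α : Fin p → ℚ) where

        v : Vector n
        v = comb α u

        A : ℚ
        A = sum (λ q → α q * α q)

        E-re-linear : ∀ j → E-re j v ≡ sum (λ q → α q * E-re j (u q))
        E-re-linear j = sym (trans (sum-cong (λ q → ∑∑-distribˡ (α q) (λ r x → X j r x * proj₁ (u q) (row r x) - Y j r x * proj₂ (u q) (row r x))))
          (trans (∑∑-comm (λ q r x → α q * (X j r x * proj₁ (u q) (row r x) - Y j r x * proj₂ (u q) (row r x))))
            (∑∑-cong (λ r x → trans (sum-cong (λ q → solve 5 (λ a x z y w → a :* (x :* z :- y :* w) := x :* (a :* z) :+ (:- y) :* (a :* w)) refl (α q) (X j r x) (proj₁ (u q) (row r x)) (Y j r x) (proj₂ (u q) (row r x))))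
              (trans (∑-distrib-+ (λ q → X j r x * (α q * proj₁ (u q) (row r x))) (λ q → (- Y j r x) * (α q * proj₂ (u q) (row r x))))
                (cong₂ _+_ (trans (sym (*-distribˡ-sum (X j r x) (λ q → α q * proj₁ (u q) (row r x)))) (cong (X j r x *_) (sym (comb-re α u (row r x)))))
                  (trans (sym (*-distribˡ-sum (- Y j r x) (λ q → α q * proj₂ (u q) (row r x)))) (trans (cong ((- Y j r x) *_) (sym (comb-im α u (row r x)))) (sym (neg-distribˡ-* (Y j r x) (proj₂ v (row r x))))))))))))

        E-im-linear : ∀ j → E-im j v ≡ sum (λ q → α q * E-im j (u q))
        E-im-linear j = sym (trans (sum-cong (λ q → ∑∑-distribˡ (α q) (λ r x → X j r x * proj₂ (u q) (row r x) + Y j r x * proj₁ (u q) (row r x))))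
          (trans (∑∑-comm (λ q r x → α q * (X j r x * proj₂ (u q) (row r x) + Y j r x * proj₁ (u q) (row r x))))
            (∑∑-cong (λ r x → trans (sum-cong (λ q → solve 5 (λ a x z y w → a :* (x :* z :+ y :* w) := x :* (a :* z) :+ y :* (a :* w)) refl (α q) (X j r x) (proj₂ (u q) (row r x)) (Y j r x) (proj₁ (u q) (row r x))))
              (trans (∑-distrib-+ (λ q → X j r x * (α q * proj₂ (u q) (row r x))) (λ q → Y j r x * (α q * proj₁ (u q) (row r x))))
                (cong₂ _+_ (trans (sym (*-distribˡ-sum (X j r x) (λ q → α q * proj₂ (u q) (row r x)))) (cong (X j r x *_) (sym (comb-im α u (row r x)))))
                  (trans (sym (*-distribˡ-sum (Y j r x) (λ q → α q * proj₁ (u q) (row r x)))) (cong (Y j r x *_) (sym (comb-re α u (row r x)))))))))))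

        w : ℚ
        w = (2ℚ ^ℚ p) * (η * η)

        small-square : ∀ (E : Fin p → ℚ) → (∀ q → ∣ E q ∣ ≤ η) → sum (λ q → α q * E q) * sum (λ q → α q * E q) ≤ w * A
        small-square E h = ≤-trans (square-sum (λ q → α q * E q))
          (≤-trans (*-monoˡ (^-nonNeg p (from-yes (0ℚ ≤? 2ℚ))) (sum-mono (λ q → ≤-trans (≤-reflexive (solve 2 (λ a e → (a :* e) :* (a :* e) := (e :* e) :* (a :* a)) refl (α q) (E q)))
              (*-monoʳ (square-nonNeg (α q)) (square-mono {E q} (h q))))))
            (≤-reflexive (trans (cong ((2ℚ ^ℚ p) *_) (sym (*-distribˡ-sum (η * η) (λ q → α q * α q)))) (sym (*-assoc (2ℚ ^ℚ p) (η * η) A)))))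

        -- x is the difference of re and re - x, and (a - b)² ≤ 2a² + 2b².
        half-square : ∀ {r e x W} → 0ℚ ≤ r → r ≤ 1ℚ → e * e ≤ W → ½ * (x * x) ≤ (r * e - x) * (r * e - x) + W
        half-square {r} {e} {x} {W} 0≤r r≤1 e²≤W = ≤-trans (≤-by-gap (½ * ((2ℚ * (r * e) - x) * (2ℚ * (r * e) - x))) (*-nonNeg (from-yes (0ℚ ≤? ½)) (square-nonNeg (2ℚ * (r * e) - x))) (lem r e x))
            (+-monoʳ-≤ ((r * e - x) * (r * e - x)) (≤-trans re²≤ e²≤W))
          where
          lem : ∀ r e x → ½ * (x * x) + ½ * ((2ℚ * (r * e) - x) * (2ℚ * (r * e) - x)) ≡ (r * e - x) * (r * e - x) + (r * r) * (e * e)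
          lem = solve 3 (λ r e x → con ½ :* (x :* x) :+ con ½ :* ((con 2ℚ :* (r :* e) :- x) :* (con 2ℚ :* (r :* e) :- x)) := (r :* e :- x) :* (r :* e :- x) :+ (r :* r) :* (e :* e)) refl
          re²≤ : (r * r) * (e * e) ≤ e * e
          re²≤ = subst ((r * r) * (e * e) ≤_) (*-identityˡ (e * e)) (*-monoʳ (square-nonNeg e) (subst (r * r ≤_) (*-identityˡ 1ℚ) (*-mono 0≤r r≤1 0≤r r≤1)))

        δ-injective-sum : ∀ {k} (g : Fin k → Fin n) → (∀ {q q′} → g q ≡ g q′ → q ≡ q′) → ∀ j → ℕΣ.sum (λ q → δ (g q) j) ℕ.≤ 1
        δ-injective-sum {zero} g inj j = ℕ.z≤n
        δ-injective-sum {suc k} g inj j = cases (g zero FP.≟ j)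
          where
          cases : Dec (g zero ≡ j) → δ (g zero) j ℕ.+ ℕΣ.sum (λ q → δ (g (suc q)) j) ℕ.≤ 1
          cases (yes e) = ℕP.≤-reflexive (cong₂ ℕ._+_ (trans (cong (λ i → δ i j) e) (ℕΣ.δ-refl j))
            (trans (ℕΣ.sum-cong (λ q → ℕΣ.δ-≢ {i = g (suc q)} {j} (λ e′ → case-≢ (inj (trans e (sym e′)))))) (trans (ℕΣ.sum-const k 0) (ℕP.*-zeroʳ k))))
            where
            case-≢ : ∀ {q : Fin k} → ¬ (zero ≡ suc q)
            case-≢ ()
          cases (no h) = subst (ℕ._≤ 1) (cong (ℕ._+ ℕΣ.sum (λ q → δ (g (suc q)) j)) (sym (ℕΣ.δ-≢ h)))
            (δ-injective-sum (λ q → g (suc q)) (λ e → FP.suc-injective (inj e)) j)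

        at-pivot : ∀ q → proj₁ v (pivot q) ≡ α q
        at-pivot q = trans (comb-re α u (pivot q)) (trans (sum-cong term) (δℚ-sum q α))
          where
          term : ∀ q′ → α q′ * proj₁ (u q′) (pivot q) ≡ δℚ q q′ * α q′
          term q′ = cases (q FP.≟ q′)
            where
            cases : Dec (q ≡ q′) → α q′ * proj₁ (u q′) (pivot q) ≡ δℚ q q′ * α q′
            cases (yes refl) = trans (cong (α q *_) (own q)) (trans (*-comm (α q) 1ℚ) (cong (λ t → fromℕ t * α q) (sym (ℕΣ.δ-refl q))))
            cases (no h) = trans (cong (α q′ *_) (other q′ q (λ e → h (sym e)))) (trans (*-comm (α q′) 0ℚ) (cong (λ t → fromℕ t * α q′) (sym (ℕΣ.δ-≢ h))))

        -- The real parts of v at the pivots are the coefficients α, and distinct pivots occupy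
        -- distinct terms of the norm.
        nondegenerate : A ≤ ⟨ v , v ⟩
        nondegenerate = begin
          A                                                              ≡⟨ sum-cong (λ q → trans (cong₂ _*_ (sym (at-pivot q)) (sym (at-pivot q))) (sym (δℚ-sum (pivot q) (λ j → proj₁ v j * proj₁ v j)))) ⟩
          sum (λ q → sum (λ j → δℚ (pivot q) j * (proj₁ v j * proj₁ v j)))   ≡⟨ ∑-comm (λ q j → δℚ (pivot q) j * (proj₁ v j * proj₁ v j)) ⟩
          sum (λ j → sum (λ q → δℚ (pivot q) j * (proj₁ v j * proj₁ v j)))   ≤⟨ sum-mono (λ j → ≤-trans (≤-reflexive (trans (sym (*-distribʳ-sum (proj₁ v j * proj₁ v j) (λ q → δℚ (pivot q) j))) (cong (_* (proj₁ v j * proj₁ v j)) (sym (fromℕ-sum (λ q → δ (pivot q) j))))))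
                                                                              (≤-trans (*-monoʳ (square-nonNeg (proj₁ v j)) (fromℕ-mono-≤ (δ-injective-sum pivot pivot-injective j)))
                                                                                (≤-by-gap (proj₂ v j * proj₂ v j) (square-nonNeg (proj₂ v j)) (cong (_+ proj₂ v j * proj₂ v j) (*-identityˡ (proj₁ v j * proj₁ v j)))))) ⟩
          ⟨ v , v ⟩ ∎
          where open ≤-Reasoning

        ¼ : ℚ
        ¼ = ½ * ½

        -- Half of the norm survives the pointwise estimates, and η is so small that half of this
        -- pays for the total error.
        seen : ¼ * ⟨ v , v ⟩ ≤ sum (λ k → ⟨ f k , v ⟩ * ⟨ f k , v ⟩)
        seen = ≤-trans (≤-by-difference {¼ * B} {G} total (lem B G (fromℕ n * (2ℚ * w * A)))) (≤-reflexive (sym G-eq))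
          where
          B = ⟨ v , v ⟩
          g h : Fin n → ℚ
          g j = (ρ j * E-re j v - proj₁ v j) * (ρ j * E-re j v - proj₁ v j)
          h j = (ρ j * E-im j v - proj₂ v j) * (ρ j * E-im j v - proj₂ v j)
          G = sum g + sum h
          G-eq : sum (λ k → ⟨ f k , v ⟩ * ⟨ f k , v ⟩) ≡ G
          G-eq = trans (sum-f (λ z → ⟨ z , v ⟩ * ⟨ z , v ⟩))
            (cong₂ _+_ (sum-cong (λ j → cong₂ _*_ (f-re-apply j v) (f-re-apply j v))) (sum-cong (λ j → cong₂ _*_ (f-im-apply j v) (f-im-apply j v))))
          pointwise : ∀ j → ½ * (proj₁ v j * proj₁ v j + proj₂ v j * proj₂ v j) ≤ (g j + h j) + 2ℚ * w * A
          pointwise j = ≤-trans (≤-reflexive (*-distribˡ-+ ½ (proj₁ v j * proj₁ v j) (proj₂ v j * proj₂ v j)))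
            (≤-trans (+-mono-≤
                (half-square {ρ j} {E-re j v} (<⇒≤ (0<ρ j)) (ρ≤1 j) (subst (λ z → z * z ≤ w * A) (sym (E-re-linear j)) (small-square (λ q → E-re j (u q)) (error-re j))))
                (half-square {ρ j} {E-im j v} (<⇒≤ (0<ρ j)) (ρ≤1 j) (subst (λ z → z * z ≤ w * A) (sym (E-im-linear j)) (small-square (λ q → E-im j (u q)) (error-im j)))))
              (≤-reflexive (trans (solve 3 (λ a b c → (a :+ c) :+ (b :+ c) := (a :+ b) :+ con 2ℚ :* c) refl (g j) (h j) (w * A)) (cong (g j + h j +_) (sym (*-assoc 2ℚ w A))))))
          summed : ½ * B ≤ G + fromℕ n * (2ℚ * w * A)
          summed = subst₂ _≤_ (sym (*-distribˡ-sum ½ (λ j → proj₁ v j * proj₁ v j + proj₂ v j * proj₂ v j)))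
            (trans (∑-distrib-+ (λ j → g j + h j) (λ _ → 2ℚ * w * A)) (cong₂ _+_ (∑-distrib-+ g h) (sum-const n (2ℚ * w * A)))) (sum-mono pointwise)
          0≤A : 0ℚ ≤ A
          0≤A = sum-nonNeg (λ q → square-nonNeg (α q))
          error≤ : fromℕ n * (2ℚ * w * A) ≤ ¼ * B
          error≤ = ≤-trans (≤-reflexive (solve 3 (λ n w a → n :* (con 2ℚ :* w :* a) := (n :* (con (fromℕ 8) :* w)) :* (con (½ * ½) :* a)) refl (fromℕ n) w A))
            (≤-trans (*-monoʳ (*-nonNeg (from-yes (0ℚ ≤? ½ * ½)) 0≤A) η-small) (≤-trans (≤-reflexive (*-identityˡ (¼ * A))) (*-monoˡ (from-yes (0ℚ ≤? ½ * ½)) nondegenerate)))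
          total : ½ * B + fromℕ n * (2ℚ * w * A) ≤ (G + fromℕ n * (2ℚ * w * A)) + ¼ * B
          total = +-mono-≤ summed error≤
          lem : ∀ B G e → G - ¼ * B ≡ ((G + e) + ¼ * B) - (½ * B + e)
          lem = solve 3 (λ B G e → G :- con (½ * ½) :* B := ((G :+ e) :+ con (½ * ½) :* B) :- (con ½ :* B :+ e)) refl

      -- 3072 = 4 · 2 · 384: the 4 undoes the factor `¼` of `seen`, the 2 counts real and imaginary
      -- rows, and 384 is twice the constant of `square-T`.
      rank-bound : κ ℕ.* p ℕ.≤ 3072 ℕ.* (M ℕ.* n)
      rank-bound = fromℕ-cancel-≤ (subst₂ _≤_ (sym (fromℕ-* κ p)) eq (begin
        fromℕ κ * fromℕ p                                     ≡⟨ solve 2 (λ k p → k :* p := con (fromℕ 4) :* (k :* (p :* con (½ * ½)))) refl (fromℕ κ) (fromℕ p) ⟩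
        fromℕ 4 * (fromℕ κ * (fromℕ p * (½ * ½)))             ≤⟨ *-monoˡ (fromℕ-nonNeg 4) (*-monoˡ (fromℕ-nonNeg κ) dimension) ⟩
        fromℕ 4 * (fromℕ κ * sum (λ k → ⟨ f k , f k ⟩))       ≡⟨ cong (λ z → fromℕ 4 * (fromℕ κ * z)) (trans (sum-f (λ z → ⟨ z , z ⟩)) (cong₂ _+_ (sum-cong f-re-norm) (sum-cong f-im-norm))) ⟩
        fromℕ 4 * (fromℕ κ * (sum S + sum S))                 ≡⟨ solve 2 (λ k s → con (fromℕ 4) :* (k :* (s :+ s)) := con (fromℕ 8) :* (k :* s)) refl (fromℕ κ) (sum S) ⟩
        fromℕ 8 * (fromℕ κ * sum S)                           ≡⟨ cong (fromℕ 8 *_) (*-distribˡ-sum (fromℕ κ) S) ⟩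
        fromℕ 8 * sum (λ j → fromℕ κ * S j)                   ≤⟨ *-monoˡ (fromℕ-nonNeg 8) (sum-mono S-bound) ⟩
        fromℕ 8 * sum {n} (λ j → fromℕ 384 * Mℚ)              ≡⟨ cong (fromℕ 8 *_) (sum-const n (fromℕ 384 * Mℚ)) ⟩
        fromℕ 8 * (fromℕ n * (fromℕ 384 * Mℚ))                ≡⟨ solve 2 (λ n m → con (fromℕ 8) :* (n :* (con (fromℕ 384) :* m)) := con (fromℕ 3072) :* (m :* n)) refl (fromℕ n) Mℚ ⟩
        fromℕ 3072 * (Mℚ * fromℕ n) ∎))
        where
        open ≤-Reasoning
        eq : fromℕ 3072 * (Mℚ * fromℕ n) ≡ fromℕ (3072 ℕ.* (M ℕ.* n))
        eq = sym (trans (fromℕ-* 3072 (M ℕ.* n)) (cong (fromℕ 3072 *_) (fromℕ-* M n)))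
        dimension : fromℕ p * (½ * ½) ≤ sum (λ k → ⟨ f k , f k ⟩)
        dimension = dimension-bound ⟨⟩-comm ⟨⟩-nonNeg ⟨⟩-zero ⟨⟩-add ⟨⟩-scale u f (from-yes (0ℚ ≤? ½ * ½)) nondegenerate seen

-- Rank bound for systems of three-term relations over the field.

module DesignRank (K : ACF₀) where
  open ACF₀ K
  open RationalEmbedding K
  open RationalLemmas
  open Norms K
  open Approximation K
  open GaussianApproximation K
  open PivotElimination K
  open Scaling K
  open NumericalRank hiding (module ℕΣ)
  module ℕΣ = NaturalSums
  module ℚΣ = RationalSums
  open NaturalSums using (δ)
  open PreNorm
  open import Data.Nat.Base as ℕ using (ℕ; zero; suc)
  import Data.Nat.Properties as ℕP
  open import Data.Fin.Base using (Fin; zero; suc)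
  import Data.Fin.Properties as FP
  open import Data.Rational.Base as ℚ using (ℚ; 0ℚ; 1ℚ; ½)
  import Data.Rational.Properties as ℚP
  open import Data.Rational.Solver using () renaming (module +-*-Solver to ℚSolver)
  open import Data.Product using (∃-syntax; _×_; _,_; proj₁; proj₂)
  open import Data.Empty using (⊥; ⊥-elim)
  open import Function.Base using (id)
  open import Relation.Nullary using (¬_; Dec; yes; no)
  open import Relation.Nullary.Decidable using (from-yes; decidable-stable)
  open import Relation.Binary.PropositionalEquality as ≡ using (_≡_; _≢_)
  open import Relation.Binary.Reasoning.Setoid setoid
  open import Algebra.Properties.Semiring.Sum semiring using (sum; ∑-distrib-+) renaming (sum-cong-≋ to sum-cong)

  sum-zero : ∀ {n} {f : Fin n → Carrier} → (∀ i → f i ≈ 0#) → sum f ≈ 0#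
  sum-zero {zero} e = refl
  sum-zero {suc n} e = trans (+-cong (e zero) (sum-zero (λ i → e (suc i)))) (+-identityˡ 0#)

  embed-sum : ∀ {n} (f g : Fin n → ℚ) → embed (ℚΣ.sum f , ℚΣ.sum g) ≈ sum (λ i → embed (f i , g i))
  embed-sum {zero} f g = embed-origin
  embed-sum {suc n} f g = trans (embed-⊕ (f zero , g zero) (ℚΣ.sum (λ i → f (suc i)) , ℚΣ.sum (λ i → g (suc i)))) (+-congˡ (embed-sum (λ i → f (suc i)) (λ i → g (suc i))))

  N-sum : ∀ Q {n b} {f : Fin n → Carrier} → (∀ i → N Q (f i) b) → N Q (sum f) (fromℕ n ℚ.* b)
  N-sum Q {zero} {b} h = ≡.subst (N Q 0#) (≡.sym (ℚP.*-zeroˡ b)) (zeroN Q)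
  N-sum Q {suc n} {b} h = ≡.subst (N Q _) eq (add Q (h zero) (N-sum Q (λ i → h (suc i))))
    where
    eq : b ℚ.+ fromℕ n ℚ.* b ≡ fromℕ (suc n) ℚ.* b
    eq = ≡.trans (≡.cong (ℚ._+ fromℕ n ℚ.* b) (≡.sym (ℚP.*-identityˡ b))) (≡.trans (≡.sym (ℚP.*-distribʳ-+ b 1ℚ (fromℕ n))) (≡.cong (ℚ._* b) (≡.sym (fromℕ-+ 1 n))))

  uniform-bound : ∀ {n} (f : Fin n → ℚ) → ∃[ b ] (0ℚ ℚ.≤ b × ∀ i → f i ℚ.≤ b)
  uniform-bound {zero} f = 0ℚ , ℚP.≤-refl , λ ()
  uniform-bound {suc n} f = extend (uniform-bound (λ i → f (suc i)))
    where
    extend : ∃[ b ] (0ℚ ℚ.≤ b × ∀ i → f (suc i) ℚ.≤ b) → ∃[ b ] (0ℚ ℚ.≤ b × ∀ i → f i ℚ.≤ b)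
    extend (b , 0≤b , h) = f zero ℚ.⊔ b , ℚP.≤-trans 0≤b (ℚP.p≤q⊔p (f zero) b) ,
      λ { zero → ℚP.p≤p⊔q (f zero) b ; (suc i) → ℚP.≤-trans (h i) (ℚP.p≤q⊔p (f zero) b) }

  small-multiple : ∀ {c t} → 0ℚ ℚ.≤ c → 0ℚ ℚ.< t → ∃[ e ] (0ℚ ℚ.< e × e ℚ.≤ 1ℚ × c ℚ.* e ℚ.≤ t)
  small-multiple {c} {t} 0≤c 0<t = t′ ℚ.* d , *-pos 0<t′ 0<d ,
      ℚP.≤-trans (*-mono (ℚP.<⇒≤ 0<t′) (ℚP.p⊓q≤q t 1ℚ) (ℚP.<⇒≤ 0<d) d≤1) (ℚP.≤-reflexive (ℚP.*-identityˡ 1ℚ)) ,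
      ℚP.≤-trans (ℚP.≤-reflexive (ℚSolver.solve 3 (λ c t d → c ℚSolver.:* (t ℚSolver.:* d) ℚSolver.:= t ℚSolver.:* (d ℚSolver.:* c)) ≡.refl c t′ d))
        (ℚP.≤-trans (*-monoˡ (ℚP.<⇒≤ 0<t′) dc≤1) (ℚP.≤-trans (ℚP.≤-reflexive (ℚP.*-identityʳ t′)) (ℚP.p⊓q≤p t 1ℚ)))
    where
    c′ = c ℚ.+ 1ℚ
    1≤c′ : 1ℚ ℚ.≤ c′
    1≤c′ = ≤-by-gap c 0≤c (ℚP.+-comm 1ℚ c)
    0<c′ : 0ℚ ℚ.< c′
    0<c′ = ℚP.<-≤-trans (from-yes (0ℚ ℚP.<? 1ℚ)) 1≤c′
    instance
      c′+ : ℚ.Positive c′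
      c′+ = ℚ.positive 0<c′
      c′≢0 : ℚ.NonZero c′
      c′≢0 = ℚP.pos⇒nonZero c′
    d = ℚ.1/ c′
    0<d : 0ℚ ℚ.< d
    0<d = ℚP.positive⁻¹ d {{ℚP.1/pos⇒pos c′}}
    d≤1 : d ℚ.≤ 1ℚ
    d≤1 = ≡.subst₂ ℚ._≤_ (ℚP.*-identityʳ d) (ℚP.*-inverseˡ c′) (*-monoˡ (ℚP.<⇒≤ 0<d) 1≤c′)
    dc≤1 : d ℚ.* c ℚ.≤ 1ℚ
    dc≤1 = ≡.subst (d ℚ.* c ℚ.≤_) (ℚP.*-inverseˡ c′) (*-monoˡ (ℚP.<⇒≤ 0<d) (≤-by-gap 1ℚ (from-yes (0ℚ ℚP.≤? 1ℚ)) ≡.refl))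
    t′ = t ℚ.⊓ 1ℚ
    0<t′ : 0ℚ ℚ.< t′
    0<t′ = min-pos (ℚP.⊓-sel t 1ℚ)
      where
      open import Data.Sum using (_⊎_; inj₁; inj₂)
      min-pos : t ℚ.⊓ 1ℚ ≡ t ⊎ t ℚ.⊓ 1ℚ ≡ 1ℚ → 0ℚ ℚ.< t ℚ.⊓ 1ℚ
      min-pos (inj₁ e) = ≡.subst (0ℚ ℚ.<_) (≡.sym e) 0<t
      min-pos (inj₂ e) = ≡.subst (0ℚ ℚ.<_) (≡.sym e) (from-yes (0ℚ ℚP.<? 1ℚ))

  unit : ℚ[i]
  unit = 1ℚ , 0ℚ

  embed-unit : embed unit ≈ 1#
  embed-unit = trans (+-cong ι-1 (trans (*-congˡ ι-0) (zeroʳ 𝕚))) (+-identityʳ 1#)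

  exact : ∀ Q z {x ε} → 0ℚ ℚ.≤ ε → x ≈ embed z → N Q (x - embed z) ε
  exact Q z 0≤ε e = weaken Q 0≤ε (resp Q (sym (trans (+-congʳ e) (-‿inverseʳ _))) (zeroN Q))

  module _ {n R : ℕ} (row : Fin R → Fin 3 → Fin n) (a a⁻¹ : Fin R → Fin 3 → Carrier) (aa⁻¹≈1 : ∀ r x → a r x * a⁻¹ r x ≈ 1#)
           (U : Subspace n) (relation : ∀ {g} → member U g → ∀ r → sum (λ x → a r x * g (row r x)) ≈ 0#)
           {M κ : ℕ} (load : ∀ j l x x′ → x ≢ x′ → ℕΣ.sum (λ r → δ (row r x) j ℕ.* δ (row r x′) l) ℕ.≤ M)
           (1≤κ : 1 ℕ.≤ κ) (κ≤owned : ∀ j → κ ℕ.≤ owned row a a⁻¹ aa⁻¹≈1 j)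
           where

    module Scale {Q₀ : PreNorm} (S : Scaled row a a⁻¹ aa⁻¹≈1 Q₀) where
      open Scaled S public

      -- Dividing column l of the coefficients by its potential amounts to multiplying the values of
      -- the functions at l by it; this is the space of functions so obtained.
      rescale : Subspace n
      rescale = record
        { member = λ h → member U (λ l → potential⁻¹ l * h l)
        ; ≈-closed = λ e → ≈-closed U (λ l → *-congˡ (e l))
        ; +-closed = λ f g → ≈-closed U (λ l → sym (distribˡ _ _ _)) (+-closed U f g)
        ; *-closed = λ c {f} h → ≈-closed U (λ l → solve 3 (λ c p f → c :* (p :* f) := p :* (c :* f)) refl c (potential⁻¹ l) (f l)) (*-closed U c h) }
        where open KSolver

      rescale-rank : ∀ {p} → Rank≥ U p → Rank≥ rescale p
      rescale-rank w = record
        { function = λ q l → (potential l * function w q l) * potential⁻¹ (pivot w q)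
        ; ∈U = λ q → ≈-closed U (λ l → sym (trans
              (solve 4 (λ i p f c → i :* ((p :* f) :* c) := (p :* i) :* (c :* f)) refl (potential⁻¹ l) (potential l) (function w q l) (potential⁻¹ (pivot w q)))
              (trans (*-congʳ (potential-inverse l)) (*-identityˡ _)))) (*-closed U (potential⁻¹ (pivot w q)) (∈U w q))
        ; pivot = pivot w
        ; at-own = λ q → trans (*-congʳ (trans (*-congˡ (at-own w q)) (*-identityʳ _))) (potential-inverse (pivot w q))
        ; at-other = λ h → trans (*-congʳ (trans (*-congˡ (at-other w h)) (zeroʳ _))) (zeroˡ _) }
        where open KSolver

      X-sum : ∀ {h} → member rescale h → ∀ j r → row r (chosen j r) ≡ j → sum (λ x → X j r x * h (row r x)) ≈ 0#
      X-sum {h} h∈ j r e = vanish (X-relation j r e)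
        where
        open import Algebra.Properties.Semiring.Sum semiring using (*-distribˡ-sum)
        open KSolver using (solve; _:=_; _:*_)
        vanish : ∃[ d ] (∀ x → X j r x * potential (row r x) ≈ d * a r x) → sum (λ x → X j r x * h (row r x)) ≈ 0#
        vanish (d , ed) = begin
          sum (λ x → X j r x * h (row r x))                      ≈⟨ sum-cong (λ x → trans (*-congˡ (trans (sym (*-identityˡ (h (row r x)))) (*-congʳ (sym (potential-inverse (row r x))))))
                                                                      (solve 4 (λ X p i h → X :* ((p :* i) :* h) := (X :* p) :* (i :* h)) refl (X j r x) (potential (row r x)) (potential⁻¹ (row r x)) (h (row r x)))) ⟩
          sum (λ x → (X j r x * potential (row r x)) * (potential⁻¹ (row r x) * h (row r x))) ≈⟨ sum-cong (λ x → trans (*-congʳ (ed x)) (*-assoc d (a r x) (potential⁻¹ (row r x) * h (row r x)))) ⟩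
          sum (λ x → d * (a r x * (potential⁻¹ (row r x) * h (row r x))))   ≈⟨ *-distribˡ-sum d (λ x → a r x * (potential⁻¹ (row r x) * h (row r x))) ⟨
          d * sum (λ x → a r x * (potential⁻¹ (row r x) * h (row r x)))     ≈⟨ trans (*-congˡ (relation h∈ r)) (zeroʳ d) ⟩
          0# ∎

      select : ∀ {A : Set} → Dec A → Carrier → Carrier
      select (yes _) x = x
      select (no _) x = 0#

      X′ : Fin n → Fin R → Fin 3 → Carrier
      X′ j r x = select (active? row chosen j r) (X j r x)

      X′-bound : ∀ {Q} → Q₀ ⊑ Q → ∀ j r x → N Q (X′ j r x) 1ℚ
      X′-bound {Q} up j r x = cases (active? row chosen j r)
        where
        cases : (d : Dec (row r (chosen j r) ≡ j)) → N Q (select d (X j r x)) 1ℚ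
        cases (yes e) = lift up (X-bound j r e x)
        cases (no _) = weaken Q 0≤1 (zeroN Q)

      X′-sum : ∀ {h} → member rescale h → ∀ j r → sum (λ x → X′ j r x * h (row r x)) ≈ 0#
      X′-sum {h} h∈ j r = cases (active? row chosen j r)
        where
        cases : (d : Dec (row r (chosen j r) ≡ j)) → sum (λ x → select d (X j r x) * h (row r x)) ≈ 0#
        cases (yes e) = X-sum h∈ j r e
        cases (no _) = sum-zero {3} (λ x → zeroˡ (h (row r x)))

      module Approximate {p : ℕ} (c : IdentityAt rescale id p) {ε : ℚ} (0<ε : 0ℚ ℚ.< ε) where

        -- Values known to be 0 or 1 are approximated by themselves, so that the inactive rows stay
        -- zero and the diagonal of I + F is not perturbed.
        CoefficientApprox : Fin n → Fin R → Fin 3 → PreNorm → Set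
        CoefficientApprox j r x Q = ∃[ z ] (N Q (X′ j r x - embed z) ε × (¬ Active row chosen j r → z ≡ origin) × (Active row chosen j r → x ≡ chosen j r → z ≡ unit))

        EntryApprox : Fin p → Fin n → PreNorm → Set
        EntryApprox q j Q = ∃[ z ] (N Q (function c q j - embed z) ε × (∀ q′ → pivot c q′ ≡ j → (q ≡ q′ → z ≡ unit) × (q ≢ q′ → z ≡ origin)))

        pivot-injective : ∀ {q q′} → pivot c q ≡ pivot c q′ → q ≡ q′
        pivot-injective {q} {q′} e = cases (q FP.≟ q′)
          where
          cases : Dec (q ≡ q′) → q ≡ q′
          cases (yes h) = h
          cases (no h) = ⊥-elim (1≉0 (trans (sym (at-own c q)) (trans (reflexive (≡.cong (function c q) e)) (at-other c h))))

        coefficient-approx : ∀ j r x P → Q₀ ⊑ P → Proper P → N P 𝕚 1ℚ → ¬ ¬ Extension P (CoefficientApprox j r x)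
        coefficient-approx j r x P up proper n𝕚 = cases (active? row chosen j r) (x FP.≟ chosen j r) ≡.refl
          where
          0≤ε = ℚP.<⇒≤ 0<ε
          cases : (d : Dec (Active row chosen j r)) → Dec (x ≡ chosen j r) → active? row chosen j r ≡ d → ¬ ¬ Extension P (CoefficientApprox j r x)
          cases (no h) _ e k = k (P , ⊑-refl , proper , origin , exact P origin 0≤ε (trans (reflexive (≡.cong (λ d → select d (X j r x)) e)) (sym embed-origin)) ,
            (λ _ → ≡.refl) , (λ act → ⊥-elim (h act)))
          cases (yes act) (yes ≡.refl) e k = k (P , ⊑-refl , proper , unit , exact P unit 0≤ε (trans (reflexive (≡.cong (λ d → select d (X j r x)) e)) (trans (X-chosen j r act) (sym embed-unit))) ,
            (λ h → ⊥-elim (h act)) , (λ _ _ → ≡.refl))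
          cases (yes act) (no h) e k = approximation 0<ε P proper n𝕚 (X′-bound up j r x) λ { (Q , u , Q-proper , z , m) →
            k (Q , u , Q-proper , z , m , (λ h′ → ⊥-elim (h′ act)) , (λ _ h′ → ⊥-elim (h h′))) }

        entry-approx : ∀ {b} q j P → Proper P → N P 𝕚 1ℚ → N P (function c q j) b → ¬ ¬ Extension P (EntryApprox q j)
        entry-approx q j P proper n𝕚 nb = cases (FP.any? (λ q′ → pivot c q′ FP.≟ j))
          where
          0≤ε = ℚP.<⇒≤ 0<ε
          cases : Dec (∃[ q′ ] pivot c q′ ≡ j) → ¬ ¬ Extension P (EntryApprox q j)
          cases (no h) k = approximation 0<ε P proper n𝕚 nb λ { (Q , u , Q-proper , z , m) →
            k (Q , u , Q-proper , z , m , λ q′ e → ⊥-elim (h (q′ , e))) }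
          cases (yes (q₁ , ≡.refl)) = same (q FP.≟ q₁)
            where
            same : Dec (q ≡ q₁) → ¬ ¬ Extension P (EntryApprox q j)
            same (yes ≡.refl) k = k (P , ⊑-refl , proper , unit , exact P unit 0≤ε (trans (at-own c q) (sym embed-unit)) ,
              λ q′ e → (λ _ → ≡.refl) , (λ h → ⊥-elim (h (pivot-injective (≡.sym e)))))
            same (no h) k = k (P , ⊑-refl , proper , origin , exact P origin 0≤ε (trans (at-other c h) (sym embed-origin)) ,
              λ q′ e → (λ e′ → ⊥-elim (h (≡.trans e′ (pivot-injective e)))) , (λ _ → ≡.refl))

        Approximated : PreNorm → Set
        Approximated Q = (∀ j r x → CoefficientApprox j r x Q) × (∀ q j → EntryApprox q j Q)

        approximate-all : ∀ P → Q₀ ⊑ P → Proper P → N P 𝕚 1ℚ → Bounded P c → ¬ ¬ Extension P Approximated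
        approximate-all P up proper n𝕚 cb k =
          family (λ j Q → ∀ r x → CoefficientApprox j r x Q) (λ j u h r x → mono-X u (h r x)) P (λ j P₁ u₁ →
            family (λ r Q → ∀ x → CoefficientApprox j r x Q) (λ r u h x → mono-X u (h x)) P (λ r P₂ u₂ →
              family (λ x Q → CoefficientApprox j r x Q) (λ x → mono-X) P (λ x P₃ u₃ h₃ → coefficient-approx j r x P₃ (⊑-trans up u₃) h₃ (lift u₃ n𝕚)) P₂ u₂) P₁ u₁)
            P ⊑-refl proper λ { (Q , u , Q-proper , xs) →
          family (λ q Q′ → ∀ j → EntryApprox q j Q′) (λ q u h j → mono-C u (h j)) P (λ q P₁ u₁ →
            family (λ j Q′ → EntryApprox q j Q′) (λ j → mono-C) P (λ j P₂ u₂ h₂ → entry-approx q j P₂ h₂ (lift u₂ n𝕚) (lift u₂ (proj₂ (cb q j)))) P₁ u₁)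
            Q u Q-proper λ { (Q′ , u′ , Q′-proper , cs) →
          k (Q′ , ⊑-trans u u′ , Q′-proper , (λ j r x → mono-X u′ (xs j r x)) , cs) } }
          where
          mono-X : ∀ {j r x P Q} → P ⊑ Q → CoefficientApprox j r x P → CoefficientApprox j r x Q
          mono-X u (z , m , e) = z , lift u m , e
          mono-C : ∀ {q j P Q} → P ⊑ Q → EntryApprox q j P → EntryApprox q j Q
          mono-C u (z , m , e) = z , lift u m , e

        module Errors {Q : PreNorm} (up : Q₀ ⊑ Q) (proper : Proper Q) (n𝕚 : N Q 𝕚 1ℚ) (ε≤1 : ε ℚ.≤ 1ℚ)
                      {B : ℚ} (0≤B : 0ℚ ℚ.≤ B) (C-bound : ∀ q j → N Q (function c q j) B) (approx : Approximated Q) where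

          Z : Fin n → Fin R → Fin 3 → ℚ[i]
          Z j r x = proj₁ (proj₁ approx j r x)

          C : Fin p → Fin n → ℚ[i]
          C q j = proj₁ (proj₂ approx q j)

          Z-approx : ∀ j r x → N Q (X′ j r x - embed (Z j r x)) ε
          Z-approx j r x = proj₁ (proj₂ (proj₁ approx j r x))

          C-approx : ∀ q j → N Q (function c q j - embed (C q j)) ε
          C-approx q j = proj₁ (proj₂ (proj₂ approx q j))

          0≤ε : 0ℚ ℚ.≤ ε
          0≤ε = ℚP.<⇒≤ 0<ε

          open KSolver using (solve; _:=_; _:*_; _:+_; _:-_)

          Z-bound : ∀ j r x → N Q (embed (Z j r x)) (fromℕ 2)
          Z-bound j r x = weaken Q (ℚP.≤-trans (ℚP.+-monoʳ-≤ 1ℚ ε≤1) (from-yes (1ℚ ℚ.+ 1ℚ ℚP.≤? fromℕ 2)))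
            (resp Q (solve 2 (λ x z → x :- (x :- z) := z) refl (X′ j r x) (embed (Z j r x))) (subN Q (X′-bound up j r x) (Z-approx j r x)))

          -- Origin of the bound 4 in the numerical part: the norm is at most 1 + ε ≤ 2, and
          -- `embed-bound` doubles it.
          Z-components : ∀ j r x → ℚ.∣ proj₁ (Z j r x) ∣ ℚ.≤ fromℕ 4 × ℚ.∣ proj₂ (Z j r x) ∣ ℚ.≤ fromℕ 4
          Z-components j r x = let b₁ , b₂ = embed-bound Q proper n𝕚 (from-yes (0ℚ ℚP.<? fromℕ 2)) (Z-bound j r x)
                               in ℚP.≤-trans b₁ (from-yes (fromℕ 2 ℚ.+ fromℕ 2 ℚP.≤? fromℕ 4)) , ℚP.≤-trans b₂ (from-yes (fromℕ 2 ℚ.+ fromℕ 2 ℚP.≤? fromℕ 4))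

          -- zw - xc = z (w - c) + (z - x) c
          term-error : ∀ j q r x → N Q (embed (Z j r x) * embed (C q (row r x)) - X′ j r x * function c q (row r x)) (ε ℚ.* (B ℚ.+ fromℕ 2))
          term-error j q r x = ≡.subst (N Q _) (ℚSolver.solve 2 (λ e b → ℚSolver.con (fromℕ 2) ℚSolver.:* e ℚSolver.:+ e ℚSolver.:* b ℚSolver.:= e ℚSolver.:* (b ℚSolver.:+ ℚSolver.con (fromℕ 2))) ≡.refl ε B)
            (resp Q (solve 4 (λ x z c w → (z :* (w :- c)) :+ (z :- x) :* c := z :* w :- x :* c) refl (X′ j r x) (embed (Z j r x)) (function c q (row r x)) (embed (C q (row r x))))
              (add Q (mul Q (Z-bound j r x) (flip (C-approx q (row r x)))) (mul Q (flip (Z-approx j r x)) (C-bound q (row r x)))))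
            where
            flip : ∀ {a b e} → N Q (a - b) e → N Q (b - a) e
            flip {a} {b} m = resp Q (solve 2 (λ a b → KSolver.:- (a :- b) := b :- a) refl a b) (negN Q m)

          E : Fin n → Fin p → ℚ[i]
          E j q = ∑∑ (λ r x → proj₁ (Z j r x) ℚ.* proj₁ (C q (row r x)) ℚ.- proj₂ (Z j r x) ℚ.* proj₂ (C q (row r x)))
                , ∑∑ (λ r x → proj₁ (Z j r x) ℚ.* proj₂ (C q (row r x)) ℚ.+ proj₂ (Z j r x) ℚ.* proj₁ (C q (row r x)))

          -- Over each row the exact products add up to 0, so they may be subtracted; only a sum of
          -- small errors is left.
          embed-E : ∀ j q → embed (E j q) ≈ sum (λ r → sum (λ x → embed (Z j r x) * embed (C q (row r x)) - X′ j r x * function c q (row r x)))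
          embed-E j q = begin
            embed (E j q)   ≈⟨ embed-sum (λ r → ℚΣ.sum (λ x → re r x)) (λ r → ℚΣ.sum (λ x → im r x)) ⟩
            sum (λ r → embed (ℚΣ.sum (λ x → re r x) , ℚΣ.sum (λ x → im r x)))   ≈⟨ sum-cong (λ r → embed-sum (λ x → re r x) (λ x → im r x)) ⟩
            sum (λ r → sum (λ x → embed (Z j r x ⊗ C q (row r x))))             ≈⟨ sum-cong row-eq ⟩
            sum (λ r → sum (λ x → embed (Z j r x) * embed (C q (row r x)) - X′ j r x * function c q (row r x))) ∎
            where
            re im : Fin R → Fin 3 → ℚ
            re r x = proj₁ (Z j r x ⊗ C q (row r x))
            im r x = proj₂ (Z j r x ⊗ C q (row r x))
            row-eq : ∀ r → sum (λ x → embed (Z j r x ⊗ C q (row r x))) ≈ sum (λ x → embed (Z j r x) * embed (C q (row r x)) - X′ j r x * function c q (row r x))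
            row-eq r = begin
              sum (λ x → embed (Z j r x ⊗ C q (row r x)))
                ≈⟨ sum-cong (λ x → trans (embed-⊗ (Z j r x) (C q (row r x))) (solve 2 (λ a b → a := (a :- b) :+ b) refl (embed (Z j r x) * embed (C q (row r x))) (X′ j r x * function c q (row r x)))) ⟩
              sum (λ x → d x + X′ j r x * function c q (row r x))
                ≈⟨ ∑-distrib-+ d (λ x → X′ j r x * function c q (row r x)) ⟩
              sum d + sum (λ x → X′ j r x * function c q (row r x))
                ≈⟨ trans (+-congˡ (X′-sum (∈U c q) j r)) (+-identityʳ _) ⟩
              sum d ∎
              where
              d : Fin 3 → Carrier
              d x = embed (Z j r x) * embed (C q (row r x)) - X′ j r x * function c q (row r x)

          E-bound : ∀ j q → N Q (embed (E j q)) (fromℕ R ℚ.* (fromℕ 3 ℚ.* (ε ℚ.* (B ℚ.+ fromℕ 2))))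
          E-bound j q = resp Q (sym (embed-E j q)) (N-sum Q (λ r → N-sum Q (λ x → term-error j q r x)))

          module _ {η : ℚ} (0<η : 0ℚ ℚ.< η) (η-small : fromℕ n ℚ.* (fromℕ 8 ℚ.* ((2ℚ ^ℚ p) ℚ.* (η ℚ.* η))) ℚ.≤ 1ℚ)
                   (ε-small : fromℕ R ℚ.* (fromℕ 3 ℚ.* (ε ℚ.* (B ℚ.+ fromℕ 2))) ℚ.≤ ½ ℚ.* η) where

            E-components : ∀ j q → ℚ.∣ proj₁ (E j q) ∣ ℚ.≤ η × ℚ.∣ proj₂ (E j q) ∣ ℚ.≤ η
            E-components j q = let b₁ , b₂ = embed-bound Q proper n𝕚 (*-pos (from-yes (0ℚ ℚP.<? ½)) 0<η) (weaken Q ε-small (E-bound j q))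
                               in ≡.subst (ℚ.∣ proj₁ (E j q) ∣ ℚ.≤_) halves b₁ , ≡.subst (ℚ.∣ proj₂ (E j q) ∣ ℚ.≤_) halves b₂
              where
              halves : ½ ℚ.* η ℚ.+ ½ ℚ.* η ≡ η
              halves = ℚSolver.solve 1 (λ e → ℚSolver.con ½ ℚSolver.:* e ℚSolver.:+ ℚSolver.con ½ ℚSolver.:* e ℚSolver.:= e) ≡.refl η

            conclusion : κ ℕ.* p ℕ.≤ 3072 ℕ.* (M ℕ.* n)
            conclusion = Bound.rank-bound row chosen {M} {κ} {p} {η} load 1≤κ (λ j → ℕP.≤-trans (κ≤owned j) (chosen-count j))
              (λ j r x → proj₁ (Z j r x)) (λ j r x → proj₂ (Z j r x))
              (λ j r h x → ≡.cong proj₁ (proj₁ (proj₂ (proj₂ (proj₁ approx j r x))) h)) (λ j r h x → ≡.cong proj₂ (proj₁ (proj₂ (proj₂ (proj₁ approx j r x))) h))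
              (λ j r h → ≡.cong proj₁ (proj₂ (proj₂ (proj₂ (proj₁ approx j r (chosen j r)))) h ≡.refl)) (λ j r h → ≡.cong proj₂ (proj₂ (proj₂ (proj₂ (proj₁ approx j r (chosen j r)))) h ≡.refl))
              (λ j r x → proj₁ (Z-components j r x)) (λ j r x → proj₂ (Z-components j r x))
              (λ q → (λ j → proj₁ (C q j)) , (λ j → proj₂ (C q j))) (pivot c) pivot-injective
              (λ q → ≡.cong proj₁ (proj₁ (proj₂ (proj₂ (proj₂ approx q (pivot c q))) q ≡.refl) ≡.refl))
              (λ q q′ h → ≡.cong proj₁ (proj₂ (proj₂ (proj₂ (proj₂ approx q (pivot c q′))) q′ ≡.refl) h))
              (λ j q → proj₁ (E-components j q)) (λ j q → proj₂ (E-components j q))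
              (ℚP.<⇒≤ 0<η) η-small

      module _ {P : PreNorm} (up : Q₀ ⊑ P) (proper : Proper P) (n𝕚 : N P 𝕚 1ℚ) {p : ℕ} (c : IdentityAt rescale id p) (c-bounded : Bounded P c) where

        -- The order of the choices matters: B bounds the given entries, η depends on n and p, and ε
        -- on η, B and the number of rows.
        bounded-rank : ¬ ¬ (κ ℕ.* p ℕ.≤ 3072 ℕ.* (M ℕ.* n))
        bounded-rank k = with-bound (uniform-bound (λ q → proj₁ (uniform-bound (λ j → proj₁ (c-bounded q j)))))
          where
          with-bound : ∃[ B ] (0ℚ ℚ.≤ B × ∀ q → proj₁ (uniform-bound (λ j → proj₁ (c-bounded q j))) ℚ.≤ B) → ⊥
          with-bound (B , 0≤B , B-bound) = with-η (small-multiple {c₀} {1ℚ} 0≤c₀ (from-yes (0ℚ ℚP.<? 1ℚ)))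
            where
            C-bound : ∀ q j → N P (function c q j) B
            C-bound q j = weaken P (ℚP.≤-trans (proj₂ (proj₂ (uniform-bound (λ j → proj₁ (c-bounded q j)))) j) (B-bound q)) (proj₂ (c-bounded q j))
            c₀ = fromℕ n ℚ.* (fromℕ 8 ℚ.* (2ℚ ^ℚ p))
            0≤c₀ : 0ℚ ℚ.≤ c₀
            0≤c₀ = *-nonNeg (fromℕ-nonNeg n) (*-nonNeg (fromℕ-nonNeg 8) (^-nonNeg p (fromℕ-nonNeg 2)))
            c₁ = fromℕ R ℚ.* (fromℕ 3 ℚ.* (B ℚ.+ fromℕ 2))
            0≤c₁ : 0ℚ ℚ.≤ c₁
            0≤c₁ = *-nonNeg (fromℕ-nonNeg R) (*-nonNeg (fromℕ-nonNeg 3) (+-nonNeg 0≤B (fromℕ-nonNeg 2)))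
            with-η : ∃[ η ] (0ℚ ℚ.< η × η ℚ.≤ 1ℚ × c₀ ℚ.* η ℚ.≤ 1ℚ) → ⊥
            with-η (η , 0<η , η≤1 , h) = with-ε (small-multiple {c₁} {½ ℚ.* η} 0≤c₁ (*-pos (from-yes (0ℚ ℚP.<? ½)) 0<η))
              where
              with-ε : ∃[ ε ] (0ℚ ℚ.< ε × ε ℚ.≤ 1ℚ × c₁ ℚ.* ε ℚ.≤ ½ ℚ.* η) → ⊥
              with-ε (ε , 0<ε , ε≤1 , h′) = approximate-all P up proper n𝕚 c-bounded λ { (Q , u , Q-proper , approx) →
                  k (Errors.conclusion (⊑-trans up u) Q-proper (lift u n𝕚) ε≤1 0≤B (λ q j → lift u (C-bound q j)) approx 0<η
                      (ℚP.≤-trans (ℚP.≤-reflexive (ℚSolver.solve 3 (λ n t e → n ℚSolver.:* (ℚSolver.con (fromℕ 8) ℚSolver.:* (t ℚSolver.:* (e ℚSolver.:* e))) ℚSolver.:= ((n ℚSolver.:* (ℚSolver.con (fromℕ 8) ℚSolver.:* t)) ℚSolver.:* e) ℚSolver.:* e) ≡.refl (fromℕ n) (2ℚ ^ℚ p) η))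
                        (ℚP.≤-trans (*-mono (*-nonNeg 0≤c₀ (ℚP.<⇒≤ 0<η)) h (ℚP.<⇒≤ 0<η) η≤1) (ℚP.≤-reflexive (ℚP.*-identityˡ 1ℚ))))
                      (ℚP.≤-trans (ℚP.≤-reflexive (ℚSolver.solve 3 (λ r e b → r ℚSolver.:* (ℚSolver.con (fromℕ 3) ℚSolver.:* (e ℚSolver.:* b)) ℚSolver.:= (r ℚSolver.:* (ℚSolver.con (fromℕ 3) ℚSolver.:* b)) ℚSolver.:* e) ≡.refl (fromℕ R) ε (B ℚ.+ fromℕ 2))) h′)) }
                where open Approximate c 0<ε

    -- Elimination follows the scaling because bounds are wanted for the rescaled functions. Taken
    -- over all columns it leaves no function over: a remaining one would vanish everywhere, also at
    -- its own pivot, so all p functions are reduced.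
    design-rank : ∀ {p} → Rank≥ U p → κ ℕ.* p ℕ.≤ 3072 ℕ.* (M ℕ.* n)
    design-rank {p} w = decidable-stable (κ ℕ.* p ℕP.≤? 3072 ℕ.* (M ℕ.* n)) λ k →
      adjoin-𝕚 trivialNorm trivialNorm-proper λ { (P₁ , _ , h₁ , n𝕚) →
      scaling row a a⁻¹ aa⁻¹≈1 P₁ h₁ λ { (P₂ , u₂ , h₂ , S) →
      elimination (Scale.rescale S) id P₂ h₂ (Scale.rescale-rank S w) λ { (P₃ , u₃ , h₃ , result) →
      Scale.bounded-rank S u₃ h₃ (lift u₃ (lift u₂ n𝕚)) (Result.c result) (Result.c-bounded result)
        λ bd → k (≡.subst (λ t → κ ℕ.* t ℕ.≤ 3072 ℕ.* (M ℕ.* n)) (all-pivots result) bd) } } }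
      where
      all-pivots : ∀ {V : Subspace n} {Q} (result : Result V id p Q) → Result.p result ≡ p
      all-pivots result = ≡.trans (≡.sym (ℕP.+-identityʳ _)) (≡.trans (≡.cong (Result.p result ℕ.+_) (≡.sym (no-rest (Result.r result) (Result.w result) (Result.w-vanish result)))) (Result.p+r≡d result))
        where
        no-rest : ∀ r (w : Rank≥ _ r) → (∀ t j → function w t j ≈ 0#) → r ≡ 0
        no-rest zero w h = ≡.refl
        no-rest (suc r) w h = ⊥-elim (1≉0 (trans (sym (at-own w zero)) (h zero (pivot w zero))))

-- Linear dependence of evaluation functionals.

module Dependence (K : ACF₀) where
  open ACF₀ K
  open RationalEmbedding K using (module KSolver)
  open PivotElimination K
  open import Data.Nat.Base using (ℕ; zero; suc)
  open import Data.Fin.Base using (Fin; zero; suc)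
  open import Data.Product using (∃-syntax; _,_; proj₁; proj₂)
  open import Relation.Nullary using (¬_; Dec; yes; no)
  open import Relation.Binary.Reasoning.Setoid setoid

  module _ {m : ℕ} (U : Subspace m) where

    Zero : Fin m → Set
    Zero i = ∀ g → member U g → g i ≈ 0#

    -- The functional "evaluate at h" on U is a combination of those at j and k.
    Dep : Fin m → Fin m → Fin m → Set
    Dep h j k = ∃[ α ] ∃[ β ] (∀ g → member U g → g h ≈ α * g j + β * g k)

    Par : Fin m → Fin m → Set
    Par i j = Dep i j j

    Dep-first : ∀ {j k} → Dep j j k
    Dep-first {j} {k} = 1# , 0# , λ g _ → sym (trans (+-cong (*-identityˡ (g j)) (zeroˡ (g k))) (+-identityʳ (g j)))

    Dep-swap : ∀ {h j k} → Dep h j k → Dep h k j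
    Dep-swap (α , β , e) = β , α , λ g g∈ → trans (e g g∈) (+-comm _ _)

    Dep-second : ∀ {j k} → Dep k j k
    Dep-second = Dep-swap Dep-first

    Dep-trans : ∀ {h j k a b} → Dep h j k → Dep j a b → Dep k a b → Dep h a b
    Dep-trans {h} {j} {k} {a} {b} (α , β , e) (γ , δ , f) (ε , ζ , f′) = α * γ + β * ε , α * δ + β * ζ , λ g g∈ →
      trans (e g g∈) (trans (+-cong (*-congˡ (f g g∈)) (*-congˡ (f′ g g∈)))
        (solve 8 (λ α β γ δ ε ζ x y → α :* (γ :* x :+ δ :* y) :+ β :* (ε :* x :+ ζ :* y) := (α :* γ :+ β :* ε) :* x :+ (α :* δ :+ β :* ζ) :* y) refl α β γ δ ε ζ (g a) (g b)))
      where open KSolver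

    Dep-zeroʳ : ∀ {i j k} → Dep i j k → Zero k → Par i j
    Dep-zeroʳ {i} {j} {k} (α , β , e) z = α , 0# , λ g g∈ → trans (e g g∈) (+-congˡ (trans (*-congˡ (z g g∈)) (trans (zeroʳ β) (sym (zeroˡ (g j))))))

    Dep-zero : ∀ {i j k} → Dep i j k → Zero j → Zero k → Zero i
    Dep-zero (α , β , e) z z′ g g∈ = trans (e g g∈) (trans (+-cong (trans (*-congˡ (z g g∈)) (zeroʳ α)) (trans (*-congˡ (z′ g g∈)) (zeroʳ β))) (+-identityˡ 0#))

    coefficient≉0 : ∀ {i j k α β} → ¬ Par i k → (∀ g → member U g → g i ≈ α * g j + β * g k) → ¬ (α ≈ 0#)
    coefficient≉0 {i} {j} {k} {α} {β} ¬par e α≈0 = ¬par (0# , β , λ g g∈ → trans (e g g∈) (+-congʳ (trans (*-congʳ α≈0) (trans (zeroˡ (g j)) (sym (zeroˡ (g k)))))))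

    -- Steinitz exchange: the coefficient of j is invertible, since otherwise i would be parallel to
    -- k.
    Dep-exchange : ∀ {i j k} → Dep i j k → ¬ Par i k → Dep j i k
    Dep-exchange {i} {j} {k} (α , β , e) ¬par = solved (inverse α (coefficient≉0 ¬par e))
      where
      open KSolver
      solved : ∃[ γ ] (α * γ ≈ 1#) → Dep j i k
      solved (γ , αγ≈1) = γ , - (γ * β) , λ g g∈ → sym (begin
        γ * g i + - (γ * β) * g k                  ≈⟨ +-congʳ (*-congˡ (e g g∈)) ⟩
        γ * (α * g j + β * g k) + - (γ * β) * g k  ≈⟨ solve 5 (λ γ α β x y → γ :* (α :* x :+ β :* y) :+ (:- (γ :* β)) :* y := (α :* γ) :* x) refl γ α β (g j) (g k) ⟩
        (α * γ) * g j                              ≈⟨ trans (*-congʳ αγ≈1) (*-identityˡ (g j)) ⟩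
        g j ∎)

    Par-sym : ∀ {i j} → ¬ Zero i → Par i j → Par j i
    Par-sym {i} {j} nz (α , β , e) = solved (inverse (α + β) λ s≈0 → nz λ g g∈ → trans (e g g∈) (trans (sym (distribʳ (g j) α β)) (trans (*-congʳ s≈0) (zeroˡ (g j)))))
      where
      open KSolver
      solved : ∃[ γ ] ((α + β) * γ ≈ 1#) → Par j i
      solved (γ , sγ≈1) = γ , 0# , λ g g∈ → sym (begin
        γ * g i + 0# * g i           ≈⟨ trans (+-congˡ (zeroˡ (g i))) (+-identityʳ _) ⟩
        γ * g i                      ≈⟨ *-congˡ (e g g∈) ⟩
        γ * (α * g j + β * g j)      ≈⟨ solve 4 (λ γ α β x → γ :* (α :* x :+ β :* x) := ((α :+ β) :* γ) :* x) refl γ α β (g j) ⟩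
        ((α + β) * γ) * g j          ≈⟨ trans (*-congʳ sγ≈1) (*-identityˡ (g j)) ⟩
        g j ∎)

    Par-trans : ∀ {i j k} → Par i j → Par j k → Par i k
    Par-trans p q = Dep-trans p q q

    -- Three distinct collinear points of the projective space of functionals. Projective
    -- collinearity is the notion that makes sense after restricting to a smaller space of
    -- functions.
    record Col (i j k : Fin m) : Set where
      constructor col
      field
        nz₁ : ¬ Zero i
        nz₂ : ¬ Zero j
        nz₃ : ¬ Zero k
        ∦₁₂ : ¬ Par i j
        ∦₁₃ : ¬ Par i k
        ∦₂₃ : ¬ Par j k
        dependent : Dep i j k

    Col-swap : ∀ {i j k} → Col i j k → Col i k j
    Col-swap (col a b c d e f g) = col a c b e d (λ p → f (Par-sym c p)) (Dep-swap g)

    Col-rotate : ∀ {i j k} → Col i j k → Col j i k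
    Col-rotate (col a b c d e f g) = col b a c (λ p → d (Par-sym b p)) f e (Dep-exchange g e)

    Col-line : ∀ {i j k} → Col i j k → ∀ {h} → Dep h i j → Dep h i k
    Col-line c d = Dep-trans d Dep-first (Col.dependent (Col-rotate c))

    -- Decides the finitely many facts about U on which the counting depends, so that the counting
    -- itself can be done in ℕ.
    record Table : Set where
      field
        zero? : ∀ i → Dec (Zero i)
        dep?  : ∀ h j k → Dec (Dep h j k)

    table : ¬ ¬ Table
    table k = ¬¬-Fin (λ i → em) λ z → ¬¬-Fin {P = λ h → ∀ j k → Dec (Dep h j k)} (λ h → ¬¬-Fin {P = λ j → ∀ k → Dec (Dep h j k)} (λ j → ¬¬-Fin {P = λ k → Dec (Dep h j k)} (λ k → em))) λ d → k (record { zero? = z ; dep? = d })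
      where
      em : ∀ {A : Set} → ¬ ¬ Dec A
      em k = k (no (λ a → k (yes a)))

  record ThreeTerm {m} (U : Subspace m) (t : Fin 3 → Fin m) : Set where
    field
      a a⁻¹ : Fin 3 → Carrier
      aa⁻¹≈1 : ∀ x → a x * a⁻¹ x ≈ 1#
      vanishes : ∀ g → member U g → a zero * g (t zero) + (a (suc zero) * g (t (suc zero)) + (a (suc (suc zero)) * g (t (suc (suc zero))) + 0#)) ≈ 0#

  triple : ∀ {A : Set} → A → A → A → Fin 3 → A
  triple i j k zero = i
  triple i j k (suc zero) = j
  triple i j k (suc (suc zero)) = k

  -- All three coefficients are units because the first point is parallel to neither of the others;
  -- the scaling divides by them.
  threeTerm : ∀ {m} {U : Subspace m} {i j k} → Col U i j k → ThreeTerm U (triple i j k)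
  threeTerm {U = U} {i} {j} {k} c = build (Col.dependent c)
    where
    open Col c
    build : Dep U i j k → ThreeTerm U (triple i j k)
    build (α , β , e) = record
      { a = triple (- 1#) α β
      ; a⁻¹ = triple (- 1#) (proj₁ iα) (proj₁ iβ)
      ; aa⁻¹≈1 = λ { zero → trans (KSolver.solve 1 (λ x → (KSolver.:- x) KSolver.:* (KSolver.:- x) KSolver.:= x KSolver.:* x) refl 1#) (*-identityˡ 1#)
                   ; (suc zero) → proj₂ iα ; (suc (suc zero)) → proj₂ iβ }
      ; vanishes = λ g g∈ → trans (+-congʳ (-1*x≈-x (g i))) (trans (+-congˡ (trans (+-congˡ (+-identityʳ _)) (sym (e g g∈)))) (-‿inverseˡ (g i)))
      }
      where
      open import Algebra.Properties.Ring ring using (-1*x≈-x)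
      iα = inverse α (coefficient≉0 U ∦₁₃ e)
      iβ = inverse β (coefficient≉0 U ∦₁₂ (λ g g∈ → trans (e g g∈) (+-comm _ _)))

-- Counting decidable predicates.

module Counting where
  open NaturalSums
  open import Data.Nat.Base
  open import Data.Nat.Properties
  open import Data.Fin.Base using (Fin)
  open import Data.Sum using (_⊎_; inj₁; inj₂)
  open import Data.Empty using (⊥-elim)
  open import Relation.Nullary using (Dec; yes; no; ¬_)
  open import Relation.Binary.PropositionalEquality using (_≡_; refl; sym; trans; cong)

  indicator-yes : ∀ {A : Set} (d : Dec A) → A → indicator d ≡ 1
  indicator-yes (yes _) _ = refl
  indicator-yes (no h) a = ⊥-elim (h a)

  indicator-no : ∀ {A : Set} (d : Dec A) → ¬ A → indicator d ≡ 0
  indicator-no (yes a) h = ⊥-elim (h a)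
  indicator-no (no _) _ = refl

  indicator≤1 : ∀ {A : Set} (d : Dec A) → indicator d ≤ 1
  indicator≤1 (yes _) = ≤-refl
  indicator≤1 (no _) = z≤n

  indicator-mono : ∀ {A B : Set} (a? : Dec A) (b? : Dec B) → (A → B) → indicator a? ≤ indicator b?
  indicator-mono (no _) b? f = z≤n
  indicator-mono (yes a) b? f = ≤-reflexive (sym (indicator-yes b? (f a)))

  indicator-cong : ∀ {A B : Set} (a? : Dec A) (b? : Dec B) → (A → B) → (B → A) → indicator a? ≡ indicator b?
  indicator-cong a? b? f g = ≤-antisym (indicator-mono a? b? f) (indicator-mono b? a? g)

  indicator-cover : ∀ {A B C D : Set} (a? : Dec A) (b? : Dec B) (c? : Dec C) (d? : Dec D) → (A → B ⊎ C ⊎ D) →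
                    indicator a? ≤ indicator b? + (indicator c? + indicator d?)
  indicator-cover (no _) b? c? d? f = z≤n
  indicator-cover (yes a) b? c? d? f = cases (f a)
    where
    cases : _ → 1 ≤ indicator b? + (indicator c? + indicator d?)
    cases (inj₁ b) = ≤-trans (≤-reflexive (sym (indicator-yes b? b))) (m≤m+n _ _)
    cases (inj₂ (inj₁ c)) = ≤-trans (≤-reflexive (sym (indicator-yes c? c))) (≤-trans (m≤m+n _ _) (m≤n+m _ (indicator b?)))
    cases (inj₂ (inj₂ d)) = ≤-trans (≤-reflexive (sym (indicator-yes d? d))) (≤-trans (m≤n+m _ (indicator c?)) (m≤n+m _ (indicator b?)))

  indicator-disjoint : ∀ {A B C D : Set} (a? : Dec A) (b? : Dec B) (c? : Dec C) (d? : Dec D) →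
                       (B → A) → (C → A) → (D → A) → (B → ¬ C) → (B → ¬ D) → (C → ¬ D) →
                       indicator b? + (indicator c? + indicator d?) ≤ indicator a?
  indicator-disjoint a? (yes b) c? d? f g h bc bd cd rewrite indicator-no c? (bc b) | indicator-no d? (bd b) = ≤-reflexive (sym (indicator-yes a? (f b)))
  indicator-disjoint a? (no _) (yes c) d? f g h bc bd cd rewrite indicator-no d? (cd c) = ≤-reflexive (sym (indicator-yes a? (g c)))
  indicator-disjoint a? (no _) (no _) (yes d) f g h bc bd cd = ≤-reflexive (sym (indicator-yes a? (h d)))
  indicator-disjoint a? (no _) (no _) (no _) f g h bc bd cd = z≤n

  # : ∀ {n} {P : Fin n → Set} → (∀ i → Dec (P i)) → ℕ
  # P? = sum (λ i → indicator (P? i))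

  #-mono : ∀ {n} {P Q : Fin n → Set} (P? : ∀ i → Dec (P i)) (Q? : ∀ i → Dec (Q i)) → (∀ i → P i → Q i) → # P? ≤ # Q?
  #-mono P? Q? f = sum-mono (λ i → indicator-mono (P? i) (Q? i) (f i))

  #≤n : ∀ {n} {P : Fin n → Set} (P? : ∀ i → Dec (P i)) → # P? ≤ n
  #≤n {n} P? = ≤-trans (sum-mono (λ i → indicator≤1 (P? i))) (≤-reflexive (trans (sum-const n 1) (*-identityʳ n)))

  #-cover : ∀ {n} {A B C D : Fin n → Set} (a? : ∀ i → Dec (A i)) (b? : ∀ i → Dec (B i)) (c? : ∀ i → Dec (C i)) (d? : ∀ i → Dec (D i)) →
            (∀ i → A i → B i ⊎ C i ⊎ D i) → # a? ≤ # b? + (# c? + # d?)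
  #-cover a? b? c? d? f = ≤-trans (sum-mono (λ i → indicator-cover (a? i) (b? i) (c? i) (d? i) (f i)))
    (≤-reflexive (trans (∑-distrib-+ (λ i → indicator (b? i)) _) (cong (# b? +_) (∑-distrib-+ (λ i → indicator (c? i)) _))))

  #-disjoint : ∀ {n} {A B C D : Fin n → Set} (a? : ∀ i → Dec (A i)) (b? : ∀ i → Dec (B i)) (c? : ∀ i → Dec (C i)) (d? : ∀ i → Dec (D i)) →
               (∀ i → B i → A i) → (∀ i → C i → A i) → (∀ i → D i → A i) → (∀ i → B i → ¬ C i) → (∀ i → B i → ¬ D i) → (∀ i → C i → ¬ D i) →
               # b? + (# c? + # d?) ≤ # a?
  #-disjoint a? b? c? d? f g h bc bd cd = ≤-trans
    (≤-reflexive (sym (trans (∑-distrib-+ (λ i → indicator (b? i)) _) (cong (# b? +_) (∑-distrib-+ (λ i → indicator (c? i)) _)))))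
    (sum-mono (λ i → indicator-disjoint (a? i) (b? i) (c? i) (d? i) (f i) (g i) (h i) (bc i) (bd i) (cd i)))

  #-positive : ∀ {n} {P : Fin n → Set} (P? : ∀ i → Dec (P i)) i → P i → 1 ≤ # P?
  #-positive P? i p = ≤-trans (≤-reflexive (sym (indicator-yes (P? i) p))) (term≤sum (λ i → indicator (P? i)) i)

-- Multiplicities, lines, and weights of collinear triples.

module Weights (K : ACF₀) where
  open PivotElimination K using (Subspace)
  open Dependence K
  open NaturalSums
  open Counting
  open import Data.Nat.Base
  open import Data.Nat.Properties
  open import Data.Nat.DivMod using (m/n*n≡m)
  open import Data.Nat.Divisibility using (∣-trans; m∣m*n; m≤n⇒m!∣n!)
  open import Data.Fin.Base using (Fin; zero; suc)
  open import Data.Product using (∃-syntax; _×_; _,_)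
  open import Data.Sum using (_⊎_; inj₁; inj₂)
  open import Data.Empty using (⊥; ⊥-elim)
  open import Relation.Nullary using (Dec; yes; no; ¬_)
  open import Relation.Nullary.Decidable using (_×-dec_; _⊎-dec_; ¬?; map′)
  open import Relation.Binary.PropositionalEquality using (_≡_; refl; sym; trans; cong)

  -- The configuration property for functionals. It passes to subspaces of U, because a dependence
  -- valid on all functions stays valid on fewer.
  LCC : ∀ {m} → Subspace m → ℕ → Set₁
  LCC {m} U τ = ∀ (P : Fin m → Set) (P? : ∀ i → Dec (P i)) → # P? ≤ τ → ∀ i → ∃[ j ] ∃[ k ] (¬ P j × ¬ P k × Dep U i j k)

  module _ {m : ℕ} (U : Subspace m) (T : Table U) where
    open Table T

    NZ : Fin m → Set
    NZ i = ¬ Zero U i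

    nz? : ∀ i → Dec (NZ i)
    nz? i = ¬? (zero? i)

    par? : ∀ i j → Dec (Par U i j)
    par? i j = dep? i j j

    col? : ∀ i j k → Dec (Col U i j k)
    col? i j k = map′ (λ { (a , b , c , d , e , f , g) → col a b c d e f g }) (λ { (col a b c d e f g) → a , b , c , d , e , f , g })
      (nz? i ×-dec nz? j ×-dec nz? k ×-dec ¬? (par? i j) ×-dec ¬? (par? i k) ×-dec ¬? (par? j k) ×-dec dep? i j k)

    inClass? : ∀ i h → Dec (NZ h × Par U h i)
    inClass? i h = nz? h ×-dec par? h i

    onLine? : ∀ i j h → Dec (NZ h × Dep U h i j)
    onLine? i j h = nz? h ×-dec dep? h i j

    -- The multiplicity of i as a point of projective space; `ℓ` below likewise counts a projective
    -- line with multiplicity.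
    μ : Fin m → ℕ
    μ i = # (inClass? i)

    ℓ : Fin m → Fin m → ℕ
    ℓ i j = # (onLine? i j)

    ℓ-swap : ∀ i j → ℓ i j ≡ ℓ j i
    ℓ-swap i j = sum-cong (λ h → indicator-cong (onLine? i j h) (onLine? j i h) (λ { (a , d) → a , Dep-swap U d }) (λ { (a , d) → a , Dep-swap U d }))

    ℓ-col : ∀ {i j k} → Col U i j k → ℓ i j ≡ ℓ i k
    ℓ-col {i} {j} {k} c = sum-cong (λ h → indicator-cong (onLine? i j h) (onLine? i k h) (λ { (a , d) → a , Col-line U c d }) (λ { (a , d) → a , Col-line U (Col-swap U c) d }))

    line≤ : ∀ {i j} → NZ i → NZ j → ¬ Par U i j → ℓ i j ≤ # (col? i j) + (μ i + μ j)
    line≤ {i} {j} ni nj ∦ = #-cover (onLine? i j) (col? i j) (inClass? i) (inClass? j) cases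
      where
      cases : ∀ h → NZ h × Dep U h i j → Col U i j h ⊎ (NZ h × Par U h i) ⊎ (NZ h × Par U h j)
      cases h (nh , d) = split (par? h i) (par? h j)
        where
        split : Dec (Par U h i) → Dec (Par U h j) → Col U i j h ⊎ (NZ h × Par U h i) ⊎ (NZ h × Par U h j)
        split (yes p) _ = inj₂ (inj₁ (nh , p))
        split (no _) (yes p) = inj₂ (inj₂ (nh , p))
        split (no hi) (no hj) = inj₁ (Col-swap U (Col-rotate U (col nh ni nj hi hj ∦ d)))

    classes≤ : ∀ {i j k} → Col U i j k → μ i + (μ j + μ k) ≤ ℓ i j
    classes≤ {i} {j} {k} c = #-disjoint (onLine? i j) (inClass? i) (inClass? j) (inClass? k)
      (λ h → λ { (n , p) → n , Dep-trans U p (Dep-first U) (Dep-first U) }) (λ h → λ { (n , p) → n , Dep-trans U p (Dep-second U) (Dep-second U) })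
      (λ h → λ { (n , p) → n , Dep-trans U p k-on-line k-on-line })
      (λ h → λ { (n , p) (_ , q) → ∦₁₂ (Par-trans U (Par-sym U n p) q) }) (λ h → λ { (n , p) (_ , q) → ∦₁₃ (Par-trans U (Par-sym U n p) q) })
      (λ h → λ { (n , p) (_ , q) → ∦₂₃ (Par-trans U (Par-sym U n p) q) })
      where
      open Col c
      k-on-line : Dep U k i j
      k-on-line = Col.dependent (Col-rotate U (Col-swap U c))

    -- m! is divisible by every possible line size, so the weights M/ℓ are integers and can later
    -- serve as numbers of copies of a row.
    M : ℕ
    M = m !

    w : ℕ → ℕ
    w zero = 0
    w (suc k) = M / suc k

    w-spec : ∀ {k} → 1 ≤ k → k ≤ m → w k * k ≡ M
    w-spec {suc k} _ k≤m = m/n*n≡m (∣-trans (m∣m*n (k !)) (m≤n⇒m!∣n! k≤m))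

    w-load : ∀ {k} → k ≤ m → w k * k ≤ M
    w-load {zero} _ = z≤n
    w-load {suc k} h = ≤-reflexive (w-spec (s≤s z≤n) h)

    -- Weighting a collinear triple inversely to the number of points on its line keeps the total weight through each pair at most M.
    y : Fin m → Fin m → Fin m → ℕ
    y i j k = indicator (col? i j k) * w (ℓ i j)

    y-eq : ∀ {i j k i′ j′ k′} → (Col U i j k → Col U i′ j′ k′) → (Col U i′ j′ k′ → Col U i j k) → (Col U i j k → ℓ i j ≡ ℓ i′ j′) → y i j k ≡ y i′ j′ k′
    y-eq {i} {j} {k} {i′} {j′} {k′} f g e = cases (col? i j k) (col? i′ j′ k′)
      where
      cases : (d : Dec (Col U i j k)) (d′ : Dec (Col U i′ j′ k′)) → indicator d * w (ℓ i j) ≡ indicator d′ * w (ℓ i′ j′)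
      cases (yes c) (yes _) = cong (λ t → 1 * w t) (e c)
      cases (yes c) (no h) = ⊥-elim (h (f c))
      cases (no h) (yes c) = ⊥-elim (h (g c))
      cases (no _) (no _) = refl

    y-swap : ∀ i j k → y i j k ≡ y i k j
    y-swap i j k = y-eq (Col-swap U) (Col-swap U) ℓ-col

    y-rotate : ∀ i j k → y i j k ≡ y j i k
    y-rotate i j k = y-eq (Col-rotate U) (Col-rotate U) (λ _ → ℓ-swap i j)

    y-sum : ∀ i j → sum (λ k → y i j k) ≡ w (ℓ i j) * # (col? i j)
    y-sum i j = trans (sym (*-distribʳ-sum (w (ℓ i j)) (λ k → indicator (col? i j k)))) (*-comm (# (col? i j)) _)

    col≤line : ∀ i j → # (col? i j) ≤ ℓ i j
    col≤line i j = #-mono (col? i j) (onLine? i j) (λ k c → Col.nz₃ c , Col.dependent (Col-rotate U (Col-swap U c)))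

    y-load : ∀ i j → sum (λ k → y i j k) ≤ M
    y-load i j = ≤-trans (≤-reflexive (y-sum i j)) (≤-trans (*-monoʳ-≤ (w (ℓ i j)) (col≤line i j)) (w-load (#≤n (onLine? i j))))

    -- The classes of i and j take up at most two thirds of their line, so at least one third is
    -- left for third points.
    Good : Fin m → Fin m → Set
    Good i j = NZ i × NZ j × ¬ Par U i j × 3 * (μ i + μ j) ≤ 2 * ℓ i j

    good? : ∀ i j → Dec (Good i j)
    good? i j = nz? i ×-dec nz? j ×-dec ¬? (par? i j) ×-dec (3 * (μ i + μ j) ≤? 2 * ℓ i j)

    good-weight : ∀ {i j} → Good i j → M ≤ 3 * sum (λ k → y i j k)
    good-weight {i} {j} (ni , nj , ∦ , h) = begin
      M                              ≡⟨ w-spec 1≤ℓ (#≤n (onLine? i j)) ⟨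
      w (ℓ i j) * ℓ i j              ≤⟨ *-monoʳ-≤ (w (ℓ i j)) ℓ≤3c ⟩
      w (ℓ i j) * (3 * # (col? i j)) ≡⟨ trans (sym (*-assoc (w (ℓ i j)) 3 _)) (trans (cong (_* # (col? i j)) (*-comm (w (ℓ i j)) 3)) (*-assoc 3 (w (ℓ i j)) _)) ⟩
      3 * (w (ℓ i j) * # (col? i j)) ≡⟨ cong (3 *_) (y-sum i j) ⟨
      3 * sum (λ k → y i j k) ∎
      where
      open ≤-Reasoning
      1≤ℓ : 1 ≤ ℓ i j
      1≤ℓ = #-positive (onLine? i j) i (ni , Dep-first U)
      c = # (col? i j)
      s = μ i + μ j
      ℓ≤3c : ℓ i j ≤ 3 * c
      ℓ≤3c = +-cancelʳ-≤ (2 * ℓ i j) (ℓ i j) (3 * c) (begin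
        ℓ i j + 2 * ℓ i j     ≡⟨⟩
        3 * ℓ i j             ≤⟨ *-monoʳ-≤ 3 (line≤ ni nj ∦) ⟩
        3 * (c + s)           ≡⟨ *-distribˡ-+ 3 c s ⟩
        3 * c + 3 * s         ≤⟨ +-monoʳ-≤ (3 * c) h ⟩
        3 * c + 2 * ℓ i j ∎)

    W : Fin m → ℕ
    W i = sum (λ j → sum (λ k → y i j k))

    W-good : ∀ i → M * # (good? i) ≤ 3 * W i
    W-good i = begin
      M * # (good? i)                             ≡⟨ *-distribˡ-sum M (λ j → indicator (good? i j)) ⟩
      sum (λ j → M * indicator (good? i j))       ≤⟨ sum-mono (λ j → term j (good? i j)) ⟩
      sum (λ j → 3 * sum (λ k → y i j k))         ≡⟨ *-distribˡ-sum 3 (λ j → sum (λ k → y i j k)) ⟨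
      3 * W i ∎
      where
      open ≤-Reasoning
      term : ∀ j (d : Dec (Good i j)) → M * indicator d ≤ 3 * sum (λ k → y i j k)
      term j (yes g) = ≤-trans (≤-reflexive (*-identityʳ M)) (good-weight g)
      term j (no _) = ≤-trans (≤-reflexive (*-zeroʳ M)) z≤n

    below? : ∀ v i → Dec (NZ i × μ i < v)
    below? v i = nz? i ×-dec (μ i <? v)

    -- The class of i and the smaller of the other two classes are each at most as large as the
    -- remaining one, hence together at most two thirds of the three disjoint classes.
    one-good : ∀ {i j k} → Col U i j k → μ i ≤ μ j → μ i ≤ μ k → Good i j ⊎ Good i k
    one-good {i} {j} {k} c i≤j i≤k = cases (≤-total (μ j) (μ k))
      where
      open Col c
      bd : ∀ {a b d n} → a ≤ d → b ≤ d → a + (b + d) ≤ n → 3 * (a + b) ≤ 2 * n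
      bd {a} {b} {d} {n} a≤d b≤d h = begin
        3 * (a + b)                     ≡⟨ *-comm 3 (a + b) ⟩
        (a + b) * 3                     ≡⟨ trans (*-distribˡ-+ (a + b) 1 2) (+-comm ((a + b) * 1) _) ⟩
        (a + b) * 2 + (a + b) * 1       ≤⟨ +-monoʳ-≤ ((a + b) * 2) (≤-trans (≤-reflexive (*-identityʳ (a + b))) (≤-trans (+-mono-≤ a≤d b≤d) (≤-reflexive (trans (cong (d +_) (sym (+-identityʳ d))) (*-comm 2 d))))) ⟩
        (a + b) * 2 + d * 2             ≡⟨ trans (sym (*-distribʳ-+ 2 (a + b) d)) (trans (cong (_* 2) (+-assoc a b d)) (*-comm (a + (b + d)) 2)) ⟩
        2 * (a + (b + d))               ≤⟨ *-monoʳ-≤ 2 h ⟩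
        2 * n ∎
        where open ≤-Reasoning
      cases : μ j ≤ μ k ⊎ μ k ≤ μ j → Good i j ⊎ Good i k
      cases (inj₁ j≤k) = inj₁ (nz₁ , nz₂ , ∦₁₂ , bd i≤k j≤k (classes≤ c))
      cases (inj₂ k≤j) = inj₂ (nz₁ , nz₃ , ∦₁₃ , bd i≤j k≤j (classes≤ (Col-swap U c)))

    module _ {τ : ℕ} (lcc : LCC U τ) where

      excluded? : ∀ v i j → Dec ((NZ j × μ j < v) ⊎ (NZ j × Par U j i) ⊎ Good i j)
      excluded? v i j = below? v j ⊎-dec inClass? i j ⊎-dec good? i j

      -- Otherwise the configuration property yields j and k outside the excluded set. They cannot
      -- be parallel to i, so i, j, k are collinear; j and k have multiplicity at least that of i,
      -- and `one-good` makes one of them an excluded partner.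
      excluded-large : ∀ v i → NZ i → μ i ≤ v → ¬ (# (excluded? v i) ≤ τ)
      excluded-large v i ni μi≤v h = contradict (lcc _ (excluded? v i) h i)
        where
        contradict : ¬ (∃[ j ] ∃[ k ] (_ × _ × Dep U i j k))
        contradict (j , k , ¬j , ¬k , d) = cases (zero? j) (zero? k)
          where
          cases : Dec (Zero U j) → Dec (Zero U k) → ⊥
          cases (yes zj) (yes zk) = ni (Dep-zero U d zj zk)
          cases (yes zj) (no nk) = ¬k (inj₂ (inj₁ (nk , Par-sym U ni (Dep-zeroʳ U (Dep-swap U d) zj))))
          cases (no nj) (yes zk) = ¬j (inj₂ (inj₁ (nj , Par-sym U ni (Dep-zeroʳ U d zk))))
          cases (no nj) (no nk) = good (one-good c (≤-trans μi≤v (≮⇒≥ (λ l → ¬j (inj₁ (nj , l))))) (≤-trans μi≤v (≮⇒≥ (λ l → ¬k (inj₁ (nk , l))))))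
            where
            ∦j : ¬ Par U i j
            ∦j p = ¬j (inj₂ (inj₁ (nj , Par-sym U ni p)))
            ∦k : ¬ Par U i k
            ∦k p = ¬k (inj₂ (inj₁ (nk , Par-sym U ni p)))
            c : Col U i j k
            c = col ni nj nk ∦j ∦k (λ p → ∦j (Dep-trans U d (Dep-first U) (Par-sym U nj p))) d
            good : ¬ (Good i j ⊎ Good i k)
            good (inj₁ g) = ¬j (inj₂ (inj₂ g))
            good (inj₂ g) = ¬k (inj₂ (inj₂ g))

      many-nonzero : ∀ i → NZ i → ¬ (# nz? ≤ τ)
      many-nonzero i ni h = contradict (lcc _ nz? h i)
        where
        contradict : ¬ (∃[ j ] ∃[ k ] (¬ NZ j × ¬ NZ k × Dep U i j k))
        contradict (j , k , ¬j , ¬k , d) = cases (zero? j) (zero? k)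
          where
          cases : Dec (Zero U j) → Dec (Zero U k) → ⊥
          cases (yes zj) (yes zk) = ni (Dep-zero U d zj zk)
          cases (no nj) _ = ¬j nj
          cases (yes _) (no nk) = ¬k nk

      -- Points of smaller multiplicity and the class of i use up at most a quarter of τ each, which
      -- leaves at least half for good partners.
      many-good : ∀ v i → NZ i → μ i ≤ v → 4 * # (below? v) ≤ τ → 4 * μ i ≤ τ → τ ≤ 2 * # (good? i)
      many-good v i ni μi≤v hb hμ = ≮⇒≥ λ 2g<τ → excluded-large v i ni μi≤v (*-cancelˡ-≤ 4 (begin
        4 * # (excluded? v i)                          ≤⟨ *-monoʳ-≤ 4 (#-cover (excluded? v i) (below? v) (inClass? i) (good? i) (λ _ e → e)) ⟩
        4 * (# (below? v) + (μ i + # (good? i)))       ≡⟨ trans (*-distribˡ-+ 4 (# (below? v)) _) (cong (4 * # (below? v) +_) (*-distribˡ-+ 4 (μ i) _)) ⟩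
        4 * # (below? v) + (4 * μ i + 4 * # (good? i)) ≤⟨ +-mono-≤ hb (+-mono-≤ hμ (≤-reflexive (*-assoc 2 2 (# (good? i))))) ⟩
        τ + (τ + 2 * (2 * # (good? i)))                ≤⟨ +-monoʳ-≤ τ (+-monoʳ-≤ τ (*-monoʳ-≤ 2 (<⇒≤ 2g<τ))) ⟩
        τ + (τ + 2 * τ)                                ≡⟨⟩
        4 * τ ∎))
        where open ≤-Reasoning

      heavy-weight : ∀ v i → NZ i → μ i ≤ v → 4 * # (below? v) ≤ τ → 4 * μ i ≤ τ → M * τ ≤ 6 * W i
      heavy-weight v i ni μi≤v hb hμ = begin
        M * τ                    ≤⟨ *-monoʳ-≤ M (many-good v i ni μi≤v hb hμ) ⟩
        M * (2 * # (good? i))    ≡⟨ trans (sym (*-assoc M 2 _)) (trans (cong (_* # (good? i)) (*-comm M 2)) (*-assoc 2 M _)) ⟩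
        2 * (M * # (good? i))    ≤⟨ *-monoʳ-≤ 2 (W-good i) ⟩
        2 * (3 * W i)            ≡⟨ *-assoc 2 3 (W i) ⟨
        6 * W i ∎
        where open ≤-Reasoning

      -- v is the level at which the points of small multiplicity come to exceed τ/4. Those of
      -- multiplicity at most v number more than τ/4, while few lie strictly below v; each has
      -- weight at least Mτ/6, and 24 = 4 · 6.
      total-weight : ∀ v → 4 * # (below? v) ≤ τ → τ < 4 * # (below? (suc v)) → (∀ i → NZ i → 4 * μ i ≤ τ) → M * (τ * τ) ≤ 24 * sum W
      total-weight v hb hb′ hμ = begin
        M * (τ * τ)                                        ≡⟨ *-assoc M τ τ ⟨
        (M * τ) * τ                                        ≤⟨ *-monoʳ-≤ (M * τ) (<⇒≤ hb′) ⟩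
        (M * τ) * (4 * # (below? (suc v)))                 ≡⟨ trans (sym (*-assoc (M * τ) 4 _)) (trans (cong (_* # (below? (suc v))) (*-comm (M * τ) 4)) (*-assoc 4 (M * τ) _)) ⟩
        4 * ((M * τ) * # (below? (suc v)))                 ≡⟨ cong (4 *_) (*-distribˡ-sum (M * τ) (λ i → indicator (below? (suc v) i))) ⟩
        4 * sum (λ i → (M * τ) * indicator (below? (suc v) i)) ≤⟨ *-monoʳ-≤ 4 (sum-mono (λ i → term i (below? (suc v) i))) ⟩
        4 * sum (λ i → 6 * W i)                            ≡⟨ cong (4 *_) (*-distribˡ-sum 6 W) ⟨
        4 * (6 * sum W)                                    ≡⟨ *-assoc 4 6 (sum W) ⟨
        24 * sum W ∎
        where
        open ≤-Reasoning
        term : ∀ i (d : Dec (NZ i × μ i < suc v)) → (M * τ) * indicator d ≤ 6 * W i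
        term i (yes (ni , l)) = ≤-trans (≤-reflexive (*-identityʳ (M * τ))) (heavy-weight v i ni (≤-pred l) hb (hμ i ni))
        term i (no _) = ≤-trans (≤-reflexive (*-zeroʳ (M * τ))) z≤n

-- Dense subsets of a weighted triple system, and multisets of rows.

module Selections where
  open NaturalSums
  open import Data.Bool.Base using (Bool; true; false; if_then_else_)
  import Data.Bool.Properties as 𝔹
  open import Data.Nat.Base
  open import Data.Nat.Properties
  open import Data.Nat.Solver using (module +-*-Solver)
  open import Data.Fin.Base using (Fin; zero; suc; splitAt)
  import Data.Fin.Properties as FP
  open import Data.Product using (∃-syntax; _×_; _,_; proj₁; proj₂)
  open import Data.Sum using (inj₁; inj₂; [_,_]′)
  open import Data.Empty using (⊥-elim)
  open import Relation.Nullary using (Dec; yes; no; ¬_; does)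
  open import Relation.Nullary.Decidable using (_×-dec_)
  open import Relation.Binary.PropositionalEquality using (_≡_; refl; sym; trans; cong; cong₂; subst)

  open Aggregate +-0-commutativeMonoid using (sum-split)

  ⟦_⟧ : Bool → ℕ
  ⟦ b ⟧ = if b then 1 else 0

  ⟦⟧≤1 : ∀ b → ⟦ b ⟧ ≤ 1
  ⟦⟧≤1 true = ≤-refl
  ⟦⟧≤1 false = z≤n

  remove : ∀ {m} → Fin m → (Fin m → Bool) → Fin m → Bool
  remove i A j = if does (i FP.≟ j) then false else A j

  remove-eq : ∀ {m} (i : Fin m) A → A i ≡ true → ∀ j → ⟦ A j ⟧ ≡ ⟦ remove i A j ⟧ + δ i j
  remove-eq i A Ai j with i FP.≟ j
  ... | yes refl = cong ⟦_⟧ Ai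
  ... | no _ = sym (+-identityʳ _)

  size : ∀ {m} → (Fin m → Bool) → ℕ
  size A = sum (λ i → ⟦ A i ⟧)

  size-remove : ∀ {m} (i : Fin m) A → A i ≡ true → size A ≡ suc (size (remove i A))
  size-remove i A Ai = trans (sum-cong (remove-eq i A Ai)) (trans (∑-distrib-+ (λ j → ⟦ remove i A j ⟧) (δ i))
    (trans (cong (size (remove i A) +_) (trans (sum-cong (λ j → sym (*-identityʳ (δ i j)))) (δ-sum i (λ _ → 1)))) (+-comm _ 1)))

  ∑³ : ∀ {m} → (Fin m → Fin m → Fin m → ℕ) → ℕ
  ∑³ f = sum (λ a → sum (λ b → sum (λ c → f a b c)))

  ∑³-cong : ∀ {m} {f g : Fin m → Fin m → Fin m → ℕ} → (∀ a b c → f a b c ≡ g a b c) → ∑³ f ≡ ∑³ g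
  ∑³-cong e = sum-cong (λ a → sum-cong (λ b → sum-cong (e a b)))

  ∑³-mono : ∀ {m} {f g : Fin m → Fin m → Fin m → ℕ} → (∀ a b c → f a b c ≤ g a b c) → ∑³ f ≤ ∑³ g
  ∑³-mono e = sum-mono (λ a → sum-mono (λ b → sum-mono (e a b)))

  ∑³-+ : ∀ {m} (f g : Fin m → Fin m → Fin m → ℕ) → ∑³ (λ a b c → f a b c + g a b c) ≡ ∑³ f + ∑³ g
  ∑³-+ f g = trans (sum-cong (λ a → trans (sum-cong (λ b → ∑-distrib-+ (f a b) (g a b))) (∑-distrib-+ (λ b → sum (f a b)) (λ b → sum (g a b)))))
    (∑-distrib-+ (λ a → sum (λ b → sum (f a b))) (λ a → sum (λ b → sum (g a b))))

  module _ {m : ℕ} (y : Fin m → Fin m → Fin m → ℕ) (y-swap : ∀ i j k → y i j k ≡ y i k j) (y-rotate : ∀ i j k → y i j k ≡ y j i k) where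

    degree : (Fin m → Bool) → Fin m → ℕ
    degree A i = sum (λ j → ⟦ A j ⟧ * sum (λ k → ⟦ A k ⟧ * y i j k))

    volume : (Fin m → Bool) → ℕ
    volume A = ∑³ (λ a b c → ⟦ A a ⟧ * (⟦ A b ⟧ * (⟦ A c ⟧ * y a b c)))

    degree-eq : ∀ A i → sum (λ b → sum (λ c → ⟦ A b ⟧ * (⟦ A c ⟧ * y i b c))) ≡ degree A i
    degree-eq A i = sum-cong (λ b → sym (*-distribˡ-sum ⟦ A b ⟧ (λ c → ⟦ A c ⟧ * y i b c)))

    volume-degree : ∀ A → volume A ≡ sum (λ i → ⟦ A i ⟧ * degree A i)
    volume-degree A = sum-cong (λ a → trans (sum-cong (λ b → sym (*-distribˡ-sum ⟦ A a ⟧ (λ c → ⟦ A b ⟧ * (⟦ A c ⟧ * y a b c)))))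
      (trans (sym (*-distribˡ-sum ⟦ A a ⟧ (λ b → sum (λ c → ⟦ A b ⟧ * (⟦ A c ⟧ * y a b c))))) (cong (⟦ A a ⟧ *_) (degree-eq A a))))

    module _ (A : Fin m → Bool) (i : Fin m) (Ai : A i ≡ true) where

      private
        A′ = remove i A
        F₁ F₂ F₃ : Fin m → Fin m → Fin m → ℕ
        F₁ a b c = δ i a * (⟦ A b ⟧ * (⟦ A c ⟧ * y a b c))
        F₂ a b c = ⟦ A a ⟧ * (δ i b * (⟦ A c ⟧ * y a b c))
        F₃ a b c = ⟦ A a ⟧ * (⟦ A b ⟧ * (δ i c * y a b c))

      -- A union bound: a triple lost by removing i has i in one of its three places.
      expand : ∀ a b c → ⟦ A a ⟧ * (⟦ A b ⟧ * (⟦ A c ⟧ * y a b c)) ≤ ⟦ A′ a ⟧ * (⟦ A′ b ⟧ * (⟦ A′ c ⟧ * y a b c)) + (F₁ a b c + (F₂ a b c + F₃ a b c))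
      expand a b c rewrite remove-eq i A Ai a | remove-eq i A Ai b | remove-eq i A Ai c = bound′ ⟦ A′ a ⟧ ⟦ A′ b ⟧ ⟦ A′ c ⟧ (δ i a) (δ i b) (δ i c) (y a b c)
        where
        open +-*-Solver using (solve; _:=_; _:+_; _:*_; con)
        bound′ : ∀ p q r d e f y → (p + d) * ((q + e) * ((r + f) * y)) ≤ p * (q * (r * y)) + (d * ((q + e) * ((r + f) * y)) + ((p + d) * (e * ((r + f) * y)) + (p + d) * ((q + e) * (f * y))))
        bound′ p q r d e f y = ≤-trans (m≤m+n _ ((d * (q * f) + (d * (e * r) + (2 * (d * (e * f)) + p * (e * f)))) * y)) (≤-reflexive
          (solve 7 (λ p q r d e f y → (p :+ d) :* ((q :+ e) :* ((r :+ f) :* y)) :+ (d :* (q :* f) :+ (d :* (e :* r) :+ (con 2 :* (d :* (e :* f)) :+ p :* (e :* f)))) :* y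
             := p :* (q :* (r :* y)) :+ (d :* ((q :+ e) :* ((r :+ f) :* y)) :+ ((p :+ d) :* (e :* ((r :+ f) :* y)) :+ (p :+ d) :* ((q :+ e) :* (f :* y))))) refl p q r d e f y))

      sum₁ : ∑³ F₁ ≡ degree A i
      sum₁ = trans (sum-cong (λ a → trans (sum-cong (λ b → sym (*-distribˡ-sum (δ i a) (λ c → ⟦ A b ⟧ * (⟦ A c ⟧ * y a b c))))) (sym (*-distribˡ-sum (δ i a) (λ b → sum (λ c → ⟦ A b ⟧ * (⟦ A c ⟧ * y a b c)))))))
        (trans (δ-sum i (λ a → sum (λ b → sum (λ c → ⟦ A b ⟧ * (⟦ A c ⟧ * y a b c))))) (degree-eq A i))

      sum₂ : ∑³ F₂ ≡ degree A i
      sum₂ = sum-cong (λ a → trans (sum-cong (λ b → trans (sym (*-distribˡ-sum ⟦ A a ⟧ (λ c → δ i b * (⟦ A c ⟧ * y a b c)))) (cong (⟦ A a ⟧ *_) (sym (*-distribˡ-sum (δ i b) (λ c → ⟦ A c ⟧ * y a b c))))))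
        (trans (sym (*-distribˡ-sum ⟦ A a ⟧ (λ b → δ i b * sum (λ c → ⟦ A c ⟧ * y a b c))))
          (cong (⟦ A a ⟧ *_) (trans (δ-sum i (λ b → sum (λ c → ⟦ A c ⟧ * y a b c))) (sum-cong (λ c → cong (⟦ A c ⟧ *_) (y-rotate a i c)))))))

      sum₃ : ∑³ F₃ ≡ degree A i
      sum₃ = sum-cong (λ a → trans (sum-cong (λ b → trans (sym (*-distribˡ-sum ⟦ A a ⟧ (λ c → ⟦ A b ⟧ * (δ i c * y a b c)))) (cong (⟦ A a ⟧ *_) (trans (sym (*-distribˡ-sum ⟦ A b ⟧ (λ c → δ i c * y a b c)))
          (cong (⟦ A b ⟧ *_) (trans (δ-sum i (λ c → y a b c)) (trans (y-swap a b i) (y-rotate a i b))))))))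
        (sym (*-distribˡ-sum ⟦ A a ⟧ (λ b → ⟦ A b ⟧ * y i a b))))

      -- By the symmetry of y, each of the three places of i accounts for the same degree.
      volume-remove : volume A ≤ volume A′ + 3 * degree A i
      volume-remove = ≤-trans (∑³-mono expand) (≤-reflexive (trans (∑³-+ _ (λ a b c → F₁ a b c + (F₂ a b c + F₃ a b c)))
        (cong (volume A′ +_) (trans (∑³-+ F₁ (λ a b c → F₂ a b c + F₃ a b c)) (trans (cong₂ _+_ sum₁ (trans (∑³-+ F₂ F₃) (cong₂ _+_ sum₂ sum₃))) (cong (λ t → degree A i + (degree A i + t)) (sym (+-identityʳ _))))))))

    Low : ℕ → (Fin m → Bool) → Fin m → Set
    Low D A i = A i ≡ true × 80 * (m * degree A i) < D

    -- Discarding points of low degree costs at most 3D/(80m) of the volume each.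
    prune : ∀ D V s A k → size A ≡ s → s + k ≡ m → 80 * (m * V) ≤ 80 * (m * volume A) + 3 * (D * k) →
            ∃[ B ] ((∀ i → ¬ Low D B i) × 80 * (m * V) ≤ 80 * (m * volume B) + 3 * (D * m))
    prune D V s A k sz sk h = cases s sz sk (FP.any? (λ i → (A i 𝔹.≟ true) ×-dec (80 * (m * degree A i) <? D)))
      where
      cases : ∀ s → size A ≡ s → s + k ≡ m → Dec (∃[ i ] Low D A i) → ∃[ B ] ((∀ i → ¬ Low D B i) × 80 * (m * V) ≤ 80 * (m * volume B) + 3 * (D * m))
      cases s sz sk (no none) = A , (λ i l → none (i , l)) , ≤-trans h (+-monoʳ-≤ (80 * (m * volume A)) (*-monoʳ-≤ 3 (*-monoʳ-≤ D (subst (k ≤_) sk (m≤n+m k s)))))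
      cases zero sz sk (yes (i , Ai , _)) = ⊥-elim (0≢1+n (trans (sym sz) (size-remove i A Ai)))
      cases (suc s) sz sk (yes (i , Ai , low)) = prune D V s (remove i A) (suc k) (suc-injective (trans (sym (size-remove i A Ai)) sz)) (trans (+-suc s k) sk) (begin
          80 * (m * V)                                               ≤⟨ h ⟩
          80 * (m * volume A) + 3 * (D * k)                          ≤⟨ +-monoˡ-≤ (3 * (D * k)) (*-monoʳ-≤ 80 (*-monoʳ-≤ m (volume-remove A i Ai))) ⟩
          80 * (m * (v + 3 * d)) + 3 * (D * k)                       ≡⟨ solve 5 (λ m v d D k → con 80 :* (m :* (v :+ con 3 :* d)) :+ con 3 :* (D :* k) := (con 80 :* (m :* v) :+ con 3 :* (D :* k)) :+ con 3 :* (con 80 :* (m :* d))) refl m v d D k ⟩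
          (80 * (m * v) + 3 * (D * k)) + 3 * (80 * (m * d))          ≤⟨ +-monoʳ-≤ (80 * (m * v) + 3 * (D * k)) (*-monoʳ-≤ 3 (<⇒≤ low)) ⟩
          (80 * (m * v) + 3 * (D * k)) + 3 * D                       ≡⟨ solve 4 (λ m v D k → (con 80 :* (m :* v) :+ con 3 :* (D :* k)) :+ con 3 :* D := con 80 :* (m :* v) :+ con 3 :* (D :* (con 1 :+ k))) refl m v D k ⟩
          80 * (m * v) + 3 * (D * suc k) ∎)
        where
        open ≤-Reasoning
        open +-*-Solver using (solve; _:=_; _:+_; _:*_; con)
        v = volume (remove i A)
        d = degree A i

    full : Fin m → Bool
    full _ = true

    volume-full : volume full ≡ ∑³ y
    volume-full = ∑³-cong {m} {λ a b c → 1 * (1 * (1 * y a b c))} {y} (λ a b c → trans (*-identityˡ (1 * (1 * y a b c))) (trans (*-identityˡ (1 * y a b c)) (*-identityˡ (y a b c))))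

    -- All removals together cost at most 3D/80, while the total weight is at least D/24. As 24 · 3
    -- = 72 < 80, some weight and hence some point remains.
    dense-part : ∀ {D} → 1 ≤ D → 1 ≤ m → D ≤ 24 * ∑³ y → ∃[ B ] ((∀ i → B i ≡ true → D ≤ 80 * (m * degree B i)) × ∃[ i ] B i ≡ true)
    dense-part {D} 1≤D 1≤m h = conclude (prune D (∑³ y) (size full) full 0 refl (trans (+-identityʳ _) (trans (sum-const m 1) (*-identityʳ m)))
        (≤-trans (≤-reflexive (cong (λ t → 80 * (m * t)) (sym volume-full))) (m≤m+n _ _)))
      where
      open +-*-Solver using (solve; _:=_; _:+_; _:*_; con)
      conclude : ∃[ B ] ((∀ i → ¬ Low D B i) × 80 * (m * ∑³ y) ≤ 80 * (m * volume B) + 3 * (D * m)) → ∃[ B ] ((∀ i → B i ≡ true → D ≤ 80 * (m * degree B i)) × ∃[ i ] B i ≡ true)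
      conclude (B , none , h′) = B , (λ i Bi → ≮⇒≥ (λ l → none i (Bi , l))) , nonempty (FP.any? (λ i → B i 𝔹.≟ true))
        where
        nonempty : Dec (∃[ i ] B i ≡ true) → ∃[ i ] B i ≡ true
        nonempty (yes p) = p
        nonempty (no empty) = ⊥-elim (<-irrefl refl (begin-strict
          72 * (D * m)                           <⟨ *-monoˡ-< (D * m) {{>-nonZero (*-mono-≤ 1≤D 1≤m)}} (n<1+n 72) ⟩
          73 * (D * m)                           ≤⟨ *-monoˡ-≤ (D * m) (m≤m+n 73 7) ⟩
          80 * (D * m)                           ≡⟨ cong (80 *_) (*-comm D m) ⟩
          80 * (m * D)                           ≤⟨ *-monoʳ-≤ 80 (*-monoʳ-≤ m h) ⟩
          80 * (m * (24 * ∑³ y))                 ≡⟨ solve 2 (λ m v → con 80 :* (m :* (con 24 :* v)) := con 24 :* (con 80 :* (m :* v))) refl m (∑³ y) ⟩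
          24 * (80 * (m * ∑³ y))                 ≤⟨ *-monoʳ-≤ 24 h′ ⟩
          24 * (80 * (m * volume B) + 3 * (D * m)) ≡⟨ cong (λ v → 24 * (80 * (m * v) + 3 * (D * m))) volume≡0 ⟩
          24 * (80 * (m * 0) + 3 * (D * m))      ≡⟨ solve 2 (λ m D → con 24 :* (con 80 :* (m :* con 0) :+ con 3 :* (D :* m)) := con 72 :* (D :* m)) refl m D ⟩
          72 * (D * m) ∎))
          where
          open ≤-Reasoning
          false-at : ∀ i → ⟦ B i ⟧ ≡ 0
          false-at i = at (B i) refl
            where
            at : ∀ b → B i ≡ b → ⟦ b ⟧ ≡ 0
            at true e = ⊥-elim (empty (i , e))
            at false _ = refl
          volume≡0 : volume B ≡ 0
          volume≡0 = trans (volume-degree B) (trans (sum-cong (λ i → cong (_* degree B i) (false-at i))) (trans (sum-const m 0) (*-zeroʳ m)))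

  record Enumeration {m : ℕ} (A : Fin m → Bool) : Set where
    field
      n : ℕ
      e : Fin n → Fin m
      selected : ∀ k → A (e k) ≡ true
      covers : ∀ i → A i ≡ true → ∃[ k ] e k ≡ i
      e-sum : ∀ (f : Fin m → ℕ) → sum (λ k → f (e k)) ≡ sum (λ i → ⟦ A i ⟧ * f i)

  enumerate : ∀ {m} (A : Fin m → Bool) → Enumeration A
  enumerate {zero} A = record { n = 0 ; e = λ () ; selected = λ () ; covers = λ () ; e-sum = λ f → refl }
  enumerate {suc m} A = extend (A zero) refl (enumerate (λ i → A (suc i)))
    where
    extend : ∀ b → A zero ≡ b → Enumeration (λ i → A (suc i)) → Enumeration A
    extend false A0 E = record
      { n = E.n ; e = λ k → suc (E.e k) ; selected = E.selected
      ; covers = λ { zero A0′ → ⊥-elim (clash (trans (sym A0) A0′)) ; (suc i) Ai → proj₁ (E.covers i Ai) , cong suc (proj₂ (E.covers i Ai)) }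
      ; e-sum = λ f → trans (E.e-sum (λ i → f (suc i))) (cong (λ b → ⟦ b ⟧ * f zero + sum (λ i → ⟦ A (suc i) ⟧ * f (suc i))) (sym A0)) }
      where
      module E = Enumeration E
      clash : ¬ (false ≡ true)
      clash ()
    extend true A0 E = record
      { n = suc E.n ; e = λ { zero → zero ; (suc k) → suc (E.e k) } ; selected = λ { zero → A0 ; (suc k) → E.selected k }
      ; covers = λ { zero _ → zero , refl ; (suc i) Ai → suc (proj₁ (E.covers i Ai)) , cong suc (proj₂ (E.covers i Ai)) }
      ; e-sum = λ f → trans (cong (f zero +_) (E.e-sum (λ i → f (suc i))))
          (trans (cong (_+ sum (λ i → ⟦ A (suc i) ⟧ * f (suc i))) (sym (*-identityˡ (f zero)))) (cong (λ b → ⟦ b ⟧ * f zero + sum (λ i → ⟦ A (suc i) ⟧ * f (suc i))) (sym A0))) }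
      where module E = Enumeration E

  -- A finite multiset of elements of X, known through the sums over it of functions that factor through π.
  record Bag {X Y : Set} (π : X → Y) (S : (Y → ℕ) → ℕ) : Set where
    field
      cardinality : ℕ
      element : Fin cardinality → X
      bag-sum : ∀ f → sum (λ r → f (π (element r))) ≡ S f

  module _ {X Y : Set} {π : X → Y} where

    emptyBag : Bag π (λ _ → 0)
    emptyBag = record { cardinality = 0 ; element = λ () ; bag-sum = λ f → refl }

    copies : ∀ k x → Bag π (λ f → k * f (π x))
    copies k x = record { cardinality = k ; element = λ _ → x ; bag-sum = λ f → sum-const k (f (π x)) }

    joinBags : ∀ {S S′} → Bag π S → Bag π S′ → Bag π (λ f → S f + S′ f)
    joinBags B B′ = record
      { cardinality = Bag.cardinality B + Bag.cardinality B′
      ; element = λ r → [ Bag.element B , Bag.element B′ ]′ (splitAt (Bag.cardinality B) r)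
      ; bag-sum = λ f → trans (sum-cong (λ r → pull f (splitAt (Bag.cardinality B) r)))
          (trans (sum-split (Bag.cardinality B) (λ r → f (π (Bag.element B r))) (λ r → f (π (Bag.element B′ r)))) (cong₂ _+_ (Bag.bag-sum B f) (Bag.bag-sum B′ f))) }
      where
      pull : ∀ f s → f (π ([ Bag.element B , Bag.element B′ ]′ s)) ≡ [ (λ r → f (π (Bag.element B r))) , (λ r → f (π (Bag.element B′ r))) ]′ s
      pull f (inj₁ _) = refl
      pull f (inj₂ _) = refl

    unionBags : ∀ {n} {S : Fin n → (Y → ℕ) → ℕ} → (∀ i → Bag π (S i)) → Bag π (λ f → sum (λ i → S i f))
    unionBags {zero} B = emptyBag
    unionBags {suc n} B = joinBags (B zero) (unionBags (λ i → B (suc i)))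

-- The constant of the rank bound.

module RankConstant where
  open import Data.Nat.Base
  open import Data.Nat.Properties using (≤ᵇ⇒≤)
  open import Relation.Binary.PropositionalEquality using (_≡_; refl)

  abstract
    -- The product of 80 from the pruning and 3072 from the rank bound; `abstract` keeps the numeral
    -- from being unfolded.
    C : ℕ
    C = 245760

    4≤C : 4 ≤ C
    4≤C = ≤ᵇ⇒≤ 4 245760 _

    C≡ : 80 * 3072 ≡ C
    C≡ = refl

-- Splitting off sets of points of low dimension.

module LowDimensionalPart (K : ACF₀) where
  open ACF₀ K using (Carrier; _≈_; 1≉0)
  module K = ACF₀ K
  open RationalLemmas using (last-true)
  open Norms K using (trivialNorm; trivialNorm-proper)
  open PivotElimination K
  open Dependence K
  open Weights K
  open DesignRank K using (design-rank)
  open NaturalSums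
  open Counting
  open Selections
  open RankConstant
  open import Data.Bool.Base using (Bool; true; false)
  open import Data.Nat.Base
  open import Data.Nat.Properties
  open import Data.Nat.Solver using (module +-*-Solver)
  open +-*-Solver using (solve; _:=_; _:+_; _:*_; con)
  open import Data.Fin.Base using (Fin; zero; suc)
  import Data.Fin.Properties as FP
  open import Data.Product using (∃-syntax; Σ-syntax; _×_; _,_; proj₁; proj₂)
  open import Data.Empty using (⊥; ⊥-elim)
  open import Relation.Nullary using (Dec; yes; no; ¬_; does)
  open import Relation.Nullary.Decidable using (_×-dec_)
  open import Relation.Binary.PropositionalEquality using (_≡_; _≢_; refl; sym; trans; cong; subst)
  open ≤-Reasoning

  ⟦does⟧ : ∀ {A : Set} (d : Dec A) → ⟦ does d ⟧ ≡ indicator d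
  ⟦does⟧ (yes _) = refl
  ⟦does⟧ (no _) = refl

  does-true : ∀ {A : Set} (d : Dec A) → does d ≡ true → A
  does-true (yes a) _ = a
  does-true (no _) ()

  from-does : ∀ {A : Set} (d : Dec A) → A → does d ≡ true
  from-does (yes _) _ = refl
  from-does (no h) a = ⊥-elim (h a)

  δ-sym : ∀ {n} (i j : Fin n) → δ i j ≡ δ j i
  δ-sym i j = indicator-cong (i FP.≟ j) (j FP.≟ i) sym sym

  restrict : ∀ {m n} → Subspace m → (Fin n → Fin m) → Subspace n
  restrict U e = record
    { member = λ h → ∃[ g ] (member U g × ∀ k → h k ≈ g (e k))
    ; ≈-closed = λ { h≈h′ (g , g∈ , eq) → g , g∈ , λ k → K.trans (K.sym (h≈h′ k)) (eq k) }
    ; +-closed = λ { (g , g∈ , eq) (g′ , g′∈ , eq′) → (λ i → g i K.+ g′ i) , +-closed U g∈ g′∈ , λ k → K.+-cong (eq k) (eq′ k) }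
    ; *-closed = λ { c (g , g∈ , eq) → (λ i → c K.* g i) , *-closed U c g∈ , λ k → K.*-congˡ (eq k) } }

  vanishing : ∀ {m n} → Subspace m → (Fin n → Fin m) → Subspace m
  vanishing U e = record
    { member = λ g → member U g × ∀ k → g (e k) ≈ K.0#
    ; ≈-closed = λ { g≈g′ (g∈ , v) → ≈-closed U g≈g′ g∈ , λ k → K.trans (K.sym (g≈g′ (e k))) (v k) }
    ; +-closed = λ { (g∈ , v) (g′∈ , v′) → +-closed U g∈ g′∈ , λ k → K.trans (K.+-cong (v k) (v′ k)) (K.+-identityˡ _) }
    ; *-closed = λ { c (g∈ , v) → *-closed U c g∈ , λ k → K.trans (K.*-congˡ (v k)) (K.zeroʳ c) } }

  combine : ∀ a b {M p t m k n} → 1 ≤ M → M * t ≤ a * (m * k) → k * p ≤ b * (M * n) → p * t ≤ (a * b) * (m * n)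
  combine a b {M} {p} {t} {m} {k} {n} 1≤M h₁ h₂ = *-cancelˡ-≤ M {{>-nonZero 1≤M}} (begin
    M * (p * t)               ≡⟨ solve 3 (λ M p t → M :* (p :* t) := p :* (M :* t)) refl M p t ⟩
    p * (M * t)               ≤⟨ *-monoʳ-≤ p h₁ ⟩
    p * (a * (m * k))         ≡⟨ solve 4 (λ p a m k → p :* (a :* (m :* k)) := a :* (m :* (k :* p))) refl p a m k ⟩
    a * (m * (k * p))         ≤⟨ *-monoʳ-≤ a (*-monoʳ-≤ m h₂) ⟩
    a * (m * (b * (M * n)))   ≡⟨ solve 5 (λ a m b M n → a :* (m :* (b :* (M :* n))) := M :* ((a :* b) :* (m :* n))) refl a m b M n ⟩
    M * ((a * b) * (m * n)) ∎)

  module _ {n : ℕ} {G : Fin n → Fin n → Fin n → ℕ} {M : ℕ} (G-swap : ∀ a b c → G a b c ≡ G a c b) (G-rotate : ∀ a b c → G a b c ≡ G b a c)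
           (G-load : ∀ a b → sum (G a b) ≤ M) where

    collapse : ∀ (j : Fin n) (f : Fin n → ℕ) → sum (λ a → f a * δ a j) ≡ f j
    collapse j f = trans (sum-cong (λ a → trans (*-comm (f a) (δ a j)) (cong (_* f a) (δ-sym a j)))) (δ-sum j f)

    collapse₂ : ∀ j l (f : Fin n → Fin n → ℕ) → sum (λ a → sum (λ b → f a b * (δ a j * δ b l))) ≡ f j l
    collapse₂ j l f = trans (sum-cong (λ a → trans (sum-cong (λ b → trans (cong (f a b *_) (*-comm (δ a j) (δ b l))) (sym (*-assoc (f a b) (δ b l) (δ a j)))))
      (trans (sym (*-distribʳ-sum (δ a j) (λ b → f a b * δ b l))) (cong (_* δ a j) (collapse l (f a)))))) (collapse j (λ a → f a l))

    pull : ∀ (f : Fin n → ℕ) d → sum (λ c → f c * d) ≡ sum f * d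
    pull f d = sym (*-distribʳ-sum d f)

    load₀₁ : ∀ j l → ∑³ (λ a b c → G a b c * (δ a j * δ b l)) ≤ M
    load₀₁ j l = ≤-trans (≤-reflexive (trans (sum-cong (λ a → sum-cong (λ b → pull (G a b) (δ a j * δ b l)))) (collapse₂ j l (λ a b → sum (G a b))))) (G-load j l)

    load₀₂ : ∀ j l → ∑³ (λ a b c → G a b c * (δ a j * δ c l)) ≤ M
    load₀₂ j l = ≤-trans (≤-reflexive (sum-cong (λ a → trans (∑-comm (λ b c → G a b c * (δ a j * δ c l)))
      (sum-cong (λ c → sum-cong (λ b → cong (_* (δ a j * δ c l)) (G-swap a b c))))))) (load₀₁ j l)

    load₁₂ : ∀ j l → ∑³ (λ a b c → G a b c * (δ b j * δ c l)) ≤ M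
    load₁₂ j l = ≤-trans (≤-reflexive (trans (∑-comm (λ a b → sum (λ c → G a b c * (δ b j * δ c l))))
      (sum-cong (λ b → sum-cong (λ a → sum-cong (λ c → cong (_* (δ b j * δ c l)) (G-rotate a b c))))))) (load₀₂ j l)

    commute : ∀ (s t : Fin n → Fin n → Fin n → ℕ) → ∑³ (λ a b c → G a b c * (s a b c * t a b c)) ≤ M → ∑³ (λ a b c → G a b c * (t a b c * s a b c)) ≤ M
    commute s t = ≤-trans (≤-reflexive (∑³-cong (λ a b c → cong (G a b c *_) (*-comm (t a b c) (s a b c)))))

    -- By symmetry every pair of positions reduces to the first two, for which the third point is
    -- summed out.
    load-any : ∀ j l x x′ → x ≢ x′ → ∑³ (λ a b c → G a b c * (δ (triple a b c x) j * δ (triple a b c x′) l)) ≤ M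
    load-any j l zero zero h = ⊥-elim (h refl)
    load-any j l zero (suc zero) h = load₀₁ j l
    load-any j l zero (suc (suc zero)) h = load₀₂ j l
    load-any j l (suc zero) zero h = commute (λ a b c → δ a l) (λ a b c → δ b j) (load₀₁ l j)
    load-any j l (suc zero) (suc zero) h = ⊥-elim (h refl)
    load-any j l (suc zero) (suc (suc zero)) h = load₁₂ j l
    load-any j l (suc (suc zero)) zero h = commute (λ a b c → δ a l) (λ a b c → δ c j) (load₀₂ l j)
    load-any j l (suc (suc zero)) (suc zero) h = commute (λ a b c → δ b l) (λ a b c → δ c j) (load₁₂ l j)
    load-any j l (suc (suc zero)) (suc (suc zero)) h = ⊥-elim (h refl)

    first-sum : ∀ j → ∑³ (λ a b c → G a b c * δ a j) ≡ sum (λ b → sum (G j b))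
    first-sum j = trans (sum-cong (λ a → trans (sum-cong (λ b → pull (G a b) (δ a j))) (pull (λ b → sum (G a b)) (δ a j)))) (collapse j (λ a → sum (λ b → sum (G a b))))

  enumeration-size : ∀ {m} (A : Fin m → Bool) → Enumeration.n (enumerate A) ≡ sum (λ i → ⟦ A i ⟧)
  enumeration-size A = trans (sym (trans (sum-const (Enumeration.n (enumerate A)) 1) (*-identityʳ _)))
    (trans (Enumeration.e-sum (enumerate A) (λ _ → 1)) (sum-cong (λ i → *-identityʳ ⟦ A i ⟧)))

  module _ {m : ℕ} (U : Subspace m) (T : Table U) {τ : ℕ} (1≤τ : 1 ≤ τ) (lcc : LCC U τ) where

    LowRank : (Fin m → Bool) → Set
    LowRank A = ∀ p → Rank≥ (restrict U (Enumeration.e (enumerate A))) p → p * (τ * τ) ≤ C * (m * Enumeration.n (enumerate A))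

    Part : Set
    Part = ∃[ A ] ((∀ i → A i ≡ true → NZ U T i) × (∃[ i ] A i ≡ true) × LowRank A)

    τ<m : ∀ {i} → NZ U T i → τ < m
    τ<m {i} ni = ≤-trans (≰⇒> (many-nonzero U T lcc i ni)) (#≤n (nz? U T))

    -- The points of a class are proportional, so the restriction has rank at most 1; the sizes 4μ >
    -- τ and m > τ pay for it.
    heavy-class : ∀ i → NZ U T i → τ < 4 * μ U T i → Part
    heavy-class i ni h = A , (λ j e → proj₁ (does-true (inClass? U T i j) e)) , (i , from-does (inClass? U T i i) (ni , Dep-first U)) , low
      where
      A : Fin m → Bool
      A j = does (inClass? U T i j)
      E = enumerate A
      open Enumeration E
      size≡μ : n ≡ μ U T i
      size≡μ = trans (enumeration-size A) (sum-cong (λ j → ⟦does⟧ (inClass? U T i j)))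
      parallel : ∀ k l → Par U (e k) (e l)
      parallel k l = let ek = does-true (inClass? U T i (e k)) (selected k) ; el = does-true (inClass? U T i (e l)) (selected l)
                     in Par-trans U (proj₂ ek) (Par-sym U (proj₁ el) (proj₂ el))
      τ²≤ : τ * τ ≤ C * (m * n)
      τ²≤ = begin
        τ * τ                ≤⟨ *-mono-≤ (<⇒≤ (τ<m ni)) (<⇒≤ h) ⟩
        m * (4 * μ U T i)    ≡⟨ trans (cong (λ t → m * (4 * t)) (sym size≡μ)) (solve 2 (λ m n → m :* (con 4 :* n) := con 4 :* (m :* n)) refl m n) ⟩
        4 * (m * n)          ≤⟨ *-monoˡ-≤ (m * n) 4≤C ⟩
        C * (m * n) ∎
      low : LowRank A
      low zero w = z≤n
      low (suc zero) w = ≤-trans (≤-reflexive (*-identityˡ (τ * τ))) τ²≤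
      low (suc (suc p)) w = ⊥-elim (impossible (∈U w zero))
        where
        impossible : ¬ (∃[ g ] (member U g × ∀ k → function w zero k ≈ g (e k)))
        impossible (g , g∈ , eq) = contradict (parallel (pivot w zero) (pivot w (suc zero)))
          where
          g-zero : g (e (pivot w (suc zero))) ≈ K.0#
          g-zero = K.trans (K.sym (eq (pivot w (suc zero)))) (at-other w (λ ()))
          contradict : ¬ Par U (e (pivot w zero)) (e (pivot w (suc zero)))
          contradict (α , β , d) = 1≉0 (K.trans (K.sym (at-own w zero)) (K.trans (eq (pivot w zero)) (K.trans (d g g∈)
            (K.trans (K.+-cong (K.trans (K.*-congˡ g-zero) (K.zeroʳ α)) (K.trans (K.*-congˡ g-zero) (K.zeroʳ β))) (K.+-identityˡ K.0#)))))

    -- With all classes of size at most τ/4, the weight estimate applies at the threshold v. The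
    -- dense part then becomes a system of three-term rows, in which each triple is repeated as
    -- often as its weight says.
    dense-class : ∀ i → NZ U T i → (∀ j → NZ U T j → 4 * μ U T j ≤ τ) → Part
    dense-class i₀ ni light = with-threshold (last-true (λ v → 4 * # (below? U T v) ≤? τ) below0 (suc m) below-all)
      where
      1≤m : 1 ≤ m
      1≤m = ≤-trans (s≤s z≤n) (τ<m ni)
      below0 : 4 * # (below? U T 0) ≤ τ
      below0 = ≤-trans (≤-reflexive (cong (4 *_) (trans (sum-cong (λ j → indicator-no (below? U T 0 j) (λ { (_ , ()) }))) (trans (sum-const m 0) (*-zeroʳ m))))) z≤n
      below-all : ¬ (4 * # (below? U T (suc m)) ≤ τ)
      below-all h = many-nonzero U T lcc i₀ ni (≤-trans (#-mono (nz? U T) (below? U T (suc m)) (λ j nj → nj , s≤s (#≤n (inClass? U T j)))) (≤-trans (m≤m+n _ _) h))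
      D : ℕ
      D = M U T * (τ * τ)
      1≤M : 1 ≤ M U T
      1≤M = 1≤n! m
      1≤D : 1 ≤ D
      1≤D = *-mono-≤ 1≤M (*-mono-≤ 1≤τ 1≤τ)
      with-threshold : ∃[ v ] (v < suc m × 4 * # (below? U T v) ≤ τ × ¬ (4 * # (below? U T (suc v)) ≤ τ)) → Part
      with-threshold (v , _ , hb , hb′) = from-dense (dense-part (y U T) (y-swap U T) (y-rotate U T) 1≤D 1≤m (total-weight U T lcc v hb (≰⇒> hb′) light))
        where
        from-dense : ∃[ B ] ((∀ i → B i ≡ true → D ≤ 80 * (m * degree (y U T) (y-swap U T) (y-rotate U T) B i)) × ∃[ i ] B i ≡ true) → Part
        from-dense (B , dense , i₁ , Bi₁) = B , nonzero , (i₁ , Bi₁) , low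
          where
          deg : Fin m → ℕ
          deg = degree (y U T) (y-swap U T) (y-rotate U T) B
          y-positive : ∀ i → 1 ≤ deg i → NZ U T i
          y-positive i 1≤deg zi = <-irrefl refl (≤-trans 1≤deg (≤-reflexive (trans (sum-cong (λ j → trans (cong (⟦ B j ⟧ *_) (trans (sum-cong (λ k → trans (cong (λ t → ⟦ B k ⟧ * (t * w U T (ℓ U T i j))) (indicator-no (col? U T i j k) (λ c → Col.nz₁ c zi))) (*-zeroʳ ⟦ B k ⟧))) (trans (sum-const m 0) (*-zeroʳ m)))) (*-zeroʳ ⟦ B j ⟧))) (trans (sum-const m 0) (*-zeroʳ m)))))
          nonzero : ∀ i → B i ≡ true → NZ U T i
          nonzero i Bi = y-positive i (n≢0⇒n>0 (λ deg≡0 → <-irrefl refl (≤-trans 1≤D (≤-trans (dense i Bi) (≤-reflexive (trans (cong (λ t → 80 * (m * t)) deg≡0) (cong (80 *_) (*-zeroʳ m))))))))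
          E = enumerate B
          open Enumeration E
          G : Fin n → Fin n → Fin n → ℕ
          G a b c = y U T (e a) (e b) (e c)
          G-load : ∀ a b → sum (G a b) ≤ M U T
          G-load a b = ≤-trans (≤-reflexive (e-sum (y U T (e a) (e b)))) (≤-trans (sum-mono (λ k → ≤-trans (*-monoˡ-≤ (y U T (e a) (e b) k) (⟦⟧≤1 (B k))) (≤-reflexive (*-identityˡ _)))) (y-load U T (e a) (e b)))
          Row : Set
          Row = Σ[ a ∈ Fin n ] Σ[ b ∈ Fin n ] Σ[ c ∈ Fin n ] Col U (e a) (e b) (e c)
          points : Row → Fin 3 → Fin n
          points (a , b , c , _) = triple a b c
          cell : ∀ a b c → Bag points (λ f → G a b c * f (triple a b c))
          cell a b c = at (col? U T (e a) (e b) (e c))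
            where
            at : (d : Dec (Col U (e a) (e b) (e c))) → Bag points (λ f → (indicator d * w U T (ℓ U T (e a) (e b))) * f (triple a b c))
            at (yes x) = copies (1 * w U T (ℓ U T (e a) (e b))) (a , b , c , x)
            at (no _) = emptyBag
          bag : Bag points (λ f → ∑³ (λ a b c → G a b c * f (triple a b c)))
          bag = unionBags (λ a → unionBags (λ b → unionBags (λ c → cell a b c)))
          R = Bag.cardinality bag
          element : Fin R → Row
          element = Bag.element bag
          row : Fin R → Fin 3 → Fin n
          row r = points (element r)
          relation : ∀ r → ThreeTerm U (triple (e (row r zero)) (e (row r (suc zero))) (e (row r (suc (suc zero)))))
          relation r = threeTerm (proj₂ (proj₂ (proj₂ (element r))))
          a a⁻¹ : Fin R → Fin 3 → Carrier
          a r = ThreeTerm.a (relation r)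
          a⁻¹ r = ThreeTerm.a⁻¹ (relation r)
          owned-degree : ∀ j → sum (λ r → δ (row r zero) j) ≡ deg (e j)
          owned-degree j = trans (Bag.bag-sum bag (λ t → δ (t zero) j)) (trans (first-sum {G = G} {M U T} (λ a b c → y-swap U T (e a) (e b) (e c)) (λ a b c → y-rotate U T (e a) (e b) (e c)) G-load j)
            (trans (sum-cong (λ b → e-sum (y U T (e j) (e b)))) (e-sum (λ b → sum (λ k → ⟦ B k ⟧ * y U T (e j) b k)))))
          low : LowRank B
          -- κ = k + 1 is the least integer with D ≤ 80mκ. Being least, it is at most every degree,
          -- hence at most the number of rows each point owns; the inequality itself turns κp ≤
          -- 3072Mn into the claimed bound.
          low p rank = with-κ (last-true (λ k → 80 * (m * k) <? D) (≤-trans (≤-reflexive (cong (λ t → suc (80 * t)) (*-zeroʳ m))) 1≤D) D too-large)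
            where
            too-large : ¬ (80 * (m * D) < D)
            too-large h = <-irrefl refl (<-≤-trans h (≤-trans (≤-reflexive (sym (*-identityˡ D))) (≤-trans (*-monoˡ-≤ D 1≤m) (m≤m+n (m * D) (79 * (m * D))))))
            with-κ : ∃[ k ] (k < D × 80 * (m * k) < D × ¬ (80 * (m * suc k) < D)) → p * (τ * τ) ≤ C * (m * n)
            with-κ (k , _ , lo , hi) = subst (λ t → p * (τ * τ) ≤ t * (m * n)) C≡ (combine 80 3072 {M U T} {p} {τ * τ} {m} {suc k} {n} 1≤M (≮⇒≥ hi) by-design)
              where
              κ≤owned : ∀ j → suc k ≤ sum (λ r → δ (row r zero) j)
              κ≤owned j = ≤-trans (≰⇒> (λ deg≤k → <-irrefl refl (<-≤-trans lo (≤-trans (dense (e j) (selected j)) (*-monoʳ-≤ 80 (*-monoʳ-≤ m deg≤k)))))) (≤-reflexive (sym (owned-degree j)))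
              by-design : suc k * p ≤ 3072 * (M U T * n)
              by-design = design-rank row a a⁻¹ (λ r → ThreeTerm.aa⁻¹≈1 (relation r)) (restrict U e)
                (λ { {h} (g , g∈ , eq) r → K.trans (K.+-cong (K.*-congˡ (eq (row r zero))) (K.+-cong (K.*-congˡ (eq (row r (suc zero)))) (K.+-congʳ (K.*-congˡ (eq (row r (suc (suc zero)))))))) (ThreeTerm.vanishes (relation r) g g∈) })
                {M U T} {suc k}
                (λ j l x x′ h → ≤-trans (≤-reflexive (Bag.bag-sum bag (λ t → δ (t x) j * δ (t x′) l)))
                   (load-any {G = G} (λ a b c → y-swap U T (e a) (e b) (e c)) (λ a b c → y-rotate U T (e a) (e b) (e c)) G-load j l x x′ h))
                (s≤s z≤n) κ≤owned rank

    low-dimensional-part : ∀ i → NZ U T i → Part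
    low-dimensional-part i ni = cases (FP.any? (λ j → nz? U T j ×-dec (τ <? 4 * μ U T j)))
      where
      cases : Dec (∃[ j ] (NZ U T j × τ < 4 * μ U T j)) → Part
      cases (yes (j , nj , h)) = heavy-class j nj h
      cases (no none) = dense-class i ni (λ j nj → ≮⇒≥ (λ h → none (j , nj , h)))

  module _ {m τ : ℕ} (1≤τ : 1 ≤ τ) where

    -- The costs of the successive parts add up to that of N points: the points of A are nonzero for
    -- U and zero for the functions vanishing on A, so no point is paid for twice. `F` is fuel,
    -- sufficient because every part is nonempty. The count is required for all tables, since one
    -- for the smaller space exists only under a double negation.
    rank-bound : ∀ F N → N ≤ F → (U : Subspace m) → LCC U τ → (∀ T → # (nz? U T) ≤ N) → ∀ {d} → Rank≥ U d → ¬ ¬ (d * (τ * τ) ≤ C * (m * N))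
    rank-bound F N N≤F U lcc few {d} w k = table U λ T → cases T (FP.any? (nz? U T))
      where
      cases : (T : Table U) → Dec (∃[ i ] NZ U T i) → ⊥
      cases T (no none) = k (≤-trans (≤-reflexive (cong (_* (τ * τ)) (rank-zero d w))) z≤n)
        where
        rank-zero : ∀ d → Rank≥ U d → d ≡ 0
        rank-zero zero _ = refl
        rank-zero (suc d) w = ⊥-elim (none (pivot w zero , λ z → 1≉0 (K.trans (K.sym (at-own w zero)) (z (function w zero) (∈U w zero)))))
      cases T (yes (i , ni)) = reduce F N≤F (low-dimensional-part U T 1≤τ lcc i ni)
        where
        reduce : ∀ F → N ≤ F → Part U T 1≤τ lcc → ⊥
        -- Elimination serves here as the rank-nullity theorem for the restriction to A; any proper
        -- norm will do.
        reduce F N≤F (A , A⊆NZ , (i₁ , Ai₁) , low) = elimination U e trivialNorm trivialNorm-proper w λ { (_ , _ , _ , result) →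
            let module R = Result result in
            descend F N≤F (R.p) (R.r) (R.p+r≡d) (low R.p (restricted R.c)) (record { function = function R.w ; ∈U = λ t → ∈U R.w t , R.w-vanish t ; pivot = pivot R.w ; at-own = at-own R.w ; at-other = at-other R.w }) }
          where
          open Enumeration (enumerate A)
          restricted : ∀ {p} → IdentityAt U e p → Rank≥ (restrict U e) p
          restricted c = record { function = λ q k → function c q (e k) ; ∈U = λ q → function c q , ∈U c q , (λ k → K.refl) ; pivot = pivot c ; at-own = at-own c ; at-other = at-other c }
          n≡ : n ≡ sum (λ i → ⟦ A i ⟧)
          n≡ = enumeration-size A
          1≤n : 1 ≤ n
          1≤n = ≤-trans (≤-reflexive (sym (cong ⟦_⟧ Ai₁))) (≤-trans (term≤sum (λ i → ⟦ A i ⟧) i₁) (≤-reflexive (sym n≡)))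
          U′ = vanishing U e
          Zero-vanishing : ∀ {i} → Zero U i → Zero U′ i
          Zero-vanishing z g (g∈ , _) = z g g∈
          Zero-selected : ∀ i → A i ≡ true → Zero U′ i
          Zero-selected i Ai g (_ , v) = K.trans (K.reflexive (cong g (sym (proj₂ (covers i Ai))))) (v (proj₁ (covers i Ai)))
          lcc′ : LCC U′ τ
          lcc′ P P? h i = weaken (lcc P P? h i)
            where
            weaken : ∃[ j ] ∃[ k ] (¬ P j × ¬ P k × Dep U i j k) → ∃[ j ] ∃[ k ] (¬ P j × ¬ P k × Dep U′ i j k)
            weaken (j , k , a , b , (α , β , d)) = j , k , a , b , (α , β , λ g g∈ → d g (proj₁ g∈))
          fewer : ∀ T′ → # (nz? U′ T′) + n ≤ N
          fewer T′ = ≤-trans (≤-reflexive (cong (# (nz? U′ T′) +_) n≡)) (≤-trans (≤-reflexive (sym (∑-distrib-+ (λ i → indicator (nz? U′ T′ i)) (λ i → ⟦ A i ⟧))))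
              (≤-trans (sum-mono (λ i → pointwise i (A i) refl)) (few T)))
            where
            pointwise : ∀ i b → A i ≡ b → indicator (nz? U′ T′ i) + ⟦ b ⟧ ≤ indicator (nz? U T i)
            pointwise i true Ai = ≤-reflexive (trans (cong (_+ 1) (indicator-no (nz? U′ T′ i) (λ nz′ → nz′ (Zero-selected i Ai)))) (sym (indicator-yes (nz? U T i) (A⊆NZ i Ai))))
            pointwise i false _ = ≤-trans (≤-reflexive (+-identityʳ _)) (indicator-mono (nz? U′ T′ i) (nz? U T i) (λ nz′ z → nz′ (Zero-vanishing z)))
          n≤N : n ≤ N
          n≤N = ≤-trans (≤-reflexive n≡) (≤-trans (sum-mono (λ i → pointwise i (A i) refl)) (few T))
            where
            pointwise : ∀ i b → A i ≡ b → ⟦ b ⟧ ≤ indicator (nz? U T i)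
            pointwise i true Ai = ≤-reflexive (sym (indicator-yes (nz? U T i) (A⊆NZ i Ai)))
            pointwise i false _ = z≤n
          descend : ∀ F → N ≤ F → ∀ p r → p + r ≡ d → p * (τ * τ) ≤ C * (m * n) → Rank≥ U′ r → ⊥
          descend zero N≤0 p r _ _ _ = <-irrefl refl (≤-trans 1≤n (≤-trans n≤N N≤0))
          descend (suc F) N≤F p r p+r≡d hp w′ = rank-bound F (N ∸ n) (≤-pred (≤-trans (smaller N n 1≤n n≤N) N≤F)) U′ lcc′
              (λ T′ → m+n≤o⇒m≤o∸n (# (nz? U′ T′)) (fewer T′)) w′ λ hr →
              k (begin
                d * (τ * τ)                                ≡⟨ cong (_* (τ * τ)) (sym p+r≡d) ⟩
                (p + r) * (τ * τ)                          ≡⟨ *-distribʳ-+ (τ * τ) p r ⟩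
                p * (τ * τ) + r * (τ * τ)                  ≤⟨ +-mono-≤ hp hr ⟩
                C * (m * n) + C * (m * (N ∸ n))            ≡⟨ solve 4 (λ c m n l → c :* (m :* n) :+ c :* (m :* l) := c :* (m :* (n :+ l))) refl C m n (N ∸ n) ⟩
                C * (m * (n + (N ∸ n)))                    ≡⟨ cong (λ t → C * (m * t)) (m+[n∸m]≡n n≤N) ⟩
                C * (m * N) ∎)
            where
            smaller : ∀ N n → 1 ≤ n → n ≤ N → suc (N ∸ n) ≤ N
            smaller (suc N) (suc n) _ _ = s≤s (m∸n≤m N n)

-- From affine configurations to spaces of functions.

module AffineConfigurations (K : ACF₀) where
  open ACF₀ K
  open RationalEmbedding K using (module KSolver)
  open PivotElimination K
  open Dependence K
  open Weights K
  open LowDimensionalPart K using (rank-bound)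
  open RankConstant using (C; 4≤C)
  module ℕΣ = NaturalSums
  open Counting using (#; #≤n)
  open RationalLemmas
  open import Data.Nat.Base as ℕ using (ℕ; zero; suc)
  import Data.Nat.Properties as ℕP
  open import Data.Integer.Base using (+_)
  open import Data.Fin.Base using (Fin; zero; suc)
  import Data.Fin.Properties as FP
  open import Data.Fin.Subset using (Subset; _∉_; ∣_∣)
  open import Data.Rational.Base as ℚ using (ℚ; 0ℚ; 1ℚ; _/_)
  import Data.Rational.Properties as ℚP
  open import Data.Rational.Solver using () renaming (module +-*-Solver to ℚSolver)
  open import Data.Vec.Base using (tabulate)
  open import Data.Vec.Properties using (lookup⇒[]=; lookup∘tabulate)
  open import Data.Product using (∃-syntax; _×_; _,_; proj₁; proj₂)
  open import Data.Sum using (_⊎_; inj₁; inj₂)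
  open import Data.Empty using (⊥; ⊥-elim)
  open import Relation.Nullary using (¬_; Dec; yes; no; does)
  open import Relation.Nullary.Decidable using (dec-true)
  open import Relation.Binary.PropositionalEquality as ≡ using (_≡_; _≢_)
  open import Relation.Binary.Reasoning.Setoid setoid
  open import Algebra.Properties.Semiring.Sum semiring using (sum; *-distribˡ-sum) renaming (sum-cong-≋ to sum-cong)

  open DesignRank K using (sum-zero)

  sumK≈sum : ∀ {n} (f : Fin n → Carrier) → sumK f ≈ sum f
  sumK≈sum {zero} f = refl
  sumK≈sum {suc n} f = +-congˡ (sumK≈sum (λ i → f (suc i)))

  record Functional (d : ℕ) : Set where
    field
      apply : Point K d → Carrier
      apply-cong : ∀ {u v} → (∀ l → u l ≈ v l) → apply u ≈ apply v
      apply-+ : ∀ u v → apply (λ l → u l + v l) ≈ apply u + apply v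
      apply-* : ∀ c u → apply (λ l → c * u l) ≈ c * apply u
  open Functional

  module _ {d : ℕ} where

    coordinate : Fin d → Functional d
    coordinate l = record { apply = λ v → v l ; apply-cong = λ e → e l ; apply-+ = λ u v → refl ; apply-* = λ c u → refl }

    _⊞_ : Functional d → Functional d → Functional d
    φ ⊞ ψ = record
      { apply = λ v → apply φ v + apply ψ v
      ; apply-cong = λ e → +-cong (apply-cong φ e) (apply-cong ψ e)
      ; apply-+ = λ u v → trans (+-cong (apply-+ φ u v) (apply-+ ψ u v)) (solve 4 (λ a b c d → (a :+ b) :+ (c :+ d) := (a :+ c) :+ (b :+ d)) refl (apply φ u) (apply φ v) (apply ψ u) (apply ψ v))
      ; apply-* = λ c u → trans (+-cong (apply-* φ c u) (apply-* ψ c u)) (sym (distribˡ c (apply φ u) (apply ψ u))) }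
      where open KSolver

    _⊡_ : Carrier → Functional d → Functional d
    a ⊡ φ = record
      { apply = λ v → a * apply φ v
      ; apply-cong = λ e → *-congˡ (apply-cong φ e)
      ; apply-+ = λ u v → trans (*-congˡ (apply-+ φ u v)) (distribˡ a (apply φ u) (apply φ v))
      ; apply-* = λ c u → trans (*-congˡ (apply-* φ c u)) (solve 3 (λ a c x → a :* (c :* x) := c :* (a :* x)) refl a c (apply φ u)) }
      where open KSolver

    combination : ∀ {k} → (Fin k → Carrier) → (Fin k → Functional d) → Functional d
    combination {zero} a φ = record
      { apply = λ _ → 0# ; apply-cong = λ _ → refl ; apply-+ = λ _ _ → sym (+-identityˡ 0#) ; apply-* = λ c _ → sym (zeroʳ c) }
    combination {suc k} a φ = (a zero ⊡ φ zero) ⊞ combination (λ q → a (suc q)) (λ q → φ (suc q))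

    combination-apply : ∀ {k} (a : Fin k → Carrier) φ v → apply (combination a φ) v ≈ sum (λ q → a q * apply (φ q) v)
    combination-apply {zero} a φ v = refl
    combination-apply {suc k} a φ v = +-congˡ (combination-apply (λ q → a (suc q)) (λ q → φ (suc q)) v)

    Independent : ∀ {k} → (Fin k → Point K d) → Set
    Independent {k} x = ∀ (c : Fin k → Carrier) → (∀ l → sum (λ i → c i * x i l) ≈ 0#) → ∀ i → c i ≈ 0#

    Dual : ∀ {k} → (Fin k → Point K d) → (Fin k → Functional d) → Set
    Dual x φ = (∀ q → apply (φ q) (x q) ≈ 1#) × (∀ q q′ → q ≢ q′ → apply (φ q) (x q′) ≈ 0#)

    sum-select : ∀ {k} (f : Fin k → Carrier) i → (∀ j → i ≢ j → f j ≈ 0#) → sum f ≈ f i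
    sum-select f zero h = trans (+-congˡ (sum-zero (λ j → h (suc j) (λ ())))) (+-identityʳ _)
    sum-select f (suc i) h = trans (+-cong (h zero (λ ())) (sum-select (λ j → f (suc j)) i (λ j i≢j → h (suc j) (λ e → i≢j (FP.suc-injective e))))) (+-identityˡ _)

    -- By independence, x₀ reduced modulo the other vectors has a nonzero coordinate. This
    -- coordinate, corrected to vanish on the others and normalised, is the functional dual to x₀;
    -- the earlier functionals are then corrected to vanish at x₀.
    dual-family : ∀ {k} (x : Fin k → Point K d) → Independent x → ¬ ¬ (∃[ φ ] Dual x φ)
    dual-family {zero} x ind k = k ((λ ()) , (λ ()) , λ ())
    dual-family {suc n} x ind k = dual-family (λ i → x (suc i)) tail-independent λ { (φ , own , other) →
      residual-coordinate φ λ { (l , yl≉0) → k (extend φ own other l yl≉0) } }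
      where
      x₀ = x zero
      xs = λ i → x (suc i)
      tail-independent : Independent xs
      tail-independent c h i = ind (λ { zero → 0# ; (suc j) → c j }) (λ l → trans (+-congʳ (zeroˡ (x₀ l))) (trans (+-identityˡ _) (h l))) (suc i)
      residual : (Fin n → Functional d) → Fin d → Carrier
      residual φ l = x₀ l - sum (λ q → xs q l * apply (φ q) x₀)
      residual-coordinate : ∀ φ → ¬ ¬ (∃[ l ] ¬ (residual φ l ≈ 0#))
      residual-coordinate φ k = ¬¬-Fin {P = λ l → residual φ l ≈ 0#} (λ l h → k (l , h)) λ vanish →
          1≉0 (ind (λ { zero → 1# ; (suc q) → - apply (φ q) x₀ }) (λ l → trans (+-cong (*-identityˡ (x₀ l)) (negated l)) (vanish l)) zero)
        where
        negated : ∀ l → sum (λ q → - apply (φ q) x₀ * xs q l) ≈ - sum (λ q → xs q l * apply (φ q) x₀)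
        negated l = begin
          sum (λ q → - apply (φ q) x₀ * xs q l)          ≈⟨ sum-cong (λ q → solve 3 (λ a x o → (:- a) :* x := (con (ℚ.- 1ℚ)) :* (x :* a)) refl (apply (φ q) x₀) (xs q l) 1#) ⟩
          sum (λ q → ι (ℚ.- 1ℚ) * (xs q l * apply (φ q) x₀))   ≈⟨ *-distribˡ-sum (ι (ℚ.- 1ℚ)) (λ q → xs q l * apply (φ q) x₀) ⟨
          ι (ℚ.- 1ℚ) * sum (λ q → xs q l * apply (φ q) x₀)     ≈⟨ solve 1 (λ s → con (ℚ.- 1ℚ) :* s := :- s) refl (sum (λ q → xs q l * apply (φ q) x₀)) ⟩
          - sum (λ q → xs q l * apply (φ q) x₀) ∎
          where
          open KSolver
          open RationalEmbedding K using (ι)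
      extend : ∀ φ → (∀ q → apply (φ q) (xs q) ≈ 1#) → (∀ q q′ → q ≢ q′ → apply (φ q) (xs q′) ≈ 0#) → ∀ l → ¬ (residual φ l ≈ 0#) → ∃[ ψ ] Dual x ψ
      extend φ own other l yl≉0 = ψ , (λ { zero → ψ₀-own ; (suc q) → ψ-own q }) ,
          (λ { zero zero h → ⊥-elim (h ≡.refl) ; zero (suc q) h → ψ₀-other q ; (suc q) zero h → ψ-at-0 q ; (suc q) (suc q′) h → ψ-other q q′ (λ e → h (≡.cong suc e)) })
        where
        open KSolver using (solve; _:=_; _:+_; _:*_; _:-_; :-_)
        s = proj₁ (inverse (residual φ l) yl≉0)
        ys≈1 = proj₂ (inverse (residual φ l) yl≉0)
        ψ₀ : Functional d
        ψ₀ = s ⊡ (coordinate l ⊞ ((- 1#) ⊡ combination (λ q → xs q l) φ))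
        ψ : Fin (suc n) → Functional d
        ψ zero = ψ₀
        ψ (suc q) = φ q ⊞ ((- apply (φ q) x₀) ⊡ ψ₀)
        ψ₀-apply : ∀ v → apply ψ₀ v ≈ s * (v l - sum (λ q → xs q l * apply (φ q) v))
        ψ₀-apply v = *-congˡ (+-congˡ (trans (-1*x≈-x _) (-‿cong (combination-apply (λ q → xs q l) φ v))))
          where open import Algebra.Properties.Ring ring using (-1*x≈-x)
        ψ₀-own : apply ψ₀ x₀ ≈ 1#
        ψ₀-own = trans (ψ₀-apply x₀) (trans (*-comm _ _) ys≈1)
        ψ₀-other : ∀ q → apply ψ₀ (xs q) ≈ 0#
        ψ₀-other q = trans (ψ₀-apply (xs q)) (trans (*-congˡ (trans (+-congˡ (-‿cong
            (trans (sum-select (λ q′ → xs q′ l * apply (φ q′) (xs q)) q (λ q′ h → trans (*-congˡ (other q′ q (λ e → h (≡.sym e)))) (zeroʳ _))) (trans (*-congˡ (own q)) (*-identityʳ _)))))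
          (-‿inverseʳ _))) (zeroʳ s))
        ψ-at-0 : ∀ q → apply (ψ (suc q)) x₀ ≈ 0#
        ψ-at-0 q = trans (+-congˡ (trans (*-congˡ ψ₀-own) (*-identityʳ _))) (-‿inverseʳ _)
        unchanged : ∀ q q′ → apply (ψ (suc q)) (xs q′) ≈ apply (φ q) (xs q′)
        unchanged q q′ = trans (+-congˡ (trans (*-congˡ (ψ₀-other q′)) (zeroʳ _))) (+-identityʳ _)
        ψ-own : ∀ q → apply (ψ (suc q)) (xs q) ≈ 1#
        ψ-own q = trans (unchanged q q) (own q)
        ψ-other : ∀ q q′ → q ≢ q′ → apply (ψ (suc q)) (xs q′) ≈ 0#
        ψ-other q q′ h = trans (unchanged q q′) (other q q′ h)

  module _ {d m : ℕ} (V : Fin m → Point K d) where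

    AffineCombination : Fin m → Fin m → Fin m → Carrier → Carrier → Set
    AffineCombination i j k α β = α + β ≈ 1# × (∀ l → V i l ≈ α * V j l + β * V k l)

    -- Contains the restrictions of all affine functions, so its rank is at least the dimension of the configuration.
    affineFunctions : Subspace m
    affineFunctions = record
      { member = λ g → ∀ i j k α β → AffineCombination i j k α β → g i ≈ α * g j + β * g k
      ; ≈-closed = λ e h i j k α β r → trans (sym (e i)) (trans (h i j k α β r) (+-cong (*-congˡ (e j)) (*-congˡ (e k))))
      ; +-closed = λ {f} {g} h h′ i j k α β r → trans (+-cong (h i j k α β r) (h′ i j k α β r))
          (solve 6 (λ a b x y z w → (a :* x :+ b :* y) :+ (a :* z :+ b :* w) := a :* (x :+ z) :+ b :* (y :+ w)) refl α β (f j) (f k) (g j) (g k))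
      ; *-closed = λ c {f} h i j k α β r → trans (*-congˡ (h i j k α β r))
          (solve 5 (λ c a b x y → c :* (a :* x :+ b :* y) := a :* (c :* x) :+ b :* (c :* y)) refl c α β (f j) (f k)) }
      where open KSolver

    -- The functionals dual to the differences from P, applied to v - P, are affine functions of v
    -- that form an identity matrix at the points `w (suc q)`.
    affine-rank : ∀ {k} (w : Fin (suc k) → Fin m) → AffinelyIndependent K (λ i → V (w i)) → ¬ ¬ Rank≥ affineFunctions k
    affine-rank {k} w ind κ = dual-family x independent λ { (φ , own , other) → κ (record
      { function = λ q i → apply (φ q) (shift (V i)) ; ∈U = λ q → respects (φ q) ; pivot = λ q → w (suc q) ; at-own = own ; at-other = λ {q} {q′} h → other q q′ h }) }
      where
      open KSolver using (solve; _:=_; _:+_; _:*_; _:-_; :-_)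
      P = V (w zero)
      shift : Point K d → Point K d
      shift v l = v l - P l
      x : Fin k → Point K d
      x q = shift (V (w (suc q)))
      independent : Independent x
      independent c h = ind c (λ l → trans (sumK≈sum (λ i → c i * x i l)) (h l))
      respects : ∀ φ → member affineFunctions (λ i → apply φ (shift (V i)))
      respects φ i j k α β (α+β≈1 , e) = begin
        apply φ (shift (V i))
          ≈⟨ apply-cong φ (λ l → begin
               V i l - P l                                             ≈⟨ +-cong (e l) (-‿cong (trans (sym (*-identityˡ (P l))) (*-congʳ (sym α+β≈1)))) ⟩
               (α * V j l + β * V k l) - (α + β) * P l                 ≈⟨ solve 5 (λ a b x y p → (a :* x :+ b :* y) :- (a :+ b) :* p := a :* (x :- p) :+ b :* (y :- p)) refl α β (V j l) (V k l) (P l) ⟩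
               α * (V j l - P l) + β * (V k l - P l) ∎) ⟩
        apply φ (λ l → α * shift (V j) l + β * shift (V k) l)
          ≈⟨ apply-+ φ (λ l → α * shift (V j) l) (λ l → β * shift (V k) l) ⟩
        apply φ (λ l → α * shift (V j) l) + apply φ (λ l → β * shift (V k) l)
          ≈⟨ +-cong (apply-* φ α (shift (V j))) (apply-* φ β (shift (V k))) ⟩
        α * apply φ (shift (V j)) + β * apply φ (shift (V k)) ∎

    subset-size : ∀ {n} {P : Fin n → Set} (P? : ∀ i → Dec (P i)) → ∣ tabulate (λ i → does (P? i)) ∣ ≡ # P?
    subset-size {zero} P? = ≡.refl
    subset-size {suc n} P? = head (P? zero) (subset-size (λ i → P? (suc i)))
      where
      head : ∀ {A : Set} (d : Dec A) {c} → ∣ tabulate (λ i → does (P? (suc i))) ∣ ≡ c → ∣ does d Data.Vec.Base.∷ tabulate (λ i → does (P? (suc i))) ∣ ≡ ℕΣ.indicator d ℕ.+ c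
      head (yes _) e = ≡.cong suc e
      head (no _) e = e

    -- The equation of the line is solved for the first point. This needs t ≠ 1, and t = 1 would
    -- identify the other two points.
    collinear-combination : ∀ {i j k} → DistinctCollinear K (V i) (V j) (V k) → ∃[ α ] ∃[ β ] AffineCombination i j k α β
    collinear-combination {i} {j} {k} (_ , _ , j≉k , t , e) = solved (inverse (1# - t) 1-t≉0)
      where
      open KSolver using (solve; _:=_; _:+_; _:*_; _:-_; :-_)
      1-t≉0 : ¬ (1# - t ≈ 0#)
      1-t≉0 h = j≉k (λ l → sym (begin
        V k l                                      ≈⟨ e l ⟩
        V i l + t * (V j l - V i l)                ≈⟨ +-congʳ (*-identityˡ (V i l)) ⟨
        1# * V i l + t * (V j l - V i l)           ≈⟨ solve 4 (λ o t a b → o :* a :+ t :* (b :- a) := (o :- t) :* (a :- b) :+ o :* b) refl 1# t (V i l) (V j l) ⟩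
        (1# - t) * (V i l - V j l) + 1# * V j l    ≈⟨ +-cong (trans (*-congʳ h) (zeroˡ _)) (*-identityˡ (V j l)) ⟩
        0# + V j l                                 ≈⟨ +-identityˡ (V j l) ⟩
        V j l ∎))
      solved : ∃[ s ] ((1# - t) * s ≈ 1#) → ∃[ α ] ∃[ β ] AffineCombination i j k α β
      solved (s , inv) = - (t * s) , s , total , λ l → sym (begin
          - (t * s) * V j l + s * V k l                           ≈⟨ +-congˡ (*-congˡ (trans (e l) (+-congʳ (sym (*-identityˡ (V i l)))))) ⟩
          - (t * s) * V j l + s * (1# * V i l + t * (V j l - V i l)) ≈⟨ solve 5 (λ t s a b o → (:- (t :* s)) :* b :+ s :* (o :* a :+ t :* (b :- a)) := ((o :- t) :* s) :* a) refl t s (V i l) (V j l) 1# ⟩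
          ((1# - t) * s) * V i l                                  ≈⟨ trans (*-congʳ inv) (*-identityˡ (V i l)) ⟩
          V i l ∎)
        where
        total : - (t * s) + s ≈ 1#
        total = trans (+-congˡ (sym (*-identityˡ s))) (trans (solve 3 (λ t s o → (:- (t :* s)) :+ o :* s := (o :- t) :* s) refl t s 1#) inv)

    affine-LCC : ∀ {δ τ} → fromℕ τ ℚ.≤ δ ℚ.* fromℕ m → IsLCC K δ V → LCC affineFunctions τ
    affine-LCC {δ} {τ} τ≤δm (_ , lcc) P P? few i = convert (lcc Δ small i)
      where
      Δ : Subset m
      Δ = tabulate (λ i → does (P? i))
      small : (+ ∣ Δ ∣) / 1 ℚ.≤ δ ℚ.* ((+ m) / 1)
      small = ≡.subst₂ ℚ._≤_ (≡.sym (/1≡fromℕ ∣ Δ ∣)) (≡.cong (δ ℚ.*_) (≡.sym (/1≡fromℕ m)))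
        (ℚP.≤-trans (fromℕ-mono-≤ (ℕP.≤-trans (ℕP.≤-reflexive (subset-size P?)) few)) τ≤δm)
      ∉⇒¬ : ∀ {j} → j ∉ Δ → ¬ P j
      ∉⇒¬ {j} j∉Δ p = j∉Δ (lookup⇒[]= j Δ (≡.trans (lookup∘tabulate (λ i → does (P? i)) j) (dec-true (P? j) p)))
      affine-dep : ∀ {j k} → ∃[ α ] ∃[ β ] AffineCombination i j k α β → Dep affineFunctions i j k
      affine-dep {j} {k} (α , β , r) = α , β , λ g g∈ → g∈ i j k α β r
      convert : ∃[ j ] ∃[ k ] (j ∉ Δ × k ∉ Δ × ((_≈ᵥ_ K (V i) (V j) ⊎ _≈ᵥ_ K (V i) (V k)) ⊎ DistinctCollinear K (V i) (V j) (V k))) → ∃[ j ] ∃[ k ] (¬ P j × ¬ P k × Dep affineFunctions i j k)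
      convert (j , k , j∉ , k∉ , c) = j , k , ∉⇒¬ j∉ , ∉⇒¬ k∉ , cases c
        where
        cases : ((_≈ᵥ_ K (V i) (V j) ⊎ _≈ᵥ_ K (V i) (V k)) ⊎ DistinctCollinear K (V i) (V j) (V k)) → Dep affineFunctions i j k
        cases (inj₁ (inj₁ e)) = affine-dep (1# , 0# , +-identityʳ 1# , λ l → trans (e l) (sym (trans (+-cong (*-identityˡ (V j l)) (zeroˡ (V k l))) (+-identityʳ (V j l)))))
        cases (inj₁ (inj₂ e)) = affine-dep (0# , 1# , +-identityˡ 1# , λ l → trans (e l) (sym (trans (+-cong (zeroˡ (V j l)) (*-identityˡ (V k l))) (+-identityˡ (V k l)))))
        cases (inj₂ distinct) = affine-dep (collinear-combination distinct)

    rank≤m : ∀ {k} → Rank≥ affineFunctions k → k ℕ.≤ m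
    rank≤m w = FP.injective⇒≤ {f = pivot w} λ {q} {q′} e → same q q′ e (q FP.≟ q′)
      where
      same : ∀ q q′ → pivot w q ≡ pivot w q′ → Dec (q ≡ q′) → q ≡ q′
      same q q′ e (yes h) = h
      same q q′ e (no h) = ⊥-elim (1≉0 (trans (sym (at-own w q)) (trans (reflexive (≡.cong (function w q) e)) (at-other w h))))

    module Conclusion {δ : ℚ} (δ>0 : 0ℚ ℚ.< δ) (δ≤1 : δ ℚ.≤ 1ℚ) (lcc : IsLCC K δ V) where

      instance
        δ+ : ℚ.Positive δ
        δ+ = ℚ.positive δ>0
        δ≢0 : ℚ.NonZero δ
        δ≢0 = ℚP.pos⇒nonZero δ

      r : ℚ
      r = ℚ.1/ δ

      rδ≡1 : r ℚ.* δ ≡ 1ℚ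
      rδ≡1 = ℚP.*-inverseˡ δ

      0<r : 0ℚ ℚ.< r
      0<r = ℚP.positive⁻¹ r {{ℚP.1/pos⇒pos δ}}

      0≤r : 0ℚ ℚ.≤ r
      0≤r = ℚP.<⇒≤ 0<r

      1≤r : 1ℚ ℚ.≤ r
      1≤r = ≡.subst₂ ℚ._≤_ rδ≡1 (ℚP.*-identityʳ r) (*-monoˡ 0≤r δ≤1)

      4C : ℕ
      4C = 4 ℕ.* C

      power-mono : ∀ n → r ^ℚ n ℚ.≤ r ^ℚ suc n
      power-mono n = ≡.subst (ℚ._≤ r ^ℚ suc n) (ℚP.*-identityˡ (r ^ℚ n)) (*-monoʳ (^-nonNeg n 0≤r) 1≤r)

      power≥ : ∀ n k → r ^ℚ n ℚ.≤ r ^ℚ (k ℕ.+ n)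
      power≥ n zero = ℚP.≤-refl
      power≥ n (suc k) = ℚP.≤-trans (power≥ n k) (power-mono (k ℕ.+ n))

      1≤4C : 1 ℕ.≤ 4C
      1≤4C = ℕP.≤-trans (ℕP.≤-trans (ℕP.≤ᵇ⇒≤ 1 4 _) 4≤C) (ℕP.m≤m+n C (3 ℕ.* C))

      m≤ : ∀ {t} → δ ℚ.* fromℕ m ℚ.≤ t → fromℕ m ℚ.≤ r ℚ.* t
      m≤ {t} h = ≡.subst (ℚ._≤ r ℚ.* t) (≡.trans (≡.sym (ℚP.*-assoc r δ (fromℕ m))) (≡.trans (≡.cong (ℚ._* fromℕ m) rδ≡1) (ℚP.*-identityˡ (fromℕ m)))) (*-monoˡ 0≤r h)

      -- In this case ⌊δm⌋ = 0 and the counting says nothing, but m < 1/δ, and the rank is at most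
      -- the number of points.
      small-case : ∀ {k} → δ ℚ.* fromℕ m ℚ.< fromℕ 1 → Rank≥ affineFunctions k → fromℕ k ℚ.≤ fromℕ 4C ℚ.* (r ^ℚ 9)
      small-case {k} h w = ℚP.≤-trans (fromℕ-mono-≤ (rank≤m w)) (ℚP.≤-trans (m≤ (ℚP.<⇒≤ h)) (ℚP.≤-trans (power≥ 1 8)
        (≡.subst (ℚ._≤ fromℕ 4C ℚ.* (r ^ℚ 9)) (ℚP.*-identityˡ (r ^ℚ 9)) (*-monoʳ (^-nonNeg 9 0≤r) (fromℕ-mono-≤ 1≤4C)))))

      -- From δm < τ + 1 ≤ 2τ it follows that m ≤ 2τ/δ, so Cm²/τ² is at most 4C/δ². As 1/δ ≥ 1,
      -- seven further factors only increase the bound.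
      large-case : ∀ {k} τ′ (let τ = suc τ′) → δ ℚ.* fromℕ m ℚ.< fromℕ (suc τ) → k ℕ.* (τ ℕ.* τ) ℕ.≤ C ℕ.* (m ℕ.* m) → fromℕ k ℚ.≤ fromℕ 4C ℚ.* (r ^ℚ 9)
      large-case {k} τ′ h bd = ℚP.≤-trans (*-cancelʳ {fromℕ k} {fromℕ 4C ℚ.* (r ^ℚ 2)} (*-pos 0<T 0<T) (≡.subst₂ ℚ._≤_ eqˡ eqʳ (ℚP.≤-trans (fromℕ-mono-≤ bd) (ℚP.≤-trans (ℚP.≤-reflexive eq-bd)
          (*-monoˡ (fromℕ-nonNeg C) (*-mono (fromℕ-nonNeg m) m≤2rτ (fromℕ-nonNeg m) m≤2rτ))))))
          (*-monoˡ (fromℕ-nonNeg 4C) (power≥ 2 7))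
        where
        τ = suc τ′
        T = fromℕ τ
        0<T : 0ℚ ℚ.< T
        0<T = fromℕ-mono-< {0} {τ} (ℕ.s≤s ℕ.z≤n)
        m≤2rτ : fromℕ m ℚ.≤ r ℚ.* (T ℚ.+ T)
        m≤2rτ = m≤ (ℚP.≤-trans (ℚP.<⇒≤ h) (ℚP.≤-trans (fromℕ-mono-≤ {suc τ} {τ ℕ.+ τ} (ℕ.s≤s (ℕP.≤-trans (ℕP.m≤n+m τ τ′) ℕP.≤-refl))) (ℚP.≤-reflexive (fromℕ-+ τ τ))))
        eq-bd : fromℕ (C ℕ.* (m ℕ.* m)) ≡ fromℕ C ℚ.* (fromℕ m ℚ.* fromℕ m)
        eq-bd = ≡.trans (fromℕ-* C (m ℕ.* m)) (≡.cong (fromℕ C ℚ.*_) (fromℕ-* m m))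
        eqˡ : fromℕ (k ℕ.* (τ ℕ.* τ)) ≡ fromℕ k ℚ.* (T ℚ.* T)
        eqˡ = ≡.trans (fromℕ-* k (τ ℕ.* τ)) (≡.cong (fromℕ k ℚ.*_) (fromℕ-* τ τ))
        eqʳ : fromℕ C ℚ.* ((r ℚ.* (T ℚ.+ T)) ℚ.* (r ℚ.* (T ℚ.+ T))) ≡ (fromℕ 4C ℚ.* (r ^ℚ 2)) ℚ.* (T ℚ.* T)
        eqʳ = ≡.trans (ℚSolver.solve 3 (λ c r t → c ℚSolver.:* ((r ℚSolver.:* (t ℚSolver.:+ t)) ℚSolver.:* (r ℚSolver.:* (t ℚSolver.:+ t)))
              ℚSolver.:= ((ℚSolver.con (fromℕ 4) ℚSolver.:* c) ℚSolver.:* (r ℚSolver.:* (r ℚSolver.:* ℚSolver.con 1ℚ))) ℚSolver.:* (t ℚSolver.:* t)) ≡.refl (fromℕ C) r T)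
            (≡.cong (λ z → (z ℚ.* (r ^ℚ 2)) ℚ.* (T ℚ.* T)) (≡.sym (fromℕ-* 4 C)))

      dimension-bound : ∀ {k} → Rank≥ affineFunctions k → ¬ ¬ (fromℕ k ℚ.≤ fromℕ 4C ℚ.* (r ^ℚ 9))
      dimension-bound {k} w κ = with-floor (floor (δ ℚ.* fromℕ m) (*-nonNeg (ℚP.<⇒≤ δ>0) (fromℕ-nonNeg m)))
        where
        with-floor : ∃[ τ ] (fromℕ τ ℚ.≤ δ ℚ.* fromℕ m × δ ℚ.* fromℕ m ℚ.< fromℕ (suc τ)) → ⊥
        with-floor (zero , _ , h) = κ (small-case h w)
        with-floor (suc τ , lo , hi) = rank-bound (ℕ.s≤s ℕ.z≤n) m m ℕP.≤-refl affineFunctions (affine-LCC {δ} lo lcc) (λ T → #≤n (nz? affineFunctions T)) w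
          λ bd → κ (large-case τ hi bd)

-- The dimension bound with its universal constant.

import Data.Nat.Base as ℕ
import Data.Nat.Properties as ℕP
import Data.Rational.Properties as ℚP
open import Data.Product using (_,_)
open import Relation.Nullary.Decidable using (decidable-stable)
open import Relation.Binary.PropositionalEquality using (subst; sym)
open import Data.Fin using (Fin)
open import Data.Product using (∃-syntax; _×_)
open import Data.Rational using (ℚ; 0ℚ; 1ℚ; _<_; _≤_)

theorem7p6 : ∃[ C ] (0ℚ < C ×
    ((K : ACF₀) (δ : ℚ) (δ>0 : 0ℚ < δ) → δ ≤ 1ℚ →
    ∀ {d m} (V : Fin m → Point K d) → IsLCC K δ V →
    DimAtMost K V (bound C δ δ>0)))
-- The factor 4 is the square of the 2 lost in rounding δm down to an integer.
theorem7p6 = fromℕ (4 ℕ.* C) , fromℕ-mono-< (ℕP.≤-trans (ℕP.≤ᵇ⇒≤ 1 4 _) (ℕP.≤-trans 4≤C (ℕP.m≤m+n C (3 ℕ.* C)))) ,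
  λ K δ δ>0 δ≤1 V lcc k w independent → decidable-stable (_ ℚP.≤? _) λ no →
    AffineConfigurations.affine-rank K V w independent λ rank →
    AffineConfigurations.Conclusion.dimension-bound K V δ>0 δ≤1 lcc rank λ k≤ →
    no (subst (_≤ _) (sym (/1≡fromℕ k)) k≤)
  where
  open RationalLemmas
  open RankConstant
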